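{- There exists a polynomially bounded function $m(n)$ such that the symmetrized determinant family $(\{T^{(n)}_{k,l}\}_{k,l\in[m(n)]})_{n\ge1}$ over $\operatorname{Mat}(\mathbb{F},m(n),m(n))$ with non-commuting variables is $\mathsf{VNP}_{\mathsf{A,\overline{C}}}$-complete under $c$-reductions: each of its members is in $\mathsf{VNP}_{\mathsf{A,\overline{C}}}$, and every family in $\mathsf{VNP}_{\mathsf{A,\overline{C}}}$ $c$-reduces to it.
   Context: Fix a field $\mathbb{F}$ of characteristic $0$ (e.g. $\mathbb{Q}$). For $n,m\ge1$ take non-commuting variables $y^{i,j}_{a,b}$ ($i,j\in[n]$, $a,b\in[m]$) and let $M$ be the $n\times n$ matrix whose $(i,j)$ entry is the $m\times m$ matrix $(y^{i,j}_{a,b})_{a,b}$ over the free algebra. Let $T=\mathsf{sdet}\,M$, where for an $n\times n$ matrix $(m_{ij})$ over an associative algebra $\mathsf{sdet} = \frac{1}{n!}\sum_{(\sigma,\tau)\in\mathsf{Sym}_n^2}(\operatorname{sgn}\sigma)(\operatorname{sgn}\tau)\, m_{\sigma(1)\tau(1)}\cdots m_{\sigma(n)\tau(n)}$ (ordered matrix products). $T^{(n)}_{k,l}$ is the $(k,l)$ entry of $T$ for $m=m(n)$, a non-commutative polynomial. $\mathsf{VP}_{\mathsf{A,\overline{C}}}$: families of non-commutative polynomials with polynomially bounded number of variables and degree computed by polynomial-size non-commutative arithmetic circuits. $\mathsf{VNP}_{\mathsf{A,\overline{C}}}$: families $f_n(x)=\sum_{e\in\{0,1\}^{r(n)}}g_n(x,e)$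 with $(g_n)\in\mathsf{VP}_{\mathsf{A,\overline{C}}}$ and $r$ polynomially bounded. A family $(f_n)$ $c$-reduces to a family $(h_n)$ if $f_n$ is computed by a polynomial-size non-commutative arithmetic circuit that may additionally use oracle gates computing members of $(h_j)$ with $j$ polynomially bounded in $n$. -}

module Defs where

open import Level using (Level; _⊔_) renaming (suc to lsuc; zero to lzero)
open import Algebra.Bundles using (CommutativeRing)
open import Data.Nat using (ℕ; zero; suc; _∸_; _^_; _≤_; _<_; _<?_; _≡ᵇ_; _<ᵇ_; _!)
open import Data.Nat using () renaming (_+_ to _+ℕ_; _*_ to _*ℕ_)
open import Data.Nat.Properties using (1≤n!)
open import Data.Bool using (Bool; true; false; if_then_else_; _∧_)
open import Data.Fin using (Fin; toℕ; fromℕ<)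
open import Data.List using (List; []; _∷_; map; foldr; concatMap; filter; allFin; length)
open import Data.Bool.ListAction using (all; and)
open import Data.Vec using (Vec; lookup) renaming ([] to []ᵥ; _∷_ to _∷ᵥ_)
open import Data.Product using (Σ; Σ-syntax; ∃; ∃-syntax; _×_; _,_; proj₁; proj₂)
open import Data.Empty using (⊥)
open import Relation.Binary.PropositionalEquality using (_≡_)
open import Data.Bool.Properties using (T?)
open import Relation.Nullary using (¬_; yes; no)
open import Relation.Nullary.Decidable using (⌊_⌋)
open import Data.Fin.Properties using () renaming (_≟_ to _≟F_)

ℕ→R : ∀ {c ℓ} (R : CommutativeRing c ℓ) → ℕ → CommutativeRing.Carrier R
ℕ→R R zero    = CommutativeRing.0# R
ℕ→R R (suc n) = CommutativeRing._+_ R (CommutativeRing.1# R) (ℕ→R R n)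

record CharZeroField c ℓ : Set (lsuc (c ⊔ ℓ)) where
  field
    commutativeRing : CommutativeRing c ℓ
  open CommutativeRing commutativeRing using (Carrier; _≈_; _*_; 0#; 1#)
  field
    inv         : (x : Carrier) → ¬ (x ≈ 0#) → Carrier
    inv-correct : ∀ x (p : ¬ (x ≈ 0#)) → x * inv x p ≈ 1#
    -- characteristic 0 (in particular 1 ≉ 0)
    char0       : ∀ n → ¬ (ℕ→R commutativeRing (suc n) ≈ 0#)

PolyBounded : (ℕ → ℕ) → Set
PolyBounded f = ∃[ c ] (∀ n → f n ≤ c *ℕ n ^ c +ℕ c)

module _ {c ℓ} (F : CharZeroField c ℓ) where
  open CharZeroField F
  open CommutativeRing commutativeRing using (Carrier; _≈_; _+_; _*_; -_; 0#; 1#)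

  -- Non-commutative polynomials F⟨x₀, x₁, ...⟩.
  -- A polynomial is presented by an expression; its meaning is its
  -- coefficient function on words (monomials = lists of variable indices).

  infixl 6 _⊕_
  infixl 7 _⊗_
  data NCPoly : Set c where
    var : ℕ → NCPoly
    cst : Carrier → NCPoly
    _⊕_ : NCPoly → NCPoly → NCPoly
    _⊗_ : NCPoly → NCPoly → NCPoly

  Word : Set
  Word = List ℕ

  splits : Word → List (Word × Word)
  splits []       = ([] , []) ∷ []
  splits (x ∷ xs) = ([] , x ∷ xs) ∷ map (λ uv → (x ∷ proj₁ uv , proj₂ uv)) (splits xs)

  sumF : List Carrier → Carrier
  sumF = foldr _+_ 0#

  coeff : NCPoly → Word → Carrier
  coeff (var i) (j ∷ []) = if i ≡ᵇ j then 1# else 0#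
  coeff (var i) _        = 0#
  coeff (cst a) []       = a
  coeff (cst a) (_ ∷ _)  = 0#
  coeff (p ⊕ q) w        = coeff p w + coeff q w
  coeff (p ⊗ q) w        = sumF (map (λ uv → coeff p (proj₁ uv) * coeff q (proj₂ uv)) (splits w))

  infix 4 _≃_
  _≃_ : NCPoly → NCPoly → Set ℓ
  p ≃ q = ∀ w → coeff p w ≈ coeff q w

  VarsBelow : ℕ → NCPoly → Set ℓ
  VarsBelow v p = ∀ w → all (λ i → i <ᵇ v) w ≡ false → coeff p w ≈ 0#

  DegLe : ℕ → NCPoly → Set ℓ
  DegLe d p = ∀ w → d < length w → coeff p w ≈ 0#

  subst : (ℕ → NCPoly) → NCPoly → NCPoly
  subst σ (var i) = σ i
  subst σ (cst a) = cst a
  subst σ (p ⊕ q) = subst σ p ⊕ subst σ q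
  subst σ (p ⊗ q) = subst σ p ⊗ subst σ q

  sumP : List NCPoly → NCPoly
  sumP = foldr _⊕_ (cst 0#)

  -- Non-commutative arithmetic circuits with oracle gates
  -- (straight-line programs; gate references point to earlier gates,
  --  index zero = the most recently added gate).
  -- An oracle gate labelled o with wiring ρ computes the oracle polynomial
  -- ⟦o⟧ with its variable xᵢ replaced by the value of gate ρ i.

  data Gate (O : Set) (k : ℕ) : Set c where
    inp : ℕ → Gate O k
    con : Carrier → Gate O k
    add : Fin k → Fin k → Gate O k
    mul : Fin k → Fin k → Gate O k
    orc : O → (ℕ → Fin k) → Gate O k

  infixl 5 _▷_
  data Circuit (O : Set) : ℕ → Set c where
    ∅   : Circuit O zero
    _▷_ : ∀ {k} → Circuit O k → Gate O k → Circuit O (suc k)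

  gateVal : ∀ {O k} → (O → NCPoly) → Gate O k → Vec NCPoly k → NCPoly
  gateVal ⟦_⟧ (inp i)   vs = var i
  gateVal ⟦_⟧ (con a)   vs = cst a
  gateVal ⟦_⟧ (add i j) vs = lookup vs i ⊕ lookup vs j
  gateVal ⟦_⟧ (mul i j) vs = lookup vs i ⊗ lookup vs j
  gateVal ⟦_⟧ (orc o ρ) vs = subst (λ i → lookup vs (ρ i)) ⟦ o ⟧

  values : ∀ {O k} → (O → NCPoly) → Circuit O k → Vec NCPoly k
  values ⟦_⟧ ∅       = []ᵥ
  values ⟦_⟧ (C ▷ g) = gateVal ⟦_⟧ g (values ⟦_⟧ C) ∷ᵥ values ⟦_⟧ C

  -- the output is the last gate; a circuit of type Circuit O (suc k) has size suc k
  output : ∀ {O k} → (O → NCPoly) → Circuit O (suc k) → NCPoly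
  output ⟦_⟧ C = lookup (values ⟦_⟧ C) Fin.zero
    where import Data.Fin as Fin

  noOracle : ⊥ → NCPoly
  noOracle ()

  -- VP and VNP (for families indexed by a type I with a size parameter
  -- sz : I → ℕ; ordinary families are indexed by ℕ with sz = id)

  InVP : (I : Set) → (I → ℕ) → (I → NCPoly) → Set (c ⊔ ℓ)
  InVP I sz f =
    Σ[ s ∈ (ℕ → ℕ) ] Σ[ v ∈ (ℕ → ℕ) ] Σ[ d ∈ (ℕ → ℕ) ]
      PolyBounded s × PolyBounded v × PolyBounded d ×
      (∀ i → VarsBelow (v (sz i)) (f i) × DegLe (d (sz i)) (f i) ×
             Σ[ k ∈ ℕ ] (suc k ≤ s (sz i) ×
               Σ[ C ∈ Circuit ⊥ (suc k) ] (output noOracle C ≃ f i)))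

  allBits : (r : ℕ) → List (Vec Bool r)
  allBits zero    = []ᵥ ∷ []
  allBits (suc r) = concatMap (λ b → map (b ∷ᵥ_) (allBits r)) (true ∷ false ∷ [])

  -- Convention: in g(x, e) the variables x₀..x_{r-1} of g are e₀..e_{r-1}
  -- and the variable x_{r+i} of g is the variable xᵢ.
  plugBits : (r : ℕ) → Vec Bool r → ℕ → NCPoly
  plugBits r e i with i <? r
  ... | yes i<r = cst (if lookup e (fromℕ< i<r) then 1# else 0#)
  ... | no  _   = var (i ∸ r)

  InVNP : (I : Set) → (I → ℕ) → (I → NCPoly) → Set (c ⊔ ℓ)
  InVNP I sz f =
    Σ[ g ∈ (I → NCPoly) ] InVP I sz g ×
      Σ[ r ∈ (ℕ → ℕ) ] PolyBounded r ×
        (∀ i → f i ≃ sumP (map (λ e → subst (plugBits (r (sz i)) e) (g i)) (allBits (r (sz i)))))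

  CReduces : (ℕ → NCPoly) → (I : Set) → (I → ℕ) → (I → NCPoly) → Set (c ⊔ ℓ)
  CReduces f I sz h =
    Σ[ s ∈ (ℕ → ℕ) ] Σ[ q ∈ (ℕ → ℕ) ] PolyBounded s × PolyBounded q ×
      (∀ n → Σ[ k ∈ ℕ ] (suc k ≤ s n ×
        Σ[ C ∈ Circuit (Σ[ i ∈ I ] sz i ≤ q n) (suc k) ]
          (output (λ o → h (proj₁ o)) C ≃ f n)))

  allMaps : (n k : ℕ) → List (Fin n → Fin k)
  allMaps zero    k = (λ ()) ∷ []
  allMaps (suc n) k = concatMap (λ a → map (λ f → cons a f) (allMaps n k)) (allFin k)
    where
    cons : Fin k → (Fin n → Fin k) → Fin (suc n) → Fin k
    cons a f Fin.zero    = a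
    cons a f (Fin.suc i) = f i
      where import Data.Fin as Fin

  pairs : (n : ℕ) → List (Fin n × Fin n)
  pairs n = filter (λ ij → toℕ (proj₁ ij) <? toℕ (proj₂ ij))
                   (concatMap (λ i → map (i ,_) (allFin n)) (allFin n))

  isInjective : ∀ {n} → (Fin n → Fin n) → Bool
  isInjective {n} σ = and (map (λ ij → if ⌊ σ (proj₁ ij) ≟F σ (proj₂ ij) ⌋ then false else true) (pairs n))

  perms : (n : ℕ) → List (Fin n → Fin n)
  perms n = filter (λ σ → T? (isInjective σ)) (allMaps n n)

  isEven : ℕ → Bool
  isEven zero          = true
  isEven (suc zero)    = false
  isEven (suc (suc n)) = isEven n

  inversions : ∀ {n} → (Fin n → Fin n) → ℕ
  inversions {n} σ = length (filter (λ ij → toℕ (σ (proj₂ ij)) <? toℕ (σ (proj₁ ij))) (pairs n))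

  sgn : ∀ {n} → (Fin n → Fin n) → Carrier
  sgn σ = if isEven (inversions σ) then 1# else - 1#

  Mat : ℕ → Set c
  Mat m = Fin m → Fin m → NCPoly

  idMat : ∀ {m} → Mat m
  idMat a b = if ⌊ a ≟F b ⌋ then cst 1# else cst 0#

  matMul : ∀ {m} → Mat m → Mat m → Mat m
  matMul {m} A B a b = sumP (map (λ e → A a e ⊗ B e b) (allFin m))

  matProd : ∀ {m} → List (Mat m) → Mat m
  matProd = foldr matMul idMat

  yIdx : (n m : ℕ) → Fin n → Fin n → Fin m → Fin m → ℕ
  yIdx n m i j a b = ((toℕ i *ℕ n +ℕ toℕ j) *ℕ m +ℕ toℕ a) *ℕ m +ℕ toℕ b

  block : (n m : ℕ) → Fin n → Fin n → Mat m
  block n m i j a b = var (yIdx n m i j a b)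

  n!≉0 : ∀ n → ¬ (ℕ→R commutativeRing (n !) ≈ 0#)
  n!≉0 n = lemma (n !) (1≤n! n)
    where
    lemma : ∀ k → 1 ≤ k → ¬ (ℕ→R commutativeRing k ≈ 0#)
    lemma (suc j) _ = char0 j

  sdetM : (n m : ℕ) → Mat m
  sdetM n m k l =
    cst (inv (ℕ→R commutativeRing (n !)) (n!≉0 n)) ⊗
      sumP (concatMap (λ σ → map (λ τ →
              cst (sgn σ * sgn τ) ⊗ matProd (map (λ i → block n m (σ i) (τ i)) (allFin n)) k l)
            (perms n)) (perms n))

  TIdx : (ℕ → ℕ) → Set
  TIdx m = Σ[ n ∈ ℕ ] (Fin (m n) × Fin (m n))

  TSize : (m : ℕ → ℕ) → TIdx m → ℕ
  TSize m = proj₁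

  TFam : (m : ℕ → ℕ) → TIdx m → NCPoly
  TFam m (n , k , l) = sdetM n (m n) k l

{-# OPTIONS --safe #-}
-- Membership. The two permutations in the symmetrized determinant are guessed as 0/1 matrices. A polynomial in the bits tests that each
-- row is a unit vector, the sign is a product over pairs of rows, and the ordered matrix product needs only one shared column per factor.
--
-- Hardness. On a block diagonal matrix only the terms with σ = τ survive and their signs cancel, so T becomes the sum over σ of the
-- ordered products D_σ(1) ⋯ D_σ(N). With blocks of size (N + 1) N the row index can hold the time and a state, so the factor at time t may
-- depend on t and on σ(t). If time t accepts only the values t and π(t), where π is a fixed permutation without fixed points, then the
-- admissible σ amount to one bit for each cycle of π, read at every time of the cycle. Hence T sums the runs of a nondeterministic
-- automaton over all bit vectors, where every bit can be read as often as the automaton needs. For f = Σ_e g(x, e) the automaton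
-- traverses the parse trees of the homogeneous components of a circuit for g; the bits consist of e and of the contents of the stack.
module Submission where

open import Defs
open import Level using (Level; _⊔_; Lift)
open import Algebra.Bundles using (CommutativeRing; Semiring)
import Algebra.Properties.Ring
open import Data.Bool using (Bool; true; false; if_then_else_; _∧_; T)
open import Data.Bool.ListAction using (and; all)
open import Data.Bool.Properties using (T?) renaming (_≟_ to _≟B_)
open import Data.Empty using (⊥; ⊥-elim)
open import Data.Fin using (Fin; fromℕ; zero; suc; toℕ; fromℕ<; combine; remQuot; splitAt; _↑ˡ_; _↑ʳ_)
open import Data.Fin.Properties using (toℕ<n; toℕ-injective; fromℕ<-toℕ; toℕ-fromℕ<; toℕ-fromℕ; toℕ-combine; combine-remQuot; remQuot-combine; splitAt-↑ˡ; splitAt-↑ʳ; splitAt⁻¹-↑ˡ; splitAt⁻¹-↑ʳ) renaming (_≟_ to _≟F_)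
open import Data.List as List using (List; []; _∷_; _++_; map; concatMap; filter; allFin; length)
open import Data.List.Properties using (++-assoc; length-++; map-∘; map-cong; map-tabulate; length-tabulate; length-map; length-filter) renaming (≡-dec to List-≡-dec)
open import Data.List.Membership.Propositional using (_∈_)
open import Data.List.Membership.Propositional.Properties using (∈-map⁺; ∈-++⁺ˡ; ∈-++⁺ʳ; ∈-deduplicate⁺; ∈-filter⁺; ∈-allFin)
open import Data.List.Relation.Unary.Unique.Propositional using (Unique)
open import Data.List.Relation.Unary.AllPairs using (_∷_)
open import Data.List.Relation.Unary.Unique.DecPropositional.Properties using (deduplicate-!)
open import Data.List.Base using (deduplicate)
open import Data.List.Relation.Unary.All as All using (All; []; _∷_)
open import Data.List.Relation.Unary.All.Properties using (all-filter)
open import Data.List.Relation.Unary.Any using (here; there)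
open import Data.Maybe using (Maybe; just; nothing)
open import Data.Nat using (ℕ; zero; suc; _∸_; _^_; _≤_; _<_; z≤n; s≤s; _≤?_; _<?_; _≡ᵇ_; _<ᵇ_; _!)
open import Data.Nat using () renaming (_+_ to _+ℕ_; _*_ to _*ℕ_; _≟_ to _≟ℕ_)
open import Data.Nat.Properties as ℕₚ using ()
open import Data.Product using (Σ-syntax; _×_; _,_; proj₁; proj₂; uncurry)
open import Data.Product.Properties using () renaming (≡-dec to ×-≡-dec)
open import Data.Sum using (_⊎_; inj₁; inj₂; [_,_]′)
open import Data.Unit using (⊤; tt)
open import Data.Vec as Vec using (Vec; lookup; tabulate; toList) renaming ([] to []ᵥ; _∷_ to _∷ᵥ_)
open import Data.Vec.Properties using (lookup∘tabulate; tabulate∘lookup; tabulate-cong; length-toList) renaming (≡-dec to Vec-≡-dec)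
open import Function using (_∘_; id)
open import Relation.Binary.PropositionalEquality as ≡ using (_≡_; _≗_; refl; cong; cong₂)
open import Relation.Binary using (DecidableEquality; tri<; tri≈; tri>)
import Relation.Binary.Reasoning.Setoid
open import Relation.Nullary using (Dec; yes; no; does; ¬_)
open import Relation.Nullary.Decidable using (⌊_⌋; dec-true; dec-false)

-- A circuit of polynomial size can have exponential formal degree, and its output has to agree with
-- `g` only after cancellation. Hence parse trees are formed only for the components of degree 1 up
-- to the degree bound of `g`; the monomials above it cancel in total, and degree 0 is a single
-- constant. Factors of degree 0 are replaced by scalars, so that a traversal spends one leaf per
-- unit of degree and has polynomially many steps. An automaton with polynomially many states cannot
-- remember a stack, but a bit keeps its value during the whole run. A pair is compared with its
-- cell when a multiplication schedules it and again when a leaf resumes there. Each cell is loaded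
-- exactly once, so a parse tree determines the contents of all cells and is counted once. A slot
-- reads a single bit, so one step of the automaton takes a round over all r bits. With as many
-- rounds as states, R of each, there are N = R r slots, and the N + 1 times, R states and a padding
-- coordinate of range r fill the dimension (N + 1) N, which depends on N alone. The factor 1 / N!
-- is undone by a constant gate.

-- Polynomial bounds

PolyBounded-const : ∀ a → PolyBounded (λ _ → a)
PolyBounded-const a = a , λ n → ℕₚ.m≤n+m a (a *ℕ n ^ a)

PolyBounded-id : PolyBounded (λ n → n)
PolyBounded-id = 1 , λ n → ℕₚ.≤-trans (ℕₚ.≤-reflexive (≡.sym (≡.trans (ℕₚ.*-identityˡ (n ^ 1)) (ℕₚ.^-identityʳ n)))) (ℕₚ.m≤m+n (1 *ℕ n ^ 1) 1)

-- Unlike c * n ^ c + c, the bounds a * (1 + n) ^ b are closed under products.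
PowerBounded : (ℕ → ℕ) → Set
PowerBounded f = Σ[ a ∈ ℕ ] Σ[ b ∈ ℕ ] (∀ n → f n ≤ a *ℕ suc n ^ b)

toPower : ∀ {f} → PolyBounded f → PowerBounded f
toPower {f} (c , f≤) = c +ℕ c , c , λ n → begin
  f n                                ≤⟨ f≤ n ⟩
  c *ℕ n ^ c +ℕ c                    ≤⟨ ℕₚ.+-mono-≤ (ℕₚ.*-monoʳ-≤ c (ℕₚ.^-monoˡ-≤ c (ℕₚ.n≤1+n n))) (ℕₚ.m≤m*n c (suc n ^ c) {{ℕₚ.m^n≢0 (suc n) c}}) ⟩
  c *ℕ suc n ^ c +ℕ c *ℕ suc n ^ c   ≡⟨ ℕₚ.*-distribʳ-+ (suc n ^ c) c c ⟨
  (c +ℕ c) *ℕ suc n ^ c              ∎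
  where open ℕₚ.≤-Reasoning

^-distribʳ-* : ∀ b m n → (m *ℕ n) ^ b ≡ m ^ b *ℕ n ^ b
^-distribʳ-* zero m n = refl
^-distribʳ-* (suc b) m n = ≡.trans (cong (m *ℕ n *ℕ_) (^-distribʳ-* b m n)) (ℕₚ.[m*n]*[o*p]≡[m*o]*[n*p] m n (m ^ b) (n ^ b))

fromPower : ∀ {f} → PowerBounded f → PolyBounded f
fromPower {f} (a , b , f≤) = c , bound
  where
  open ℕₚ.≤-Reasoning
  c : ℕ
  -- For positive n, `suc n` is at most `2 * n`, so `a * 2 ^ b` serves as factor and `b` as
  -- exponent; the summand `a` covers n = 0.
  c = a *ℕ 2 ^ b +ℕ a +ℕ b
  a≤c : a ≤ c
  a≤c = ℕₚ.≤-trans (ℕₚ.m≤n+m a (a *ℕ 2 ^ b)) (ℕₚ.m≤m+n _ b)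
  bound : ∀ n → f n ≤ c *ℕ n ^ c +ℕ c
  bound zero = begin
    f 0                ≤⟨ f≤ 0 ⟩
    a *ℕ 1 ^ b         ≡⟨ cong (a *ℕ_) (ℕₚ.^-zeroˡ b) ⟩
    a *ℕ 1             ≡⟨ ℕₚ.*-identityʳ a ⟩
    a                  ≤⟨ a≤c ⟩
    c                  ≤⟨ ℕₚ.m≤n+m c (c *ℕ 0 ^ c) ⟩
    c *ℕ 0 ^ c +ℕ c    ∎
  bound n@(suc k) = begin
    f n                       ≤⟨ f≤ n ⟩
    a *ℕ suc n ^ b            ≤⟨ ℕₚ.*-monoʳ-≤ a (ℕₚ.^-monoˡ-≤ b 1+n≤2n) ⟩
    a *ℕ (2 *ℕ n) ^ b         ≡⟨ cong (a *ℕ_) (^-distribʳ-* b 2 n) ⟩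
    a *ℕ (2 ^ b *ℕ n ^ b)     ≡⟨ ℕₚ.*-assoc a (2 ^ b) (n ^ b) ⟨
    a *ℕ 2 ^ b *ℕ n ^ b       ≤⟨ ℕₚ.*-mono-≤ (ℕₚ.≤-trans (ℕₚ.m≤m+n (a *ℕ 2 ^ b) a) (ℕₚ.m≤m+n _ b)) (ℕₚ.^-monoʳ-≤ n (ℕₚ.m≤n+m b (a *ℕ 2 ^ b +ℕ a))) ⟩
    c *ℕ n ^ c                ≤⟨ ℕₚ.m≤m+n _ c ⟩
    c *ℕ n ^ c +ℕ c           ∎
    where
    1+n≤2n : suc n ≤ 2 *ℕ n
    1+n≤2n = ℕₚ.≤-trans (ℕₚ.+-monoˡ-≤ n (s≤s z≤n)) (ℕₚ.≤-reflexive (cong (n +ℕ_) (≡.sym (ℕₚ.+-identityʳ n))))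

PolyBounded-* : ∀ {f g} → PolyBounded f → PolyBounded g → PolyBounded (λ n → f n *ℕ g n)
PolyBounded-* {f} {g} pf pg with toPower pf | toPower pg
... | a , b , f≤ | a′ , b′ , g≤ = fromPower (a *ℕ a′ , b +ℕ b′ , λ n → begin
  f n *ℕ g n                                  ≤⟨ ℕₚ.*-mono-≤ (f≤ n) (g≤ n) ⟩
  a *ℕ suc n ^ b *ℕ (a′ *ℕ suc n ^ b′)        ≡⟨ ℕₚ.[m*n]*[o*p]≡[m*o]*[n*p] a _ a′ _ ⟩
  a *ℕ a′ *ℕ (suc n ^ b *ℕ suc n ^ b′)        ≡⟨ cong (a *ℕ a′ *ℕ_) (ℕₚ.^-distribˡ-+-* (suc n) b b′) ⟨
  a *ℕ a′ *ℕ suc n ^ (b +ℕ b′)                ∎)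
  where open ℕₚ.≤-Reasoning

PolyBounded-+ : ∀ {f g} → PolyBounded f → PolyBounded g → PolyBounded (λ n → f n +ℕ g n)
PolyBounded-+ {f} {g} pf pg with toPower pf | toPower pg
... | a , b , f≤ | a′ , b′ , g≤ = fromPower (a +ℕ a′ , b +ℕ b′ , λ n → begin
  f n +ℕ g n                                            ≤⟨ ℕₚ.+-mono-≤ (f≤ n) (g≤ n) ⟩
  a *ℕ suc n ^ b +ℕ a′ *ℕ suc n ^ b′                    ≤⟨ ℕₚ.+-mono-≤ (ℕₚ.*-monoʳ-≤ a (ℕₚ.^-monoʳ-≤ (suc n) (ℕₚ.m≤m+n b b′))) (ℕₚ.*-monoʳ-≤ a′ (ℕₚ.^-monoʳ-≤ (suc n) (ℕₚ.m≤n+m b′ b))) ⟩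
  a *ℕ suc n ^ (b +ℕ b′) +ℕ a′ *ℕ suc n ^ (b +ℕ b′)     ≡⟨ ℕₚ.*-distribʳ-+ _ a a′ ⟨
  (a +ℕ a′) *ℕ suc n ^ (b +ℕ b′)                        ∎)
  where open ℕₚ.≤-Reasoning

-- Boolean tests and finite types

allᵇ : ∀ {n} → (Fin n → Bool) → Bool
allᵇ {zero}  t = true
allᵇ {suc n} t = t zero ∧ allᵇ (t ∘ suc)

allᵇ⇒ : ∀ {n} {t : Fin n → Bool} → allᵇ t ≡ true → ∀ i → t i ≡ true
allᵇ⇒ {suc n} {t} eq i       with t zero in eq₀
allᵇ⇒ {suc n} {t} eq zero    | true = eq₀
allᵇ⇒ {suc n} {t} eq (suc i) | true = allᵇ⇒ eq i

⇒allᵇ : ∀ {n} {t : Fin n → Bool} → (∀ i → t i ≡ true) → allᵇ t ≡ true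
⇒allᵇ {zero}  h = refl
⇒allᵇ {suc n} h rewrite h zero = ⇒allᵇ (h ∘ suc)

does⇒ : ∀ {p} {P : Set p} (P? : Dec P) → does P? ≡ true → P
does⇒ (yes p) _ = p

Bool-⇔ : ∀ {a b} → (a ≡ true → b ≡ true) → (b ≡ true → a ≡ true) → a ≡ b
Bool-⇔ {false} {false} f g = refl
Bool-⇔ {false} {true}  f g = g refl
Bool-⇔ {true}  {b}     f g = ≡.sym (f refl)

does-⇔ : ∀ {p q} {P : Set p} {Q : Set q} (P? : Dec P) (Q? : Dec Q) → (P → Q) → (Q → P) → does P? ≡ does Q?
does-⇔ P? Q? f g = Bool-⇔ (λ e → dec-true Q? (f (does⇒ P? e))) (λ e → dec-true P? (g (does⇒ Q? e)))

∧-⇒ˡ : ∀ {a b} → a ∧ b ≡ true → a ≡ true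
∧-⇒ˡ {true} _ = refl

∧-⇒ʳ : ∀ {a b} → a ∧ b ≡ true → b ≡ true
∧-⇒ʳ {true} e = e

infixr 6 _×F_
infix 8 _^F_

record Finite (X : Set) : Set where
  field
    elements : List X
    _≟_      : DecidableEquality X

open Finite

vecs : ∀ {X : Set} n → List X → List (Vec X n)
vecs zero    xs = []ᵥ ∷ []
vecs (suc n) xs = concatMap (λ x → map (x ∷ᵥ_) (vecs n xs)) xs

FinF : ∀ n → Finite (Fin n)
FinF n = record { elements = allFin n ; _≟_ = _≟F_ }

BoolF : Finite Bool
BoolF = record { elements = true ∷ false ∷ [] ; _≟_ = _≟B_ }

_×F_ : ∀ {X Y} → Finite X → Finite Y → Finite (X × Y)
X ×F Y = record
  { elements = concatMap (λ x → map (x ,_) (elements Y)) (elements X)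
  ; _≟_      = ×-≡-dec (_≟_ X) (_≟_ Y) }

_^F_ : ∀ {X} → Finite X → ∀ n → Finite (Vec X n)
X ^F n = record { elements = vecs n (elements X) ; _≟_ = Vec-≡-dec (_≟_ X) }

-- Expanding a product yields one test per factor; merged into a single equality of vectors, these
-- tests can be evaluated by `Delta-Vec`.
does-Vec : ∀ {X : Set} (_≟X_ : DecidableEquality X) {n} (v : Vec X n) (f : Fin n → X) →
           does (Vec-≡-dec _≟X_ v (tabulate f)) ≡ allᵇ (λ i → does (lookup v i ≟X f i))
does-Vec _≟X_ v f = Bool-⇔
  (λ e → ⇒allᵇ λ i → dec-true (lookup v i ≟X f i)
    (≡.trans (cong (λ u → lookup u i) (does⇒ (Vec-≡-dec _≟X_ v (tabulate f)) e)) (lookup∘tabulate f i)))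
  (λ e → dec-true (Vec-≡-dec _≟X_ v (tabulate f))
    (≡.trans (≡.sym (tabulate∘lookup v)) (tabulate-cong λ i → does⇒ (lookup v i ≟X f i) (allᵇ⇒ e i))))

-- Guarded finite sums and matrix products over a semiring

module Sums {a ℓ} (S : Semiring a ℓ) where
  open Semiring S renaming (Carrier to A; refl to ≈-refl) hiding (zero)
  open import Relation.Binary.Reasoning.Setoid setoid

  private variable
    x y : Level
    X : Set x
    Y : Set y

  ∑ : List X → (X → A) → A
  ∑ []       f = 0#
  ∑ (x ∷ xs) f = f x + ∑ xs f

  infixr 8 _▸_
  _▸_ : Bool → A → A
  b ▸ x = if b then x else 0#

  ∑-cong : (xs : List X) {f g : X → A} → (∀ x → f x ≈ g x) → ∑ xs f ≈ ∑ xs g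
  ∑-cong []       h = ≈-refl
  ∑-cong (x ∷ xs) h = +-cong (h x) (∑-cong xs h)

  ∑-zero : (xs : List X) {f : X → A} → (∀ x → f x ≈ 0#) → ∑ xs f ≈ 0#
  ∑-zero []       h = ≈-refl
  ∑-zero (x ∷ xs) h = trans (+-cong (h x) (∑-zero xs h)) (+-identityˡ 0#)

  +-interchange : ∀ a b c d → (a + b) + (c + d) ≈ (a + c) + (b + d)
  +-interchange a b c d = begin
    (a + b) + (c + d)   ≈⟨ +-assoc a b (c + d) ⟩
    a + (b + (c + d))   ≈⟨ +-congˡ (+-assoc b c d) ⟨
    a + ((b + c) + d)   ≈⟨ +-congˡ (+-congʳ (+-comm b c)) ⟩
    a + ((c + b) + d)   ≈⟨ +-congˡ (+-assoc c b d) ⟩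
    a + (c + (b + d))   ≈⟨ +-assoc a c (b + d) ⟨
    (a + c) + (b + d)   ∎

  ∑-+ : (xs : List X) (f g : X → A) → ∑ xs (λ x → f x + g x) ≈ ∑ xs f + ∑ xs g
  ∑-+ []       f g = sym (+-identityˡ 0#)
  ∑-+ (x ∷ xs) f g = trans (+-congˡ (∑-+ xs f g)) (+-interchange _ _ _ _)

  ∑-*ˡ : (xs : List X) (a : A) (f : X → A) → a * ∑ xs f ≈ ∑ xs (λ x → a * f x)
  ∑-*ˡ []       a f = zeroʳ a
  ∑-*ˡ (x ∷ xs) a f = trans (distribˡ a _ _) (+-congˡ (∑-*ˡ xs a f))

  ∑-*ʳ : (xs : List X) (a : A) (f : X → A) → ∑ xs f * a ≈ ∑ xs (λ x → f x * a)
  ∑-*ʳ []       a f = zeroˡ a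
  ∑-*ʳ (x ∷ xs) a f = trans (distribʳ a _ _) (+-congˡ (∑-*ʳ xs a f))

  ∑-swap : (xs : List X) (ys : List Y) (f : X → Y → A) →
           ∑ xs (λ x → ∑ ys (f x)) ≈ ∑ ys (λ y → ∑ xs (λ x → f x y))
  ∑-swap []       ys f = sym (∑-zero ys λ _ → ≈-refl)
  ∑-swap (x ∷ xs) ys f = trans (+-congˡ (∑-swap xs ys f)) (sym (∑-+ ys (f x) _))

  ∑-++ : (xs ys : List X) (f : X → A) → ∑ (xs ++ ys) f ≈ ∑ xs f + ∑ ys f
  ∑-++ []       ys f = sym (+-identityˡ _)
  ∑-++ (x ∷ xs) ys f = trans (+-congˡ (∑-++ xs ys f)) (sym (+-assoc _ _ _))

  ∑-map : (g : X → Y) (xs : List X) (f : Y → A) → ∑ (map g xs) f ≡ ∑ xs (f ∘ g)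
  ∑-map g []       f = refl
  ∑-map g (x ∷ xs) f = cong (f (g x) +_) (∑-map g xs f)

  ∑-concatMap : (g : X → List Y) (xs : List X) (f : Y → A) → ∑ (concatMap g xs) f ≈ ∑ xs (λ x → ∑ (g x) f)
  ∑-concatMap g []       f = ≈-refl
  ∑-concatMap g (x ∷ xs) f = trans (∑-++ (g x) _ f) (+-congˡ (∑-concatMap g xs f))

  ∑-cartesian : ∀ {z} {Z : Set z} (h : X → Y → Z) (xs : List X) (ys : List Y) (f : Z → A) →
                ∑ (concatMap (λ x → map (h x) ys) xs) f ≈ ∑ xs (λ x → ∑ ys (λ y → f (h x y)))
  ∑-cartesian h xs ys f = trans (∑-concatMap _ xs f) (∑-cong xs λ x → reflexive (∑-map (h x) ys f))

  ∑-filter : ∀ {p} {P : X → Set p} (P? : ∀ x → Dec (P x)) (xs : List X) (f : X → A) →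
             ∑ (filter P? xs) f ≈ ∑ xs (λ x → does (P? x) ▸ f x)
  ∑-filter P? []       f = ≈-refl
  ∑-filter P? (x ∷ xs) f with does (P? x)
  ... | true  = +-congˡ (∑-filter P? xs f)
  ... | false = trans (∑-filter P? xs f) (sym (+-identityˡ _))

  ∑-tabulate : ∀ {n} (g : Fin n → X) (f : X → A) → ∑ (List.tabulate g) f ≡ ∑ (allFin n) (f ∘ g)
  ∑-tabulate {n = zero}  g f = refl
  ∑-tabulate {n = suc n} g f = cong (f (g zero) +_) (≡.trans (∑-tabulate (g ∘ suc) f) (≡.sym (∑-tabulate suc (f ∘ g))))

  ∑-suc : ∀ n (f : Fin (suc n) → A) → ∑ (allFin (suc n)) f ≡ f zero + ∑ (allFin n) (f ∘ suc)
  ∑-suc n f = cong (f zero +_) (∑-tabulate suc f)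

  ▸-cong : ∀ b {x y} → x ≈ y → b ▸ x ≈ b ▸ y
  ▸-cong true  e = e
  ▸-cong false e = ≈-refl

  ▸-cong′ : ∀ b {x y} → (b ≡ true → x ≈ y) → b ▸ x ≈ b ▸ y
  ▸-cong′ true  e = e refl
  ▸-cong′ false e = ≈-refl

  ▸-congᵇ : ∀ {b c} x → b ≡ c → b ▸ x ≈ c ▸ x
  ▸-congᵇ x refl = ≈-refl

  ▸-zero : ∀ b → b ▸ 0# ≈ 0#
  ▸-zero true  = ≈-refl
  ▸-zero false = ≈-refl

  ▸-+ : ∀ b x y → b ▸ (x + y) ≈ b ▸ x + b ▸ y
  ▸-+ true  x y = ≈-refl
  ▸-+ false x y = sym (+-identityˡ 0#)

  ▸-∑ : ∀ b (xs : List X) (f : X → A) → b ▸ ∑ xs f ≈ ∑ xs (λ x → b ▸ f x)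
  ▸-∑ true  xs f = ≈-refl
  ▸-∑ false xs f = sym (∑-zero xs λ _ → ≈-refl)

  ▸-*ˡ : ∀ b x y → (b ▸ x) * y ≈ b ▸ (x * y)
  ▸-*ˡ true  x y = ≈-refl
  ▸-*ˡ false x y = zeroˡ y

  ▸-*ʳ : ∀ b x y → x * (b ▸ y) ≈ b ▸ (x * y)
  ▸-*ʳ true  x y = ≈-refl
  ▸-*ʳ false x y = zeroʳ x

  ▸-∧ : ∀ b c x → (b ∧ c) ▸ x ≈ b ▸ c ▸ x
  ▸-∧ true  c x = ≈-refl
  ▸-∧ false c x = ≈-refl

  ▸-comm : ∀ b c x → b ▸ c ▸ x ≈ c ▸ b ▸ x
  ▸-comm true  c x = ≈-refl
  ▸-comm false c x = sym (▸-zero c)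

  ▸-* : ∀ b c x y → (b ▸ x) * (c ▸ y) ≈ (b ∧ c) ▸ (x * y)
  ▸-* true  c x y = ▸-*ʳ c x y
  ▸-* false c x y = zeroˡ _

  -- `Finite` does not require that every element is listed exactly once. This identity takes the
  -- place of that requirement, in the form in which sums need it.
  Delta : ∀ {X} → Finite X → Set (a ⊔ ℓ)
  Delta {X} fin = ∀ (x₀ : X) (f : X → A) → ∑ (elements fin) (λ x → does (_≟_ fin x x₀) ▸ f x) ≈ f x₀

  Delta-Fin : ∀ n → Delta (FinF n)
  Delta-Fin (suc n) zero    f = begin
    _                                          ≈⟨ reflexive (∑-suc n _) ⟩
    f zero + ∑ (allFin n) (λ _ → 0#)           ≈⟨ +-congˡ (∑-zero (allFin n) λ _ → ≈-refl) ⟩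
    f zero + 0#                                ≈⟨ +-identityʳ _ ⟩
    f zero                                     ∎
  Delta-Fin (suc n) (suc i) f = begin
    _                                                              ≈⟨ reflexive (∑-suc n _) ⟩
    0# + ∑ (allFin n) (λ j → does (j ≟F i) ▸ f (suc j))            ≈⟨ +-identityˡ _ ⟩
    ∑ (allFin n) (λ j → does (j ≟F i) ▸ f (suc j))                 ≈⟨ Delta-Fin n i (f ∘ suc) ⟩
    f (suc i)                                                      ∎

  Delta-Bool : Delta BoolF
  Delta-Bool true  f = trans (+-congˡ (+-identityˡ 0#)) (+-identityʳ _)
  Delta-Bool false f = trans (+-identityˡ _) (+-identityʳ _)

  Delta-× : ∀ {X Y} (finX : Finite X) (finY : Finite Y) → Delta finX → Delta finY → Delta (finX ×F finY)
  Delta-× finX finY δX δY (x₀ , y₀) f = begin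
    _ ≈⟨ ∑-cartesian _,_ (elements finX) (elements finY) _ ⟩
    ∑ (elements finX) (λ x → ∑ (elements finY) (λ y → does (_≟_ (finX ×F finY) (x , y) (x₀ , y₀)) ▸ f (x , y)))
      ≈⟨ ∑-cong (elements finX) (λ x → ∑-cong (elements finY) λ y →
           trans (▸-congᵇ (f (x , y)) (does-pair x y)) (▸-∧ (does (_≟_ finX x x₀)) (does (_≟_ finY y y₀)) (f (x , y)))) ⟩
    ∑ (elements finX) (λ x → ∑ (elements finY) (λ y → does (_≟_ finX x x₀) ▸ does (_≟_ finY y y₀) ▸ f (x , y)))
      ≈⟨ ∑-cong (elements finX) (λ x → ▸-∑ (does (_≟_ finX x x₀)) (elements finY) _) ⟨
    ∑ (elements finX) (λ x → does (_≟_ finX x x₀) ▸ ∑ (elements finY) (λ y → does (_≟_ finY y y₀) ▸ f (x , y)))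
      ≈⟨ δX x₀ _ ⟩
    ∑ (elements finY) (λ y → does (_≟_ finY y y₀) ▸ f (x₀ , y))   ≈⟨ δY y₀ _ ⟩
    f (x₀ , y₀) ∎
    where
    does-pair : ∀ x y → does (_≟_ (finX ×F finY) (x , y) (x₀ , y₀)) ≡ does (_≟_ finX x x₀) ∧ does (_≟_ finY y y₀)
    does-pair x y = Bool-⇔
      (λ e → let q = does⇒ (_≟_ (finX ×F finY) (x , y) (x₀ , y₀)) e in
             cong₂ _∧_ (dec-true (_≟_ finX x x₀) (cong proj₁ q)) (dec-true (_≟_ finY y y₀) (cong proj₂ q)))
      (λ e → dec-true (_≟_ (finX ×F finY) (x , y) (x₀ , y₀))
               (cong₂ _,_ (does⇒ (_≟_ finX x x₀) (∧-⇒ˡ e)) (does⇒ (_≟_ finY y y₀) (∧-⇒ʳ e))))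

  ∑-vecs : ∀ {X : Set} n (xs : List X) (f : Vec X (suc n) → A) →
           ∑ (vecs (suc n) xs) f ≈ ∑ xs (λ x → ∑ (vecs n xs) (λ v → f (x ∷ᵥ v)))
  ∑-vecs n xs f = ∑-cartesian _∷ᵥ_ xs (vecs n xs) f

  Delta-Vec : ∀ {X} (fin : Finite X) → Delta fin → ∀ n → Delta (fin ^F n)
  Delta-Vec fin δ zero    []ᵥ      f = +-identityʳ _
  Delta-Vec fin δ (suc n) (x₀ ∷ᵥ v₀) f = begin
    _ ≈⟨ ∑-vecs n (elements fin) _ ⟩
    ∑ (elements fin) (λ x → ∑ (vecs n (elements fin)) (λ v → does (_≟_ (fin ^F suc n) (x ∷ᵥ v) (x₀ ∷ᵥ v₀)) ▸ f (x ∷ᵥ v)))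
      ≈⟨ ∑-cong (elements fin) (λ x → ∑-cong (vecs n (elements fin)) λ v →
           trans (▸-congᵇ (f (x ∷ᵥ v)) (does-∷ x v)) (▸-∧ (does (_≟_ fin x x₀)) (does (_≟_ (fin ^F n) v v₀)) (f (x ∷ᵥ v)))) ⟩
    ∑ (elements fin) (λ x → ∑ (vecs n (elements fin)) (λ v → does (_≟_ fin x x₀) ▸ does (_≟_ (fin ^F n) v v₀) ▸ f (x ∷ᵥ v)))
      ≈⟨ ∑-cong (elements fin) (λ x → ▸-∑ (does (_≟_ fin x x₀)) (vecs n (elements fin)) _) ⟨
    ∑ (elements fin) (λ x → does (_≟_ fin x x₀) ▸ ∑ (vecs n (elements fin)) (λ v → does (_≟_ (fin ^F n) v v₀) ▸ f (x ∷ᵥ v)))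
      ≈⟨ δ x₀ _ ⟩
    ∑ (vecs n (elements fin)) (λ v → does (_≟_ (fin ^F n) v v₀) ▸ f (x₀ ∷ᵥ v))   ≈⟨ Delta-Vec fin δ n v₀ _ ⟩
    f (x₀ ∷ᵥ v₀) ∎
    where
    does-∷ : ∀ x v → does (_≟_ (fin ^F suc n) (x ∷ᵥ v) (x₀ ∷ᵥ v₀)) ≡ does (_≟_ fin x x₀) ∧ does (_≟_ (fin ^F n) v v₀)
    does-∷ x v = Bool-⇔
      (λ e → let q = does⇒ (_≟_ (fin ^F suc n) (x ∷ᵥ v) (x₀ ∷ᵥ v₀)) e in
             cong₂ _∧_ (dec-true (_≟_ fin x x₀) (cong Vec.head q)) (dec-true (_≟_ (fin ^F n) v v₀) (cong Vec.tail q)))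
      (λ e → dec-true (_≟_ (fin ^F suc n) (x ∷ᵥ v) (x₀ ∷ᵥ v₀))
               (cong₂ _∷ᵥ_ (does⇒ (_≟_ fin x x₀) (∧-⇒ˡ e)) (does⇒ (_≟_ (fin ^F n) v v₀) (∧-⇒ʳ e))))

  Delta-Bits : ∀ n → Delta (BoolF ^F n)
  Delta-Bits = Delta-Vec BoolF Delta-Bool

  -- Both sides sum over the pairs with x = β y: the test y = α x together with `p x` is equivalent
  -- to x = β y, and the two sums are exchanged.
  ∑-image : ∀ {X Y} (finX : Finite X) (finY : Finite Y) → Delta finX → Delta finY →
            (p : X → Bool) (α : X → Y) (β : Y → X) →
            (∀ y → p (β y) ≡ true) → (∀ y → α (β y) ≡ y) → (∀ x → p x ≡ true → β (α x) ≡ x) →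
            (f : X → A) → ∑ (elements finX) (λ x → p x ▸ f x) ≈ ∑ (elements finY) (f ∘ β)
  ∑-image finX finY δX δY p α β pβ αβ βα f = begin
    ∑ xs (λ x → p x ▸ f x)                                                ≈⟨ ∑-cong xs (λ x → δY (α x) (λ _ → p x ▸ f x)) ⟨
    ∑ xs (λ x → ∑ ys (λ y → does (_≟_ finY y (α x)) ▸ p x ▸ f x))         ≈⟨ ∑-cong xs (λ x → ∑-cong ys λ y → trans (sym (▸-∧ (does (_≟_ finY y (α x))) (p x) (f x))) (▸-congᵇ (f x) (same x y))) ⟩
    ∑ xs (λ x → ∑ ys (λ y → does (_≟_ finX x (β y)) ▸ f x))               ≈⟨ ∑-swap xs ys _ ⟩
    ∑ ys (λ y → ∑ xs (λ x → does (_≟_ finX x (β y)) ▸ f x))               ≈⟨ ∑-cong ys (λ y → δX (β y) f) ⟩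
    ∑ ys (f ∘ β)                                                          ∎
    where
    xs = elements finX
    ys = elements finY
    same : ∀ x y → does (_≟_ finY y (α x)) ∧ p x ≡ does (_≟_ finX x (β y))
    same x y = Bool-⇔
      (λ e → dec-true (_≟_ finX x (β y)) (≡.trans (≡.sym (βα x (∧-⇒ʳ {does (_≟_ finY y (α x))} e))) (cong β (≡.sym (does⇒ (_≟_ finY y (α x)) (∧-⇒ˡ e))))))
      (λ e → let q = does⇒ (_≟_ finX x (β y)) e in
             cong₂ _∧_ (dec-true (_≟_ finY y (α x)) (≡.trans (≡.sym (αβ y)) (cong α (≡.sym q)))) (≡.trans (cong p q) (pβ y)))

  ∑-bijection : ∀ {X Y} (finX : Finite X) (finY : Finite Y) → Delta finX → Delta finY →
                (α : X → Y) (β : Y → X) → (∀ y → α (β y) ≡ y) → (∀ x → β (α x) ≡ x) →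
                (f : X → A) → ∑ (elements finX) f ≈ ∑ (elements finY) (f ∘ β)
  ∑-bijection finX finY δX δY α β αβ βα = ∑-image finX finY δX δY (λ _ → true) α β (λ _ → refl) αβ (λ x _ → βα x)

  Matrix : Set → Set a
  Matrix Y = Y → Y → A

  module _ {Y : Set} (fin : Finite Y) where
    -- The index type is arbitrary, so that a row index can be a tuple of time, state and padding.
    mprod : List (Matrix Y) → Matrix Y
    mprod []       x y = does (_≟_ fin x y) ▸ 1#
    mprod (M ∷ Ms) x y = ∑ (elements fin) (λ z → M x z * mprod Ms z y)

    mprod-cong : ∀ {n} {M N : Fin n → Matrix Y} → (∀ t x y → M t x y ≈ N t x y) →
                 ∀ x y → mprod (List.tabulate M) x y ≈ mprod (List.tabulate N) x y
    mprod-cong {zero}  h x y = ≈-refl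
    mprod-cong {suc n} h x y = ∑-cong (elements fin) λ z → *-cong (h zero x z) (mprod-cong (h ∘ suc) z y)

    mprod-++ : Delta fin → ∀ Ms Ns x y → mprod (Ms ++ Ns) x y ≈ ∑ (elements fin) (λ z → mprod Ms x z * mprod Ns z y)
    mprod-++ δ []       Ns x y = begin
      mprod Ns x y                                                         ≈⟨ δ x (λ z → mprod Ns z y) ⟨
      ∑ ys (λ z → does (_≟_ fin z x) ▸ mprod Ns z y)                       ≈⟨ ∑-cong ys (λ z → begin
          does (_≟_ fin z x) ▸ mprod Ns z y        ≈⟨ ▸-congᵇ (mprod Ns z y) (does-⇔ (_≟_ fin z x) (_≟_ fin x z) ≡.sym ≡.sym) ⟩
          does (_≟_ fin x z) ▸ mprod Ns z y        ≈⟨ ▸-cong (does (_≟_ fin x z)) (*-identityˡ _) ⟨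
          does (_≟_ fin x z) ▸ (1# * mprod Ns z y) ≈⟨ ▸-*ˡ (does (_≟_ fin x z)) 1# (mprod Ns z y) ⟨
          (does (_≟_ fin x z) ▸ 1#) * mprod Ns z y ∎) ⟩
      ∑ ys (λ z → mprod [] x z * mprod Ns z y)                             ∎
      where ys = elements fin
    mprod-++ δ (M ∷ Ms) Ns x y = begin
      ∑ ys (λ w → M x w * mprod (Ms ++ Ns) w y)                            ≈⟨ ∑-cong ys (λ w → *-congˡ (mprod-++ δ Ms Ns w y)) ⟩
      ∑ ys (λ w → M x w * ∑ ys (λ z → mprod Ms w z * mprod Ns z y))        ≈⟨ ∑-cong ys (λ w → ∑-*ˡ ys _ _) ⟩
      ∑ ys (λ w → ∑ ys (λ z → M x w * (mprod Ms w z * mprod Ns z y)))      ≈⟨ ∑-swap ys ys _ ⟩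
      ∑ ys (λ z → ∑ ys (λ w → M x w * (mprod Ms w z * mprod Ns z y)))      ≈⟨ ∑-cong ys (λ z → ∑-cong ys λ w → *-assoc _ _ _) ⟨
      ∑ ys (λ z → ∑ ys (λ w → (M x w * mprod Ms w z) * mprod Ns z y))      ≈⟨ ∑-cong ys (λ z → ∑-*ʳ ys _ _) ⟨
      ∑ ys (λ z → mprod (M ∷ Ms) x z * mprod Ns z y)                       ∎
      where ys = elements fin

    -- Distributivity: a choice of one summand in every factor, where the guards multiply to a
    -- conjunction. Hardness chooses bits, membership chooses pairs of a row and a column.
    mprod-expand : ∀ {C : Set} (cs : List C) {n} (test : Fin n → C → Bool) (M : Fin n → C → Matrix Y) (N : Fin n → Matrix Y) →
                   (∀ t x y → N t x y ≈ ∑ cs (λ c → test t c ▸ M t c x y)) →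
                   ∀ x y → mprod (List.tabulate N) x y ≈
                           ∑ (vecs n cs) (λ v → allᵇ (λ t → test t (lookup v t)) ▸ mprod (List.tabulate (λ t → M t (lookup v t))) x y)
    mprod-expand cs {zero}  test M N h x y = sym (+-identityʳ _)
    mprod-expand cs {suc n} test M N h x y = begin
      ∑ ys (λ z → N zero x z * mprod (List.tabulate (N ∘ suc)) z y)
        ≈⟨ ∑-cong ys (λ z → *-cong (h zero x z) (mprod-expand cs (test ∘ suc) (M ∘ suc) (N ∘ suc) (h ∘ suc) z y)) ⟩
      ∑ ys (λ z → ∑ cs (λ c → test zero c ▸ M zero c x z) * ∑ vs (λ v → tests v ▸ P v z))
        ≈⟨ ∑-cong ys (λ z → trans (∑-*ʳ cs _ _) (∑-cong cs λ c → trans (∑-*ˡ vs _ _) (∑-cong vs λ v → ▸-* (test zero c) (tests v) _ _))) ⟩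
      ∑ ys (λ z → ∑ cs (λ c → ∑ vs (λ v → (test zero c ∧ tests v) ▸ (M zero c x z * P v z))))
        ≈⟨ trans (∑-swap ys cs _) (∑-cong cs λ c → trans (∑-swap ys vs _) (∑-cong vs λ v → sym (▸-∑ (test zero c ∧ tests v) ys _))) ⟩
      ∑ cs (λ c → ∑ vs (λ v → (test zero c ∧ tests v) ▸ ∑ ys (λ z → M zero c x z * P v z)))
        ≈⟨ ∑-vecs n cs _ ⟨
      ∑ (vecs (suc n) cs) (λ v → allᵇ (λ t → test t (lookup v t)) ▸ mprod (List.tabulate (λ t → M t (lookup v t))) x y) ∎
      where
      ys = elements fin
      vs = vecs n cs
      tests : Vec _ n → Bool
      tests v = allᵇ (λ t → test (suc t) (lookup v t))
      P : Vec _ n → Y → A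
      P v z = mprod (List.tabulate (λ t → M (suc t) (lookup v t))) z y

-- The semiring of non-commutative polynomials

module Polynomials {c ℓ} (F : CharZeroField c ℓ) where
  open CharZeroField F public using (commutativeRing; inv; inv-correct)
  module K = CommutativeRing commutativeRing
  module SK = Sums K.semiring
  module KR = Relation.Binary.Reasoning.Setoid K.setoid

  open Algebra.Properties.Ring K.ring public using (-1*x≈-x; -‿involutive)

  Poly : Set c
  Poly = NCPoly F

  Series : Set c
  Series = List ℕ → K.Carrier

  -- The Cauchy product by recursion along the word. Since `f ∘ (x ∷_)` is the left quotient of `f`
  -- by a letter, its laws follow by induction on the word for arbitrary series, without handling
  -- lists of splits.
  conv : Series → Series → Series
  conv f g []      = f [] K.* g []
  conv f g (x ∷ w) = f [] K.* g (x ∷ w) K.+ conv (f ∘ (x ∷_)) g w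

  sumF-splits : ∀ (f g : Series) w →
    sumF F (map (λ uv → f (proj₁ uv) K.* g (proj₂ uv)) (splits F w)) K.≈ conv f g w
  sumF-splits f g []      = K.+-identityʳ _
  sumF-splits f g (x ∷ w) = K.+-congˡ (K.trans
    (K.reflexive (cong (sumF F) (≡.sym (map-∘ (splits F w)))))
    (sumF-splits (f ∘ (x ∷_)) g w))

  coeff-⊗ : ∀ (p q : Poly) w → coeff F (p ⊗ q) w K.≈ conv (coeff F p) (coeff F q) w
  coeff-⊗ p q w = sumF-splits (coeff F p) (coeff F q) w

  conv-cong : ∀ {f f′ g g′ : Series} → (∀ w → f w K.≈ f′ w) → (∀ w → g w K.≈ g′ w) → ∀ w → conv f g w K.≈ conv f′ g′ w
  conv-cong f≈ g≈ []      = K.*-cong (f≈ []) (g≈ [])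
  conv-cong f≈ g≈ (x ∷ w) = K.+-cong (K.*-cong (f≈ []) (g≈ (x ∷ w))) (conv-cong (f≈ ∘ (x ∷_)) g≈ w)

  conv-+ˡ : ∀ (f f′ g : Series) w → conv (λ u → f u K.+ f′ u) g w K.≈ conv f g w K.+ conv f′ g w
  conv-+ˡ f f′ g []      = K.distribʳ _ _ _
  conv-+ˡ f f′ g (x ∷ w) = K.trans (K.+-cong (K.distribʳ _ _ _) (conv-+ˡ _ _ g w)) (SK.+-interchange _ _ _ _)

  conv-+ʳ : ∀ (f g g′ : Series) w → conv f (λ u → g u K.+ g′ u) w K.≈ conv f g w K.+ conv f g′ w
  conv-+ʳ f g g′ []      = K.distribˡ _ _ _
  conv-+ʳ f g g′ (x ∷ w) = K.trans (K.+-cong (K.distribˡ _ _ _) (conv-+ʳ _ g g′ w)) (SK.+-interchange _ _ _ _)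

  conv-zeroˡ : ∀ (f g : Series) → (∀ w → f w K.≈ K.0#) → ∀ w → conv f g w K.≈ K.0#
  conv-zeroˡ f g f≈0 []      = K.trans (K.*-congʳ (f≈0 [])) (K.zeroˡ _)
  conv-zeroˡ f g f≈0 (x ∷ w) = K.trans (K.+-cong (K.trans (K.*-congʳ (f≈0 [])) (K.zeroˡ _)) (conv-zeroˡ _ g (f≈0 ∘ (x ∷_)) w)) (K.+-identityˡ _)

  conv-zeroʳ : ∀ (f g : Series) → (∀ w → g w K.≈ K.0#) → ∀ w → conv f g w K.≈ K.0#
  conv-zeroʳ f g g≈0 []      = K.trans (K.*-congˡ (g≈0 [])) (K.zeroʳ _)
  conv-zeroʳ f g g≈0 (x ∷ w) = K.trans (K.+-cong (K.trans (K.*-congˡ (g≈0 _)) (K.zeroʳ _)) (conv-zeroʳ _ g g≈0 w)) (K.+-identityˡ _)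

  conv-cstˡ : ∀ a (g : Series) w → conv (coeff F (cst a)) g w K.≈ a K.* g w
  conv-cstˡ a g []      = K.refl
  conv-cstˡ a g (x ∷ w) = K.trans (K.+-congˡ (conv-zeroˡ _ g (λ _ → K.refl) w)) (K.+-identityʳ _)

  conv-cstʳ : ∀ a (f : Series) w → conv f (coeff F (cst a)) w K.≈ f w K.* a
  conv-cstʳ a f []      = K.refl
  conv-cstʳ a f (x ∷ w) = K.trans (K.+-cong (K.zeroʳ _) (conv-cstʳ a (f ∘ (x ∷_)) w)) (K.+-identityˡ _)

  conv-*ˡ : ∀ a (f g : Series) w → conv (λ u → a K.* f u) g w K.≈ a K.* conv f g w
  conv-*ˡ a f g []      = K.*-assoc _ _ _
  conv-*ˡ a f g (x ∷ w) = K.trans (K.+-cong (K.*-assoc _ _ _) (conv-*ˡ a _ g w)) (K.sym (K.distribˡ _ _ _))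

  conv-assoc : ∀ (f g h : Series) w → conv (conv f g) h w K.≈ conv f (conv g h) w
  conv-assoc f g h []      = K.*-assoc _ _ _
  conv-assoc f g h (x ∷ w) = begin
    f [] K.* g [] K.* h (x ∷ w) K.+ conv (λ u → f [] K.* g (x ∷ u) K.+ conv (f ∘ (x ∷_)) g u) h w
      ≈⟨ K.+-cong (K.*-assoc _ _ _) (K.trans (conv-+ˡ _ _ h w) (K.+-cong (conv-*ˡ (f []) (g ∘ (x ∷_)) h w) (conv-assoc (f ∘ (x ∷_)) g h w))) ⟩
    f [] K.* (g [] K.* h (x ∷ w)) K.+ (f [] K.* conv (g ∘ (x ∷_)) h w K.+ conv (f ∘ (x ∷_)) (conv g h) w)
      ≈⟨ K.+-assoc _ _ _ ⟨
    f [] K.* (g [] K.* h (x ∷ w)) K.+ f [] K.* conv (g ∘ (x ∷_)) h w K.+ conv (f ∘ (x ∷_)) (conv g h) w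
      ≈⟨ K.+-congʳ (K.distribˡ _ _ _) ⟨
    f [] K.* (g [] K.* h (x ∷ w) K.+ conv (g ∘ (x ∷_)) h w) K.+ conv (f ∘ (x ∷_)) (conv g h) w ∎
    where open KR

  -- A record, so that p and q can be inferred from a proof of p ≋ q.
  infix 4 _≋_
  record _≋_ (p q : Poly) : Set ℓ where
    constructor coeffs
    field at : ∀ w → coeff F p w K.≈ coeff F q w
  open _≋_ public

  ⊗-cong : ∀ {p p′ q q′ : Poly} → p ≋ p′ → q ≋ q′ → p ⊗ q ≋ p′ ⊗ q′
  ⊗-cong {p} {p′} {q} {q′} p≈ q≈ = coeffs λ w →
    K.trans (coeff-⊗ p q w) (K.trans (conv-cong (at p≈) (at q≈) w) (K.sym (coeff-⊗ p′ q′ w)))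

  ⊗-assoc : ∀ (p q r : Poly) → (p ⊗ q) ⊗ r ≋ p ⊗ (q ⊗ r)
  ⊗-assoc p q r = coeffs λ w → begin
    coeff F ((p ⊗ q) ⊗ r) w                              ≈⟨ coeff-⊗ (p ⊗ q) r w ⟩
    conv (coeff F (p ⊗ q)) (coeff F r) w                 ≈⟨ conv-cong (coeff-⊗ p q) (λ _ → K.refl) w ⟩
    conv (conv (coeff F p) (coeff F q)) (coeff F r) w    ≈⟨ conv-assoc _ _ _ w ⟩
    conv (coeff F p) (conv (coeff F q) (coeff F r)) w    ≈⟨ conv-cong (λ _ → K.refl) (coeff-⊗ q r) w ⟨
    conv (coeff F p) (coeff F (q ⊗ r)) w                 ≈⟨ coeff-⊗ p (q ⊗ r) w ⟨
    coeff F (p ⊗ (q ⊗ r)) w                              ∎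
    where open KR

  -- A semiring suffices: signs and complements of bits enter only through constants taken from the
  -- field.
  polySemiring : Semiring c ℓ
  polySemiring = record
    { Carrier = Poly ; _≈_ = _≋_ ; _+_ = _⊕_ ; _*_ = _⊗_ ; 0# = cst K.0# ; 1# = cst K.1#
    ; isSemiring = record
      { isSemiringWithoutAnnihilatingZero = record
        { +-isCommutativeMonoid = record
          { isMonoid = record
            { isSemigroup = record
              { isMagma = record
                { isEquivalence = record
                  { refl  = coeffs λ w → K.refl
                  ; sym   = λ e → coeffs λ w → K.sym (at e w)
                  ; trans = λ e e′ → coeffs λ w → K.trans (at e w) (at e′ w) }
                ; ∙-cong = λ e e′ → coeffs λ w → K.+-cong (at e w) (at e′ w) }
              ; assoc = λ p q r → coeffs λ w → K.+-assoc _ _ _ }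
            ; identity = (λ p → coeffs λ w → K.trans (K.+-congʳ (coeff-0 w)) (K.+-identityˡ _))
                       , (λ p → coeffs λ w → K.trans (K.+-congˡ (coeff-0 w)) (K.+-identityʳ _)) }
          ; comm = λ p q → coeffs λ w → K.+-comm _ _ }
        ; *-cong = ⊗-cong
        ; *-assoc = ⊗-assoc
        ; *-identity = (λ p → coeffs λ w → K.trans (coeff-⊗ (cst K.1#) p w) (K.trans (conv-cstˡ _ _ w) (K.*-identityˡ _)))
                     , (λ p → coeffs λ w → K.trans (coeff-⊗ p (cst K.1#) w) (K.trans (conv-cstʳ _ _ w) (K.*-identityʳ _)))
        ; distrib = (λ p q r → coeffs λ w → K.trans (coeff-⊗ p (q ⊕ r) w) (K.trans (conv-+ʳ _ _ _ w) (K.sym (K.+-cong (coeff-⊗ p q w) (coeff-⊗ p r w)))))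
                  , (λ p q r → coeffs λ w → K.trans (coeff-⊗ (q ⊕ r) p w) (K.trans (conv-+ˡ _ _ _ w) (K.sym (K.+-cong (coeff-⊗ q p w) (coeff-⊗ r p w))))) }
      ; zero = (λ p → coeffs λ w → K.trans (coeff-⊗ (cst K.0#) p w) (K.trans (conv-zeroˡ _ _ coeff-0 w) (K.sym (coeff-0 w))))
             , (λ p → coeffs λ w → K.trans (coeff-⊗ p (cst K.0#) w) (K.trans (conv-zeroʳ _ _ coeff-0 w) (K.sym (coeff-0 w)))) } }
    where
    coeff-0 : ∀ w → coeff F (cst K.0#) w K.≈ K.0#
    coeff-0 []      = K.refl
    coeff-0 (_ ∷ _) = K.refl

  module P = Semiring polySemiring
  open Sums polySemiring public
  module PR = Relation.Binary.Reasoning.Setoid P.setoid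

  cst-cong : ∀ {a b} → a K.≈ b → cst a ≋ cst b
  cst-cong a≈b = coeffs λ { [] → a≈b ; (_ ∷ _) → K.refl }

  cst-+ : ∀ a b → cst (a K.+ b) ≋ cst a ⊕ cst b
  cst-+ a b = coeffs λ { [] → K.refl ; (_ ∷ _) → K.sym (K.+-identityˡ _) }

  cst-⊗ : ∀ a p w → coeff F (cst a ⊗ p) w K.≈ a K.* coeff F p w
  cst-⊗ a p w = K.trans (coeff-⊗ (cst a) p w) (conv-cstˡ _ _ w)

  cst-* : ∀ a b → cst (a K.* b) ≋ cst a ⊗ cst b
  cst-* a b = coeffs λ w → K.trans (at-cst w) (K.sym (cst-⊗ a (cst b) w))
    where
    at-cst : ∀ w → coeff F (cst (a K.* b)) w K.≈ a K.* coeff F (cst b) w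
    at-cst []      = K.refl
    at-cst (_ ∷ _) = K.sym (K.zeroʳ a)

  cst-central : ∀ a p → cst a ⊗ p ≋ p ⊗ cst a
  cst-central a p = coeffs λ w → K.trans (cst-⊗ a p w) (K.trans (K.*-comm _ _)
    (K.sym (K.trans (coeff-⊗ p (cst a) w) (conv-cstʳ _ _ w))))

  cst-swap : ∀ a p q → p ⊗ (cst a ⊗ q) ≋ cst a ⊗ (p ⊗ q)
  cst-swap a p q = P.trans (P.sym (P.*-assoc _ _ _)) (P.trans (P.*-congʳ (P.sym (cst-central a p))) (P.*-assoc _ _ _))

  cst-∑ : ∀ {x} {X : Set x} (xs : List X) (f : X → K.Carrier) → cst (SK.∑ xs f) ≋ ∑ xs (cst ∘ f)
  cst-∑ []       f = P.refl
  cst-∑ (x ∷ xs) f = P.trans (cst-+ _ _) (P.+-congˡ (cst-∑ xs f))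

  cst-▸ : ∀ b a → cst (b SK.▸ a) ≋ b ▸ cst a
  cst-▸ true  a = P.refl
  cst-▸ false a = P.refl

  sumP-map : ∀ {x} {X : Set x} (xs : List X) (f : X → Poly) → sumP F (map f xs) ≡ ∑ xs f
  sumP-map []       f = refl
  sumP-map (x ∷ xs) f = cong (f x ⊕_) (sumP-map xs f)

  subst-∑ : ∀ σ {x} {X : Set x} (xs : List X) (f : X → Poly) → subst F σ (∑ xs f) ≡ ∑ xs (subst F σ ∘ f)
  subst-∑ σ []       f = refl
  subst-∑ σ (x ∷ xs) f = cong (subst F σ (f x) ⊕_) (subst-∑ σ xs f)

  coeff-∑ : ∀ {x} {X : Set x} (xs : List X) (f : X → Poly) w → coeff F (∑ xs f) w K.≈ SK.∑ xs (λ x → coeff F (f x) w)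
  coeff-∑ []       f []      = K.refl
  coeff-∑ []       f (_ ∷ _) = K.refl
  coeff-∑ (x ∷ xs) f w       = K.+-congˡ (coeff-∑ xs f w)

  -- Expansion into monomials and substitution

  Monomial : Set c
  Monomial = K.Carrier × List ℕ

  mon : (ℕ → Poly) → List ℕ → Poly
  mon σ []      = cst K.1#
  mon σ (i ∷ w) = σ i ⊗ mon σ w

  mon-++ : ∀ σ u v → mon σ (u ++ v) ≋ mon σ u ⊗ mon σ v
  mon-++ σ []      v = P.sym (P.*-identityˡ _)
  mon-++ σ (i ∷ u) v = P.trans (P.*-congˡ (mon-++ σ u v)) (P.sym (P.*-assoc _ _ _))

  term : (ℕ → Poly) → Monomial → Poly
  term σ (a , w) = cst a ⊗ mon σ w

  _·_ : Monomial → Monomial → Monomial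
  (a , u) · (b , v) = a K.* b , u ++ v

  term-· : ∀ σ m m′ → term σ (m · m′) ≋ term σ m ⊗ term σ m′
  term-· σ (a , u) (b , v) = begin
    cst (a K.* b) ⊗ mon σ (u ++ v)                ≈⟨ P.*-cong (cst-* a b) (mon-++ σ u v) ⟩
    (cst a ⊗ cst b) ⊗ (mon σ u ⊗ mon σ v)         ≈⟨ P.*-assoc _ _ _ ⟩
    cst a ⊗ (cst b ⊗ (mon σ u ⊗ mon σ v))         ≈⟨ P.*-congˡ (cst-swap b _ _) ⟨
    cst a ⊗ (mon σ u ⊗ (cst b ⊗ mon σ v))         ≈⟨ P.*-assoc _ _ _ ⟨
    (cst a ⊗ mon σ u) ⊗ (cst b ⊗ mon σ v)         ∎
    where open PR

  monomials : Poly → List Monomial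
  monomials (var i) = (K.1# , i ∷ []) ∷ []
  monomials (cst a) = (a , []) ∷ []
  monomials (p ⊕ q) = monomials p ++ monomials q
  monomials (p ⊗ q) = concatMap (λ m → map (m ·_) (monomials q)) (monomials p)

  -- Substitution acts on expressions, whereas polynomials are compared by coefficients. The
  -- expanded, uncancelled list of monomials connects the two.
  subst-monomials : ∀ σ p → subst F σ p ≋ ∑ (monomials p) (term σ)
  subst-monomials σ (var i) = P.sym (P.trans (P.+-identityʳ _) (P.trans (P.*-identityˡ _) (P.*-identityʳ _)))
  subst-monomials σ (cst a) = P.sym (P.trans (P.+-identityʳ _) (P.*-identityʳ _))
  subst-monomials σ (p ⊕ q) = P.trans (P.+-cong (subst-monomials σ p) (subst-monomials σ q)) (P.sym (∑-++ (monomials p) (monomials q) _))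
  subst-monomials σ (p ⊗ q) = begin
    subst F σ p ⊗ subst F σ q                                               ≈⟨ P.*-cong (subst-monomials σ p) (subst-monomials σ q) ⟩
    ∑ ms (term σ) ⊗ ∑ ms′ (term σ)                                          ≈⟨ P.trans (∑-*ʳ ms _ _) (∑-cong ms λ m → ∑-*ˡ ms′ _ _) ⟩
    ∑ ms (λ m → ∑ ms′ (λ m′ → term σ m ⊗ term σ m′))                        ≈⟨ ∑-cong ms (λ m → ∑-cong ms′ λ m′ → term-· σ m m′) ⟨
    ∑ ms (λ m → ∑ ms′ (λ m′ → term σ (m · m′)))                             ≈⟨ ∑-cartesian _·_ ms ms′ _ ⟨
    ∑ (monomials (p ⊗ q)) (term σ)                                          ∎
    where
    open PR
    ms  = monomials p
    ms′ = monomials q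

  subst-var : ∀ (p : Poly) → subst F var p ≡ p
  subst-var (var i) = refl
  subst-var (cst a) = refl
  subst-var (p ⊕ q) = cong₂ _⊕_ (subst-var p) (subst-var q)
  subst-var (p ⊗ q) = cong₂ _⊗_ (subst-var p) (subst-var q)

  _≟W_ : DecidableEquality (List ℕ)
  _≟W_ = List-≡-dec _≟ℕ_

  coeff-mon : ∀ w u → coeff F (mon var w) u K.≈ does (w ≟W u) SK.▸ K.1#
  coeff-mon []      []      = K.refl
  coeff-mon []      (x ∷ u) = K.refl
  coeff-mon (i ∷ w) []      = K.trans (coeff-⊗ (var i) (mon var w) []) (K.zeroˡ _)
  coeff-mon (i ∷ w) (x ∷ u) = begin
    coeff F (var i ⊗ mon var w) (x ∷ u)                          ≈⟨ coeff-⊗ (var i) (mon var w) (x ∷ u) ⟩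
    K.0# K.* _ K.+ conv (coeff F (var i) ∘ (x ∷_)) (coeff F (mon var w)) u
      ≈⟨ K.trans (K.+-congʳ (K.zeroˡ _)) (K.+-identityˡ _) ⟩
    conv (coeff F (var i) ∘ (x ∷_)) (coeff F (mon var w)) u       ≈⟨ conv-cong {g = coeff F (mon var w)} tail-var (λ _ → K.refl) u ⟩
    conv (coeff F (cst b)) (coeff F (mon var w)) u                ≈⟨ conv-cstˡ b _ u ⟩
    b K.* coeff F (mon var w) u                                   ≈⟨ K.*-congˡ (coeff-mon w u) ⟩
    b K.* (does (w ≟W u) SK.▸ K.1#)                               ≈⟨ combine-tests (i ≡ᵇ x) (does (w ≟W u)) ⟩
    does ((i ∷ w) ≟W (x ∷ u)) SK.▸ K.1#                           ∎
    where
    open KR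
    b : K.Carrier
    b = if i ≡ᵇ x then K.1# else K.0#
    tail-var : ∀ v → coeff F (var i) (x ∷ v) K.≈ coeff F (cst b) v
    tail-var []      = K.refl
    tail-var (_ ∷ _) = K.refl
    combine-tests : ∀ s t → (if s then K.1# else K.0#) K.* (t SK.▸ K.1#) K.≈ (s ∧ t) SK.▸ K.1#
    combine-tests true  t = K.*-identityˡ _
    combine-tests false t = K.zeroˡ _

  coefficient : List Monomial → Series
  coefficient ms u = SK.∑ ms (λ m → does (proj₂ m ≟W u) SK.▸ proj₁ m)

  coeff-monomials : ∀ p u → coeff F p u K.≈ coefficient (monomials p) u
  coeff-monomials p u = begin
    coeff F p u                                           ≡⟨ cong (λ q → coeff F q u) (subst-var p) ⟨
    coeff F (subst F var p) u                             ≈⟨ at (subst-monomials var p) u ⟩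
    coeff F (∑ (monomials p) (term var)) u                ≈⟨ coeff-∑ (monomials p) _ u ⟩
    SK.∑ (monomials p) (λ m → coeff F (term var m) u)     ≈⟨ SK.∑-cong (monomials p) (λ { (a , w) → begin
        coeff F (cst a ⊗ mon var w) u         ≈⟨ cst-⊗ a (mon var w) u ⟩
        a K.* coeff F (mon var w) u           ≈⟨ K.*-congˡ (coeff-mon w u) ⟩
        a K.* (does (w ≟W u) SK.▸ K.1#)       ≈⟨ SK.▸-*ʳ (does (w ≟W u)) _ _ ⟩
        does (w ≟W u) SK.▸ (a K.* K.1#)       ≈⟨ SK.▸-cong (does (w ≟W u)) (K.*-identityʳ a) ⟩
        does (w ≟W u) SK.▸ a                  ∎ }) ⟩
    coefficient (monomials p) u                           ∎
    where open KR

  ∑-unique : ∀ {us} → Unique us → ∀ {w} → w ∈ us → (f : List ℕ → Poly) → ∑ us (λ u → does (w ≟W u) ▸ f u) ≋ f w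
  ∑-unique {u ∷ us} (u∉ ∷ _) {w} (here refl) f = begin
    does (w ≟W w) ▸ f w ⊕ ∑ us (λ u → does (w ≟W u) ▸ f u)
      ≈⟨ P.+-cong (▸-congᵇ (f w) (dec-true (w ≟W w) refl)) (others us u∉) ⟩
    f w ⊕ cst K.0#      ≈⟨ P.+-identityʳ _ ⟩
    f w                 ∎
    where
    open PR
    others : ∀ vs → All (λ v → ¬ w ≡ v) vs → ∑ vs (λ v → does (w ≟W v) ▸ f v) ≋ cst K.0#
    others []       []         = P.refl
    others (v ∷ vs) (w≢v ∷ ws) = P.trans (P.+-cong (▸-congᵇ (f v) (dec-false (w ≟W v) w≢v)) (others vs ws)) (P.+-identityʳ _)
  ∑-unique {u ∷ us} (u∉ ∷ un) {w} (there w∈) f = begin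
    does (w ≟W u) ▸ f u ⊕ ∑ us (λ u → does (w ≟W u) ▸ f u)
      ≈⟨ P.+-cong (▸-congᵇ (f u) (dec-false (w ≟W u) λ { refl → All.lookup u∉ w∈ refl })) (∑-unique un w∈ f) ⟩
    cst K.0# ⊕ f w      ≈⟨ P.+-identityˡ _ ⟩
    f w                 ∎
    where open PR

  -- Gathers like terms. The list `us` may contain further words, so that two expressions can be
  -- collected along the same list; the test may depend on the word only, as a bound on the degree
  -- does.
  collect : ∀ σ (t : List ℕ → Bool) {us} → Unique us → ∀ ms → All (λ m → proj₂ m ∈ us) ms →
            ∑ ms (λ m → t (proj₂ m) ▸ term σ m) ≋ ∑ us (λ u → t u ▸ (cst (coefficient ms u) ⊗ mon σ u))
  collect σ t {us} un []             []         = P.sym (∑-zero us λ u → P.trans (▸-cong (t u) (P.zeroˡ _)) (▸-zero (t u)))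
  collect σ t {us} un ((a , w) ∷ ms) (w∈ ∷ ms∈) = begin
    t w ▸ term σ (a , w) ⊕ ∑ ms (λ m → t (proj₂ m) ▸ term σ m)
      ≈⟨ P.+-cong (P.sym (∑-unique un w∈ λ u → t u ▸ term σ (a , u))) (collect σ t un ms ms∈) ⟩
    ∑ us (λ u → does (w ≟W u) ▸ t u ▸ term σ (a , u)) ⊕ ∑ us (λ u → t u ▸ (cst (coefficient ms u) ⊗ mon σ u))
      ≈⟨ ∑-+ us _ _ ⟨
    ∑ us (λ u → does (w ≟W u) ▸ t u ▸ term σ (a , u) ⊕ t u ▸ (cst (coefficient ms u) ⊗ mon σ u))
      ≈⟨ ∑-cong us (λ u → begin
          does (w ≟W u) ▸ t u ▸ term σ (a , u) ⊕ t u ▸ (cst (coefficient ms u) ⊗ mon σ u)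
            ≈⟨ P.+-congʳ (P.trans (▸-comm (does (w ≟W u)) (t u) _) (▸-cong (t u) (P.sym (▸-*ˡ (does (w ≟W u)) _ _)))) ⟩
          t u ▸ ((does (w ≟W u) ▸ cst a) ⊗ mon σ u) ⊕ t u ▸ (cst (coefficient ms u) ⊗ mon σ u)
            ≈⟨ ▸-+ (t u) _ _ ⟨
          t u ▸ ((does (w ≟W u) ▸ cst a) ⊗ mon σ u ⊕ cst (coefficient ms u) ⊗ mon σ u)
            ≈⟨ ▸-cong (t u) (P.trans (P.sym (P.distribʳ _ _ _)) (P.*-congʳ (P.trans (P.+-congʳ (P.sym (cst-▸ (does (w ≟W u)) a))) (P.sym (cst-+ _ _))))) ⟩
          t u ▸ (cst (coefficient ((a , w) ∷ ms) u) ⊗ mon σ u) ∎) ⟩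
    ∑ us (λ u → t u ▸ (cst (coefficient ((a , w) ∷ ms) u) ⊗ mon σ u)) ∎
    where open PR

  -- Substitution only sees the coefficients, so the monomials of p of degree above d may be dropped although they need not vanish individually.
  subst-bounded : ∀ σ d p g → _≃_ F p g → DegLe F d g →
                  subst F σ g ≋ ∑ (monomials p) (λ m → does (length (proj₂ m) ≤? d) ▸ term σ m)
  subst-bounded σ d p g p≃g g≤d = begin
    subst F σ g                                                          ≈⟨ subst-monomials σ g ⟩
    ∑ (monomials g) (term σ)                                             ≈⟨ collect σ (λ _ → true) un (monomials g) (All.tabulate λ m∈ → covers (∈-++⁺ʳ (map proj₂ (monomials p)) (∈-map⁺ proj₂ m∈))) ⟩
    ∑ us (λ u → cst (coefficient (monomials g) u) ⊗ mon σ u)             ≈⟨ ∑-cong us (λ u → truncate u (length u ≤? d)) ⟩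
    ∑ us (λ u → does (length u ≤? d) ▸ (cst (coefficient (monomials p) u) ⊗ mon σ u))
      ≈⟨ collect σ (λ u → does (length u ≤? d)) un (monomials p) (All.tabulate λ m∈ → covers (∈-++⁺ˡ (∈-map⁺ proj₂ m∈))) ⟨
    ∑ (monomials p) (λ m → does (length (proj₂ m) ≤? d) ▸ term σ m)      ∎
    where
    open PR
    us : List (List ℕ)
    -- The words of both expressions, so that their coefficients can be compared one word at a time.
    us = deduplicate _≟W_ (map proj₂ (monomials p) ++ map proj₂ (monomials g))
    un : Unique us
    un = deduplicate-! _≟W_ _
    covers : ∀ {w} → w ∈ map proj₂ (monomials p) ++ map proj₂ (monomials g) → w ∈ us
    covers = ∈-deduplicate⁺ _≟W_
    truncate : ∀ u (u? : Dec (length u ≤ d)) → cst (coefficient (monomials g) u) ⊗ mon σ u ≋ does u? ▸ (cst (coefficient (monomials p) u) ⊗ mon σ u)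
    truncate u (yes _)  = P.*-congʳ (cst-cong (K.trans (K.sym (coeff-monomials g u)) (K.trans (K.sym (p≃g u)) (coeff-monomials p u))))
    truncate u (no u≰d) = P.trans (P.*-congʳ (cst-cong (K.trans (K.sym (coeff-monomials g u)) (g≤d u (ℕₚ.≰⇒> u≰d))))) (P.zeroˡ _)

  -- Homogeneous components

  -- Formed from the monomials of the expression before any cancellation; the recursion along sums
  -- and products is then a fact about lists.
  homogeneous : (ℕ → Poly) → ℕ → Poly → Poly
  homogeneous σ k p = ∑ (monomials p) (λ m → does (length (proj₂ m) ≟ℕ k) ▸ term σ m)

  ∑-≟ℕ : ∀ {n a} (a<n : a < n) (f : Fin n → Poly) → ∑ (allFin n) (λ j → does (a ≟ℕ toℕ j) ▸ f j) ≋ f (fromℕ< a<n)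
  ∑-≟ℕ {n} {a} a<n f = P.trans
    (∑-cong (allFin n) λ j → ▸-congᵇ (f j) (does-⇔ (a ≟ℕ toℕ j) (j ≟F fromℕ< a<n)
      (λ e → toℕ-injective (≡.trans (≡.sym e) (≡.sym (toℕ-fromℕ< a<n))))
      (λ e → ≡.trans (≡.sym (toℕ-fromℕ< a<n)) (cong toℕ (≡.sym e)))))
    (Delta-Fin n (fromℕ< a<n) f)

  -- Here `p` is going to be the output of a circuit for `g`. Its formal degree may far exceed `d`,
  -- but what lies above `d` sums to zero word by word.
  subst-homogeneous : ∀ σ d p g → _≃_ F p g → DegLe F d g →
                      subst F σ g ≋ ∑ (allFin (suc d)) (λ k → homogeneous σ (toℕ k) p)
  subst-homogeneous σ d p g p≃g g≤d = P.trans (subst-bounded σ d p g p≃g g≤d) (P.trans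
    (∑-cong (monomials p) (λ m → by-degree (term σ m) (length (proj₂ m)) (length (proj₂ m) ≤? d)))
    (∑-swap (monomials p) (allFin (suc d)) _))
    where
    by-degree : ∀ x a (a? : Dec (a ≤ d)) → does a? ▸ x ≋ ∑ (allFin (suc d)) (λ k → does (a ≟ℕ toℕ k) ▸ x)
    by-degree x a (yes a≤d) = P.sym (∑-≟ℕ (s≤s a≤d) λ _ → x)
    by-degree x a (no a≰d)  = P.sym (∑-zero (allFin (suc d)) λ k → ▸-congᵇ x (dec-false (a ≟ℕ toℕ k) λ { refl → a≰d (ℕₚ.≤-pred (toℕ<n k)) }))

  homogeneous-var : ∀ σ k i → homogeneous σ k (var i) ≋ does (1 ≟ℕ k) ▸ σ i
  homogeneous-var σ k i = P.trans (P.+-identityʳ _) (▸-cong (does (1 ≟ℕ k)) (P.trans (P.*-identityˡ _) (P.*-identityʳ _)))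

  homogeneous-cst : ∀ σ k a → homogeneous σ k (cst a) ≋ does (0 ≟ℕ k) ▸ cst a
  homogeneous-cst σ k a = P.trans (P.+-identityʳ _) (▸-cong (does (0 ≟ℕ k)) (P.*-identityʳ _))

  homogeneous-⊕ : ∀ σ k p q → homogeneous σ k (p ⊕ q) ≋ homogeneous σ k p ⊕ homogeneous σ k q
  homogeneous-⊕ σ k p q = ∑-++ (monomials p) (monomials q) _

  -- The degree of the left factor runs over the fixed range up to `D`, restricted by a test,
  -- because it will be the degree part of a node, whose type does not depend on `k`.
  homogeneous-⊗ : ∀ σ {D} k p q → k ≤ D →
    homogeneous σ k (p ⊗ q) ≋ ∑ (allFin (suc D)) (λ j → does (toℕ j ≤? k) ▸ (homogeneous σ (toℕ j) p ⊗ homogeneous σ (k ∸ toℕ j) q))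
  homogeneous-⊗ σ {D} k p q k≤D = begin
    homogeneous σ k (p ⊗ q)
      ≈⟨ ∑-cartesian _·_ ms ms′ _ ⟩
    ∑ ms (λ m → ∑ ms′ (λ m′ → does (length (proj₂ m ++ proj₂ m′) ≟ℕ k) ▸ term σ (m · m′)))
      ≈⟨ ∑-cong ms (λ m → ∑-cong ms′ λ m′ → P.trans (▸-cong (does (length (proj₂ m ++ proj₂ m′) ≟ℕ k)) (term-· σ m m′)) (split _ (length (proj₂ m ++ proj₂ m′)) (length (proj₂ m)) _ (length-++ (proj₂ m)))) ⟩
    ∑ ms (λ m → ∑ ms′ (λ m′ → ∑ js (λ j → does (toℕ j ≤? k) ▸ (does (length (proj₂ m) ≟ℕ toℕ j) ∧ does (length (proj₂ m′) ≟ℕ k ∸ toℕ j)) ▸ (term σ m ⊗ term σ m′))))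
      ≈⟨ ∑-cong ms (λ m → ∑-swap ms′ js _) ⟩
    ∑ ms (λ m → ∑ js (λ j → ∑ ms′ (λ m′ → does (toℕ j ≤? k) ▸ (does (length (proj₂ m) ≟ℕ toℕ j) ∧ does (length (proj₂ m′) ≟ℕ k ∸ toℕ j)) ▸ (term σ m ⊗ term σ m′))))
      ≈⟨ ∑-swap ms js _ ⟩
    ∑ js (λ j → ∑ ms (λ m → ∑ ms′ (λ m′ → does (toℕ j ≤? k) ▸ (does (length (proj₂ m) ≟ℕ toℕ j) ∧ does (length (proj₂ m′) ≟ℕ k ∸ toℕ j)) ▸ (term σ m ⊗ term σ m′))))
      ≈⟨ ∑-cong js (λ j → P.trans (∑-cong ms λ m → P.sym (▸-∑ (does (toℕ j ≤? k)) ms′ _)) (P.sym (▸-∑ (does (toℕ j ≤? k)) ms _))) ⟩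
    ∑ js (λ j → does (toℕ j ≤? k) ▸ ∑ ms (λ m → ∑ ms′ (λ m′ → (does (length (proj₂ m) ≟ℕ toℕ j) ∧ does (length (proj₂ m′) ≟ℕ k ∸ toℕ j)) ▸ (term σ m ⊗ term σ m′))))
      ≈⟨ ∑-cong js (λ j → ▸-cong (does (toℕ j ≤? k)) (∑-cong ms λ m → P.trans (∑-*ˡ ms′ _ _) (∑-cong ms′ λ m′ → ▸-* (does (length (proj₂ m) ≟ℕ toℕ j)) (does (length (proj₂ m′) ≟ℕ k ∸ toℕ j)) _ _))) ⟨
    ∑ js (λ j → does (toℕ j ≤? k) ▸ ∑ ms (λ m → (does (length (proj₂ m) ≟ℕ toℕ j) ▸ term σ m) ⊗ homogeneous σ (k ∸ toℕ j) q))
      ≈⟨ ∑-cong js (λ j → ▸-cong (does (toℕ j ≤? k)) (∑-*ʳ ms _ _)) ⟨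
    ∑ js (λ j → does (toℕ j ≤? k) ▸ (homogeneous σ (toℕ j) p ⊗ homogeneous σ (k ∸ toℕ j) q)) ∎
    where
    open PR
    ms  = monomials p
    ms′ = monomials q
    js  = allFin (suc D)
    arith : ∀ {n a b} → n ≡ a +ℕ b → a ≤ k → does (n ≟ℕ k) ≡ does (a ≤? k) ∧ does (b ≟ℕ k ∸ a)
    arith {n} {a} {b} n≡ a≤k rewrite n≡ | dec-true (a ≤? k) a≤k = does-⇔ (a +ℕ b ≟ℕ k) (b ≟ℕ k ∸ a)
      (λ { refl → ≡.sym (ℕₚ.m+n∸m≡n a b) }) (λ { refl → ℕₚ.m+[n∸m]≡n a≤k })
    split : ∀ x n a b → n ≡ a +ℕ b →
            does (n ≟ℕ k) ▸ x ≋ ∑ js (λ j → does (toℕ j ≤? k) ▸ (does (a ≟ℕ toℕ j) ∧ does (b ≟ℕ k ∸ toℕ j)) ▸ x)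
    split x n a b n≡ with a ≤? k
    ... | yes a≤k = P.sym (begin
      ∑ js (λ j → does (toℕ j ≤? k) ▸ (does (a ≟ℕ toℕ j) ∧ does (b ≟ℕ k ∸ toℕ j)) ▸ x)
        ≈⟨ ∑-cong js (λ j → P.trans (▸-cong (does (toℕ j ≤? k)) (▸-∧ (does (a ≟ℕ toℕ j)) (does (b ≟ℕ k ∸ toℕ j)) x))
                                    (▸-comm (does (toℕ j ≤? k)) (does (a ≟ℕ toℕ j)) _)) ⟩
      ∑ js (λ j → does (a ≟ℕ toℕ j) ▸ does (toℕ j ≤? k) ▸ does (b ≟ℕ k ∸ toℕ j) ▸ x)
        ≈⟨ ∑-≟ℕ (s≤s (ℕₚ.≤-trans a≤k k≤D)) (λ j → does (toℕ j ≤? k) ▸ does (b ≟ℕ k ∸ toℕ j) ▸ x) ⟩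
      _ ≡⟨ cong (λ i → does (i ≤? k) ▸ does (b ≟ℕ k ∸ i) ▸ x) (toℕ-fromℕ< (s≤s (ℕₚ.≤-trans a≤k k≤D))) ⟩
      does (a ≤? k) ▸ does (b ≟ℕ k ∸ a) ▸ x   ≈⟨ ▸-∧ (does (a ≤? k)) (does (b ≟ℕ k ∸ a)) x ⟨
      (does (a ≤? k) ∧ does (b ≟ℕ k ∸ a)) ▸ x ≈⟨ ▸-congᵇ x (arith n≡ a≤k) ⟨
      does (n ≟ℕ k) ▸ x                       ∎)
    ... | no a≰k = P.trans
      (▸-congᵇ x (dec-false (n ≟ℕ k) λ { refl → a≰k (ℕₚ.≤-trans (ℕₚ.m≤m+n a b) (ℕₚ.≤-reflexive (≡.sym n≡))) }))
      (P.sym (∑-zero js λ j → kill j (toℕ j ≤? k)))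
      where
      kill : ∀ j (j? : Dec (toℕ j ≤ k)) → does j? ▸ (does (a ≟ℕ toℕ j) ∧ does (b ≟ℕ k ∸ toℕ j)) ▸ x ≋ cst K.0#
      kill j (no _)    = P.refl
      kill j (yes j≤k) rewrite dec-false (a ≟ℕ toℕ j) (λ a≡j → a≰k (≡.subst (_≤ k) (≡.sym a≡j) j≤k)) = P.refl

-- The cyclic successor

isLast : ∀ {n} → Fin (suc n) → Bool
isLast {zero}  _       = true
isLast {suc n} zero    = false
isLast {suc n} (suc j) = isLast j

next : ∀ {n} → Fin (suc n) → Fin (suc n)
next {n} ρ with suc (toℕ ρ) <? suc n
... | yes p = fromℕ< p
... | no  _ = zero

toℕ-next : ∀ {n} (ρ : Fin (suc n)) → suc (toℕ ρ) < suc n → toℕ (next ρ) ≡ suc (toℕ ρ)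
toℕ-next {n} ρ p with suc (toℕ ρ) <? suc n
... | yes q = toℕ-fromℕ< q
... | no ¬q = ⊥-elim (¬q p)

next-top : ∀ {n} (ρ : Fin (suc n)) → suc (toℕ ρ) ≡ suc n → next ρ ≡ zero
next-top {n} ρ e with suc (toℕ ρ) <? suc n
... | yes q = ⊥-elim (ℕₚ.<-irrefl e q)
... | no  _ = refl

below-or-top : ∀ {n} (ρ : Fin (suc n)) → suc (toℕ ρ) < suc n ⊎ suc (toℕ ρ) ≡ suc n
below-or-top ρ = ℕₚ.m≤n⇒m<n∨m≡n (toℕ<n ρ)

next-injective : ∀ {n} (ρ ρ′ : Fin (suc n)) → next ρ ≡ next ρ′ → ρ ≡ ρ′
next-injective ρ ρ′ e with below-or-top ρ | below-or-top ρ′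
... | inj₁ p | inj₁ p′ = toℕ-injective (ℕₚ.suc-injective (≡.trans (≡.sym (toℕ-next ρ p)) (≡.trans (cong toℕ e) (toℕ-next ρ′ p′))))
... | inj₁ p | inj₂ q′ with () ← ≡.trans (≡.sym (toℕ-next ρ p)) (cong toℕ (≡.trans e (next-top ρ′ q′)))
... | inj₂ q | inj₁ p′ with () ← ≡.trans (≡.sym (toℕ-next ρ′ p′)) (cong toℕ (≡.trans (≡.sym e) (next-top ρ q)))
... | inj₂ q | inj₂ q′ = toℕ-injective (ℕₚ.suc-injective (≡.trans q (≡.sym q′)))

-- False on a one-element type; this is why the automaton is given at least two rounds.
next≢ : ∀ {n} (ρ : Fin (suc (suc n))) → ¬ next ρ ≡ ρ
next≢ ρ e with below-or-top ρ
... | inj₁ p = ℕₚ.1+n≢n (≡.trans (≡.sym (toℕ-next ρ p)) (cong toℕ e))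
... | inj₂ q with () ← ≡.trans (cong (suc ∘ toℕ) (≡.trans (≡.sym (next-top ρ q)) e)) q

-- `next` is a single cycle: `p0` walks to the top and wraps around to `zero`, and `up` climbs from
-- there. It carries a bit from one round to all others.
next-orbit : ∀ {n} (p : Fin (suc n) → Set) → (∀ ρ → p ρ → p (next ρ)) → ∀ ρ ρ′ → p ρ → p ρ′
next-orbit {n} p step ρ ρ′ pρ = up (toℕ ρ′) ρ′ refl
  where
  p0 : ∀ k ρ → k +ℕ suc (toℕ ρ) ≡ suc n → p ρ → p zero
  p0 zero    ρ e pρ = ≡.subst p (next-top ρ e) (step ρ pρ)
  p0 (suc k) ρ e pρ = p0 k (next ρ) (≡.trans (cong (λ i → k +ℕ suc i) (toℕ-next ρ below)) (≡.trans (ℕₚ.+-suc k (suc (toℕ ρ))) e)) (step ρ pρ)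
    where
    below : suc (toℕ ρ) < suc n
    below = ℕₚ.≤-trans (s≤s (ℕₚ.m≤n+m (suc (toℕ ρ)) k)) (ℕₚ.≤-reflexive e)
  up : ∀ k ρ′ → toℕ ρ′ ≡ k → p ρ′
  up zero    zero     refl = p0 (n ∸ toℕ ρ) ρ (≡.trans (ℕₚ.+-suc _ _) (cong suc (ℕₚ.m∸n+n≡m (ℕₚ.≤-pred (toℕ<n ρ))))) pρ
  up (suc k) (suc ρ′) e    = ≡.subst p (toℕ-injective (≡.trans (toℕ-next before before<) (cong suc (toℕ-fromℕ< before<′)))) (step before (up k before (≡.trans (toℕ-fromℕ< before<′) (ℕₚ.suc-injective e))))
    where
    before<′ : toℕ ρ′ < suc n
    before<′ = ℕₚ.m≤n⇒m≤1+n (toℕ<n ρ′)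
    before : Fin (suc n)
    before = fromℕ< before<′
    before< : suc (toℕ before) < suc n
    before< = ℕₚ.≤-trans (ℕₚ.≤-reflexive (cong (λ i → suc (suc i)) (toℕ-fromℕ< before<′))) (s≤s (toℕ<n ρ′))

-- Cuts the sequence of all slots into rounds.
tabulate-combine : ∀ {a} {A : Set a} R r (f : Fin (R *ℕ r) → A) →
                   List.tabulate f ≡ List.concat (List.tabulate {n = R} (λ ρ → List.tabulate {n = r} (λ j → f (combine ρ j))))
tabulate-combine zero    r f = refl
tabulate-combine (suc R) r f = ≡.trans (tabulate-+ r f) (cong (List.tabulate (λ j → f (j ↑ˡ (R *ℕ r))) ++_) (tabulate-combine R r (f ∘ (r ↑ʳ_))))
  where
  tabulate-+ : ∀ {a} {A : Set a} m {n} (f : Fin (m +ℕ n) → A) →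
               List.tabulate f ≡ List.tabulate (λ i → f (i ↑ˡ n)) ++ List.tabulate (f ∘ (m ↑ʳ_))
  tabulate-+ zero    f = refl
  tabulate-+ (suc m) f = cong (f zero ∷_) (tabulate-+ m (f ∘ suc))

-- The symmetrized determinant under substitution

module SymmetrizedDeterminant {c ℓ} (F : CharZeroField c ℓ) where
  open Polynomials F
  open PR

  concatMap-pair : ∀ {X Y : Set} {x y} {xs : List X} {ys : List Y} → x ∈ xs → y ∈ ys → (x , y) ∈ concatMap (λ a → map (a ,_) ys) xs
  concatMap-pair (here refl) y∈ = ∈-++⁺ˡ (∈-map⁺ _ y∈)
  concatMap-pair {xs = z ∷ _} {ys} (there x∈) y∈ = ∈-++⁺ʳ (map (z ,_) ys) (concatMap-pair x∈ y∈)

  pair∈ : ∀ {n} (i j : Fin n) → toℕ i < toℕ j → (i , j) ∈ pairs F n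
  pair∈ i j i<j = ∈-filter⁺ (λ ij → toℕ (proj₁ ij) <? toℕ (proj₂ ij)) (concatMap-pair (∈-allFin i) (∈-allFin j)) i<j

  and-distinct : ∀ {n} (σ : Fin n → Fin n) ps → and (map (λ ij → if ⌊ σ (proj₁ ij) ≟F σ (proj₂ ij) ⌋ then false else true) ps) ≡ true →
                 ∀ {i j} → (i , j) ∈ ps → ¬ σ i ≡ σ j
  and-distinct σ ((i , j) ∷ ps) h  (here refl) with σ i ≟F σ j
  and-distinct σ ((i , j) ∷ ps) () (here refl) | yes _
  ... | no ne = ne
  and-distinct σ ((i , j) ∷ ps) h  (there m) = and-distinct σ ps (∧-⇒ʳ {if ⌊ σ i ≟F σ j ⌋ then false else true} h) m

  isInjective-sound : ∀ {n} (σ : Fin n → Fin n) → isInjective F σ ≡ true → ∀ i j → σ i ≡ σ j → i ≡ j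
  isInjective-sound {n} σ inj i j e with ℕₚ.<-cmp (toℕ i) (toℕ j)
  ... | tri< i<j _ _ = ⊥-elim (and-distinct σ (pairs F n) inj (pair∈ i j i<j) e)
  ... | tri≈ _ i≡j _ = toℕ-injective i≡j
  ... | tri> _ _ j<i = ⊥-elim (and-distinct σ (pairs F n) inj (pair∈ j i j<i) (≡.sym e))

  isInjective-complete : ∀ {n} (σ : Fin n → Fin n) → (∀ i j → σ i ≡ σ j → i ≡ j) → isInjective F σ ≡ true
  isInjective-complete {n} σ inj = go (pairs F n) (all-filter (λ ij → toℕ (proj₁ ij) <? toℕ (proj₂ ij)) (concatMap (λ i → map (i ,_) (allFin n)) (allFin n)))
    where
    go : ∀ ps → All (λ ij → toℕ (proj₁ ij) < toℕ (proj₂ ij)) ps → and (map (λ ij → if ⌊ σ (proj₁ ij) ≟F σ (proj₂ ij) ⌋ then false else true) ps) ≡ true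
    go []             []         = refl
    go ((i , j) ∷ ps) (i<j ∷ h) with σ i ≟F σ j
    ... | yes e = ⊥-elim (ℕₚ.<-irrefl (cong toℕ (inj i j e)) i<j)
    ... | no  _ = go ps h

  isInjective-cong : ∀ {n} {σ τ : Fin n → Fin n} → σ ≗ τ → isInjective F σ ≡ isInjective F τ
  isInjective-cong {n} {σ} {τ} e = cong and (map-cong (λ ij → cong₂ (λ a b → if ⌊ a ≟F b ⌋ then false else true) (e (proj₁ ij)) (e (proj₂ ij))) (pairs F n))

  sgn-cong : ∀ {n} {σ τ : Fin n → Fin n} → σ ≗ τ → sgn F σ ≡ sgn F τ
  sgn-cong {n} {σ} {τ} e = cong (λ k → if isEven F k then K.1# else K.- K.1#) (cong length (go (pairs F n)))
    where
    go : ∀ ps → filter (λ ij → toℕ (σ (proj₂ ij)) <? toℕ (σ (proj₁ ij))) ps ≡ filter (λ ij → toℕ (τ (proj₂ ij)) <? toℕ (τ (proj₁ ij))) ps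
    go [] = refl
    go ((i , j) ∷ ps) rewrite e i | e j with does (toℕ (τ j) <? toℕ (τ i))
    ... | true  = cong ((i , j) ∷_) (go ps)
    ... | false = go ps

  sgn-square : ∀ {n} (σ : Fin n → Fin n) → sgn F σ K.* sgn F σ K.≈ K.1#
  sgn-square σ with isEven F (inversions F σ)
  ... | true  = K.*-identityˡ _
  ... | false = K.trans (-1*x≈-x (K.- K.1#)) (-‿involutive K.1#)

  infixr 5 _∷ᶠ_
  _∷ᶠ_ : ∀ {n} {X : Set} → X → (Fin n → X) → Fin (suc n) → X
  (a ∷ᶠ f) zero    = a
  (a ∷ᶠ f) (suc i) = f i

  -- Passes from functions to vectors, which have decidable equality and hence a `Delta`. As
  -- pointwise equal functions need not be equal, `h` has to respect `≗`.
  ∑-allMaps : ∀ n k (h : (Fin n → Fin k) → Poly) → (∀ {σ τ} → σ ≗ τ → h σ ≋ h τ) →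
              ∑ (allMaps F n k) h ≋ ∑ (vecs n (allFin k)) (h ∘ lookup)
  ∑-allMaps zero    k h ext = P.+-congʳ (ext λ ())
  ∑-allMaps (suc n) k h ext = begin
    ∑ (allMaps F (suc n) k) h
      ≈⟨ ∑-cartesian _ (allFin k) (allMaps F n k) h ⟩
    _ ≈⟨ ∑-cong (allFin k) (λ a → ∑-cong (allMaps F n k) λ f → ext {τ = a ∷ᶠ f} λ { zero → refl ; (suc i) → refl }) ⟩
    ∑ (allFin k) (λ a → ∑ (allMaps F n k) (λ f → h (a ∷ᶠ f)))
      ≈⟨ ∑-cong (allFin k) (λ a → ∑-allMaps n k (λ f → h (a ∷ᶠ f)) λ e → ext λ { zero → refl ; (suc i) → e i }) ⟩
    ∑ (allFin k) (λ a → ∑ (vecs n (allFin k)) (λ v → h (a ∷ᶠ lookup v)))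
      ≈⟨ ∑-cong (allFin k) (λ a → ∑-cong (vecs n (allFin k)) λ v → ext λ { zero → refl ; (suc i) → refl }) ⟩
    ∑ (allFin k) (λ a → ∑ (vecs n (allFin k)) (λ v → h (lookup (a ∷ᵥ v))))
      ≈⟨ ∑-vecs n (allFin k) (h ∘ lookup) ⟨
    ∑ (vecs (suc n) (allFin k)) (h ∘ lookup) ∎

  ∑-perms : ∀ n (h : (Fin n → Fin n) → Poly) → (∀ {σ τ} → σ ≗ τ → h σ ≋ h τ) →
            ∑ (perms F n) h ≋ ∑ (vecs n (allFin n)) (λ v → isInjective F (lookup v) ▸ h (lookup v))
  ∑-perms n h ext = P.trans (∑-filter (λ σ → T? (isInjective F σ)) (allMaps F n n) h)
    (∑-allMaps n n (λ σ → isInjective F σ ▸ h σ) λ {σ} {τ} e → P.trans (▸-congᵇ (h σ) (isInjective-cong e)) (▸-cong (isInjective F τ) (ext e)))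

  subst-matProd : ∀ {m} σ (Ms : List (Mat F m)) k l →
                  subst F σ (matProd F Ms k l) ≋ mprod (FinF m) (map (λ M a b → subst F σ (M a b)) Ms) k l
  subst-matProd σ []       k l with k ≟F l
  ... | yes _ = P.refl
  ... | no  _ = P.refl
  subst-matProd {m} σ (M ∷ Ms) k l = P.trans (P.reflexive (≡.trans (cong (subst F σ) (sumP-map (allFin m) _)) (subst-∑ σ (allFin m) _)))
    (∑-cong (allFin m) λ e → P.*-congˡ (subst-matProd σ Ms e l))

  invFactorial : ℕ → K.Carrier
  invFactorial n = inv (ℕ→R commutativeRing (n !)) (n!≉0 F n)

  sumP-∑ : ∀ (ps : List Poly) → sumP F ps ≡ ∑ ps id
  sumP-∑ []       = refl
  sumP-∑ (p ∷ ps) = cong (p ⊕_) (sumP-∑ ps)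

  signedTerm : ∀ {n m} (M : Fin n → Fin n → Fin m → Fin m → Poly) (k l : Fin m) (σ τ : Fin n → Fin n) → Poly
  signedTerm M k l σ τ = cst (sgn F σ K.* sgn F τ) ⊗ mprod (FinF _) (List.tabulate (λ i → M (σ i) (τ i))) k l

  signedTerm-cong : ∀ {n m} (M : Fin n → Fin n → Fin m → Fin m → Poly) (k l : Fin m) {σ σ′ τ τ′ : Fin n → Fin n} →
                    σ ≗ σ′ → τ ≗ τ′ → signedTerm M k l σ τ ≋ signedTerm M k l σ′ τ′
  signedTerm-cong M k l e e′ = P.*-cong (P.reflexive (cong₂ (λ a b → cst (a K.* b)) (sgn-cong e) (sgn-cong e′)))
    (mprod-cong (FinF _) (λ t x y → P.reflexive (cong₂ (λ i j → M i j x y) (e t) (e′ t))) k l)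

  -- Common to both halves of the proof: in the hardness part `σ` is the wiring of an oracle gate,
  -- in the membership part it is `var`.
  subst-sdet : ∀ σ n m k l → subst F σ (sdetM F n m k l) ≋
    cst (invFactorial n) ⊗ ∑ (vecs n (allFin n)) (λ u → isInjective F (lookup u) ▸
      ∑ (vecs n (allFin n)) (λ v → isInjective F (lookup v) ▸ signedTerm (λ i j a b → σ (yIdx F n m i j a b)) k l (lookup u) (lookup v)))
  subst-sdet σ n m k l = P.*-congˡ (begin
    subst F σ (sumP F entries)
      ≡⟨ ≡.trans (cong (subst F σ) (sumP-∑ entries)) (subst-∑ σ entries id) ⟩
    ∑ entries (subst F σ)
      ≈⟨ ∑-cartesian entry (perms F n) (perms F n) (subst F σ) ⟩
    ∑ (perms F n) (λ s → ∑ (perms F n) (λ t → subst F σ (entry s t)))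
      ≈⟨ ∑-cong (perms F n) (λ s → ∑-cong (perms F n) λ t → P.*-congˡ (P.trans (subst-matProd σ (map (λ i → block F n m (s i) (t i)) (allFin n)) k l)
           (P.reflexive (cong (λ Ms → mprod (FinF m) Ms k l) (≡.trans (≡.sym (map-∘ (allFin n))) (map-tabulate id _)))))) ⟩
    ∑ (perms F n) (λ s → ∑ (perms F n) (λ t → signedTerm M k l s t))
      ≈⟨ ∑-cong (perms F n) (λ s → ∑-perms n (signedTerm M k l s) (signedTerm-cong M k l λ _ → refl)) ⟩
    ∑ (perms F n) (λ s → ∑ (vecs n (allFin n)) (λ v → isInjective F (lookup v) ▸ signedTerm M k l s (lookup v)))
      ≈⟨ ∑-perms n _ (λ e → ∑-cong (vecs n (allFin n)) λ v → ▸-cong (isInjective F (lookup v)) (signedTerm-cong M k l e λ _ → refl)) ⟩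
    _ ∎)
    where
    M : Fin n → Fin n → Fin m → Fin m → Poly
    M i j a b = σ (yIdx F n m i j a b)
    entry : (Fin n → Fin n) → (Fin n → Fin n) → Poly
    entry s t = cst (sgn F s K.* sgn F t) ⊗ matProd F (map (λ i → block F n m (s i) (t i)) (allFin n)) k l
    entries : List Poly
    entries = concatMap (λ s → map (λ t → entry s t) (perms F n)) (perms F n)

  mprod-▸ : ∀ {Y : Set} (fin : Finite Y) {n} (b : Fin n → Bool) (M : Fin n → Matrix Y) x y →
            mprod fin (List.tabulate (λ t a c → b t ▸ M t a c)) x y ≋ allᵇ b ▸ mprod fin (List.tabulate M) x y
  mprod-▸ fin {zero}  b M x y = P.refl
  mprod-▸ fin {suc n} b M x y = P.trans
    (∑-cong (elements fin) λ z → P.trans (P.*-congˡ (mprod-▸ fin (b ∘ suc) (M ∘ suc) z y)) (▸-* (b zero) (allᵇ (b ∘ suc)) _ _))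
    (P.sym (▸-∑ (b zero ∧ allᵇ (b ∘ suc)) (elements fin) _))

  -- For a block diagonal matrix only the terms with σ = τ survive, and their signs cancel: the determinant becomes a permanent.
  subst-sdet-diagonal : ∀ σ n m k l (D : Fin n → Fin m → Fin m → Poly) →
    (∀ i j a b → σ (yIdx F n m i j a b) ≋ does (j ≟F i) ▸ D i a b) →
    subst F σ (sdetM F n m k l) ≋
      cst (invFactorial n) ⊗ ∑ (vecs n (allFin n)) (λ u → isInjective F (lookup u) ▸ mprod (FinF m) (List.tabulate (λ t → D (lookup u t))) k l)
  subst-sdet-diagonal σ n m k l D diag = P.trans (subst-sdet σ n m k l) (P.*-congˡ (∑-cong vs λ u → ▸-cong′ (isInjective F (lookup u)) (collapse u)))
    where
    vs = vecs n (allFin n)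
    M : Fin n → Fin n → Fin m → Fin m → Poly
    M i j a b = σ (yIdx F n m i j a b)
    Q : Vec (Fin n) n → Poly
    Q u = mprod (FinF m) (List.tabulate (λ t → D (lookup u t))) k l
    collapse : ∀ u → isInjective F (lookup u) ≡ true → ∑ vs (λ v → isInjective F (lookup v) ▸ signedTerm M k l (lookup u) (lookup v)) ≋ Q u
    collapse u inj = begin
      ∑ vs (λ v → isInjective F (lookup v) ▸ signedTerm M k l (lookup u) (lookup v))
        ≈⟨ ∑-cong vs (λ v → ▸-cong (isInjective F (lookup v)) (P.trans
             (P.*-congˡ (P.trans (mprod-cong (FinF m) (λ t → diag (lookup u t) (lookup v t)) k l) (mprod-▸ (FinF m) (λ t → does (lookup v t ≟F lookup u t)) (λ t → D (lookup u t)) k l)))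
             (▸-*ʳ (allᵇ (λ t → does (lookup v t ≟F lookup u t))) _ _))) ⟩
      ∑ vs (λ v → isInjective F (lookup v) ▸ allᵇ (λ t → does (lookup v t ≟F lookup u t)) ▸ (cst (sgn F (lookup u) K.* sgn F (lookup v)) ⊗ Q u))
        ≈⟨ ∑-cong vs (λ v → P.trans (▸-comm (isInjective F (lookup v)) (allᵇ (λ t → does (lookup v t ≟F lookup u t))) _)
             (▸-congᵇ _ (≡.trans (≡.sym (does-Vec _≟F_ v (lookup u))) (cong (λ w → does (Vec-≡-dec _≟F_ v w)) (tabulate∘lookup u))))) ⟩
      ∑ vs (λ v → does (Vec-≡-dec _≟F_ v u) ▸ isInjective F (lookup v) ▸ (cst (sgn F (lookup u) K.* sgn F (lookup v)) ⊗ Q u))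
        ≈⟨ Delta-Vec (FinF n) (Delta-Fin n) n u (λ v → isInjective F (lookup v) ▸ (cst (sgn F (lookup u) K.* sgn F (lookup v)) ⊗ Q u)) ⟩
      isInjective F (lookup u) ▸ (cst (sgn F (lookup u) K.* sgn F (lookup u)) ⊗ Q u)
        ≈⟨ ▸-congᵇ _ inj ⟩
      cst (sgn F (lookup u) K.* sgn F (lookup u)) ⊗ Q u
        ≈⟨ P.trans (P.*-congʳ (cst-cong (sgn-square (lookup u)))) (P.*-identityˡ _) ⟩
      Q u ∎

  toℕ-code : ∀ n m i j (a b : Fin m) → toℕ (combine (combine (combine {n} {n} i j) a) b) ≡ yIdx F n m i j a b
  toℕ-code n m i j a b = digit (combine (combine i j) a) b (digit (combine i j) a (digit i j refl))
    where
    digit : ∀ {p q x} (s : Fin p) (t : Fin q) → toℕ s ≡ x → toℕ (combine s t) ≡ x *ℕ q +ℕ toℕ t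
    digit {q = q} s t refl = ≡.trans (toℕ-combine s t) (cong (_+ℕ toℕ t) (ℕₚ.*-comm q (toℕ s)))

  -- The wiring of an oracle gate is defined on all of ℕ, so a matrix of wires must be read off from
  -- the numbers `yIdx`. These are mixed-radix numerals, decoded one digit per stage; numbers that
  -- encode no entry get `default`.
  decode-yIdx : ∀ {W : Set} n m (default : W) (h : Fin n → Fin n → Fin m → Fin m → W) →
                Σ[ ρ ∈ (ℕ → W) ] (∀ i j a b → ρ (yIdx F n m i j a b) ≡ h i j a b)
  decode-yIdx {W} n m default h = ρ , correct
    where
    size : ℕ
    size = n *ℕ n *ℕ m *ℕ m
    entry₁ : Fin m → Fin m → Fin n × Fin n → W
    entry₁ a b (i , j) = h i j a b
    entry₂ : Fin m → Fin (n *ℕ n) × Fin m → W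
    entry₂ b (r , a) = entry₁ a b (remQuot n r)
    entry₃ : Fin (n *ℕ n *ℕ m) × Fin m → W
    entry₃ (p , b) = entry₂ b (remQuot m p)
    entry : Fin size → W
    entry q = entry₃ (remQuot m q)
    ρ : ℕ → W
    ρ x with x <? size
    ... | yes x< = entry (fromℕ< x<)
    ... | no  _  = default
    code : Fin n → Fin n → Fin m → Fin m → Fin size
    code i j a b = combine (combine (combine i j) a) b
    entry-code : ∀ i j a b → entry (code i j a b) ≡ h i j a b
    entry-code i j a b = ≡.trans (cong entry₃ (remQuot-combine (combine (combine i j) a) b))
      (≡.trans (cong (entry₂ b) (remQuot-combine (combine i j) a)) (cong (entry₁ a b) (remQuot-combine i j)))
    ρ-code : ∀ (q : Fin size) → ρ (toℕ q) ≡ entry q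
    ρ-code q with toℕ q <? size
    ... | yes x< = cong entry (fromℕ<-toℕ q x<)
    ... | no ¬x< = ⊥-elim (¬x< (toℕ<n q))
    correct : ∀ i j a b → ρ (yIdx F n m i j a b) ≡ h i j a b
    correct i j a b = ≡.trans (cong ρ (≡.sym (toℕ-code n m i j a b))) (≡.trans (ρ-code (code i j a b)) (entry-code i j a b))

-- From the determinant to automata that reread a bit vector

-- An automaton with state set Fin R reads a bit vector e of length r. In each round a state x passes if it accepts all r bits,
-- and then moves along sc with weight ω x.
module TestedAutomaton {c ℓ} (F : CharZeroField c ℓ) (R′ r′ : ℕ) where
  open Polynomials F
  open SymmetrizedDeterminant F
  open PR

  -- `R` is both the number of states and the number of rounds. In a row index of type `Y`, the
  -- coordinate in `Fin r` is padding that brings the dimension to `suc L * L`; `clocked` enters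
  -- only rows where it is `zero`.
  R r L m : ℕ
  R = suc (suc R′)
  r = suc r′
  L = R *ℕ r
  m = suc L *ℕ L

  bools : List Bool
  bools = true ∷ false ∷ []

  Y : Set
  Y = Fin (suc L) × (Fin R × Fin r)

  finY : Finite Y
  finY = FinF (suc L) ×F (FinF R ×F FinF r)

  δY : Delta finY
  δY = Delta-× (FinF (suc L)) (FinF R ×F FinF r) (Delta-Fin (suc L)) (Delta-× (FinF R) (FinF r) (Delta-Fin R) (Delta-Fin r))

  unpack : Fin m → Y
  unpack a = let (t , s) = remQuot {suc L} L a in t , remQuot {R} r s

  pack : Y → Fin m
  pack (t , x , s) = combine t (combine x s)

  unpack-pack : ∀ y → unpack (pack y) ≡ y
  unpack-pack (t , x , s) = ≡.trans (cong (λ { (t , u) → t , remQuot {R} r u }) (remQuot-combine t (combine x s)))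
    (cong (t ,_) (remQuot-combine x s))

  pack-unpack : ∀ a → pack (unpack a) ≡ a
  pack-unpack a = ≡.trans (cong (combine (proj₁ (remQuot {suc L} L a))) (combine-remQuot {R} r (proj₂ (remQuot {suc L} L a)))) (combine-remQuot {suc L} L a)

  mprod-unpack : ∀ {n} (E : Fin n → Matrix Y) a b →
                 mprod (FinF m) (List.tabulate (λ t a b → E t (unpack a) (unpack b))) a b ≋ mprod finY (List.tabulate E) (unpack a) (unpack b)
  mprod-unpack {zero}  E a b = ▸-congᵇ (cst K.1#) (does-⇔ (a ≟F b) (Finite._≟_ finY (unpack a) (unpack b)) (cong unpack)
    λ e → ≡.trans (≡.sym (pack-unpack a)) (≡.trans (cong pack e) (pack-unpack b)))
  mprod-unpack {suc n} E a b = begin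
    ∑ (allFin m) (λ c → E zero (unpack a) (unpack c) ⊗ mprod (FinF m) (List.tabulate (λ t a b → E (suc t) (unpack a) (unpack b))) c b)
      ≈⟨ ∑-cong (allFin m) (λ c → P.*-congˡ (mprod-unpack (E ∘ suc) c b)) ⟩
    ∑ (allFin m) (λ c → E zero (unpack a) (unpack c) ⊗ mprod finY (List.tabulate (E ∘ suc)) (unpack c) (unpack b))
      ≈⟨ ∑-bijection (FinF m) finY (Delta-Fin m) δY unpack pack unpack-pack pack-unpack _ ⟩
    ∑ (elements finY) (λ y → E zero (unpack a) (unpack (pack y)) ⊗ mprod finY (List.tabulate (E ∘ suc)) (unpack (pack y)) (unpack b))
      ≈⟨ ∑-cong (elements finY) (λ y → P.reflexive (cong (λ y → E zero (unpack a) y ⊗ mprod finY (List.tabulate (E ∘ suc)) y (unpack b)) (unpack-pack y))) ⟩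
    mprod finY (List.tabulate E) (unpack a) (unpack b) ∎

  clocked : (ℕ → Matrix (Fin R)) → Matrix Y
  clocked B (t , x , _) (t′ , x′ , s′) = does (suc (toℕ t) ≟ℕ toℕ t′) ▸ does (s′ ≟F zero) ▸ B (toℕ t) x x′

  -- In the sum over the next row index exactly one time and one padding coordinate survive, which
  -- leaves a sum over states.
  mprod-clocked : ∀ {n} (B : Fin n → ℕ → Matrix (Fin R)) t t₁ x y → toℕ t +ℕ n ≡ toℕ t₁ →
                  mprod finY (List.tabulate (λ s → clocked (B s))) (t , x , zero) (t₁ , y , zero) ≋
                  mprod (FinF R) (List.tabulate (λ s → B s (toℕ t +ℕ toℕ s))) x y
  mprod-clocked {zero}  B t t₁ x y e = ▸-congᵇ (cst K.1#) (does-⇔ (Finite._≟_ finY (t , x , zero) (t₁ , y , zero)) (x ≟F y)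
    (cong (proj₁ ∘ proj₂)) (cong₂ (λ t x → t , x , zero) (toℕ-injective (≡.trans (≡.sym (ℕₚ.+-identityʳ _)) e))))
  mprod-clocked {suc n} B t t₁ x y e = begin
    ∑ (elements finY) (λ z → clocked (B zero) (t , x , zero) z ⊗ rest z)
      ≈⟨ P.trans (∑-cartesian _,_ (allFin (suc L)) (elements (FinF R ×F FinF r)) _)
                 (∑-cong (allFin (suc L)) λ t′ → ∑-cartesian _,_ (allFin R) (allFin r) _) ⟩
    ∑ (allFin (suc L)) (λ t′ → ∑ (allFin R) (λ x′ → ∑ (allFin r) (λ s′ →
      (does (suc (toℕ t) ≟ℕ toℕ t′) ▸ does (s′ ≟F zero) ▸ B zero (toℕ t) x x′) ⊗ rest (t′ , x′ , s′))))
      ≈⟨ ∑-cong (allFin (suc L)) (λ t′ → begin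
          ∑ (allFin R) (λ x′ → ∑ (allFin r) (λ s′ → (does (suc (toℕ t) ≟ℕ toℕ t′) ▸ does (s′ ≟F zero) ▸ B zero (toℕ t) x x′) ⊗ rest (t′ , x′ , s′)))
            ≈⟨ ∑-cong (allFin R) (λ x′ → ∑-cong (allFin r) λ s′ → P.trans (▸-*ˡ (does (suc (toℕ t) ≟ℕ toℕ t′)) _ _) (▸-cong (does (suc (toℕ t) ≟ℕ toℕ t′)) (▸-*ˡ (does (s′ ≟F zero)) _ _))) ⟩
          ∑ (allFin R) (λ x′ → ∑ (allFin r) (λ s′ → does (suc (toℕ t) ≟ℕ toℕ t′) ▸ does (s′ ≟F zero) ▸ (B zero (toℕ t) x x′ ⊗ rest (t′ , x′ , s′))))
            ≈⟨ ∑-cong (allFin R) (λ x′ → P.trans (P.sym (▸-∑ (does (suc (toℕ t) ≟ℕ toℕ t′)) (allFin r) _)) (▸-cong (does (suc (toℕ t) ≟ℕ toℕ t′)) (Delta-Fin r zero λ s′ → B zero (toℕ t) x x′ ⊗ rest (t′ , x′ , s′)))) ⟩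
          ∑ (allFin R) (λ x′ → does (suc (toℕ t) ≟ℕ toℕ t′) ▸ (B zero (toℕ t) x x′ ⊗ rest (t′ , x′ , zero)))
            ≈⟨ ▸-∑ (does (suc (toℕ t) ≟ℕ toℕ t′)) (allFin R) _ ⟨
          does (suc (toℕ t) ≟ℕ toℕ t′) ▸ ∑ (allFin R) (λ x′ → B zero (toℕ t) x x′ ⊗ rest (t′ , x′ , zero)) ∎) ⟩
    ∑ (allFin (suc L)) (λ t′ → does (suc (toℕ t) ≟ℕ toℕ t′) ▸ ∑ (allFin R) (λ x′ → B zero (toℕ t) x x′ ⊗ rest (t′ , x′ , zero)))
      ≈⟨ ∑-≟ℕ t< (λ t′ → ∑ (allFin R) (λ x′ → B zero (toℕ t) x x′ ⊗ rest (t′ , x′ , zero))) ⟩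
    ∑ (allFin R) (λ x′ → B zero (toℕ t) x x′ ⊗ rest (fromℕ< t< , x′ , zero))
      ≈⟨ ∑-cong (allFin R) (λ x′ → P.*-cong (P.reflexive (cong (λ u → B zero u x x′) (≡.sym (ℕₚ.+-identityʳ (toℕ t)))))
           (P.trans (mprod-clocked (B ∘ suc) (fromℕ< t<) t₁ x′ y (≡.trans (cong (_+ℕ n) (toℕ-fromℕ< t<)) (≡.trans (≡.sym (ℕₚ.+-suc _ n)) e)))
                    (mprod-cong (FinF R) (λ s u v → P.reflexive (cong (λ w → B (suc s) w u v) (≡.trans (cong (_+ℕ toℕ s) (toℕ-fromℕ< t<)) (≡.sym (ℕₚ.+-suc _ _))))) x′ y))) ⟩
    mprod (FinF R) (List.tabulate (λ s → B s (toℕ t +ℕ toℕ s))) x y ∎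
    where
    rest : Y → Poly
    rest z = mprod finY (List.tabulate (λ s → clocked (B (suc s)))) z (t₁ , y , zero)
    t< : suc (toℕ t) < suc L
    t< = ℕₚ.≤-trans (s≤s (ℕₚ.≤-trans (ℕₚ.≤-trans (s≤s (ℕₚ.m≤m+n (toℕ t) n)) (ℕₚ.≤-reflexive (≡.sym (ℕₚ.+-suc _ n)))) (ℕₚ.≤-reflexive e))) (toℕ<n t₁)

  -- Slot (ρ, j) reads bit j in round ρ. It accepts its own token if the bit is false and the token of slot (ρ + 1, j) if it is true,
  -- so that an injective choice of tokens reads the same bit vector in every round.
  token : Fin L → Bool → Fin L
  token s false = s
  token s true  = let (ρ , j) = remQuot {R} r s in combine (next ρ) j

  token-combine : ∀ ρ j → token (combine ρ j) true ≡ combine (next ρ) j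
  token-combine ρ j = cong (λ { (ρ , j) → combine (next ρ) j }) (remQuot-combine {R} {r} ρ j)

  token-true≢ : ∀ s → ¬ token s true ≡ s
  token-true≢ s e = next≢ ρ (cong proj₁ (≡.trans (≡.sym (remQuot-combine {R} {r} (next ρ) j)) (cong (remQuot {R} r) e)))
    where
    ρ = proj₁ (remQuot {R} r s)
    j = proj₂ (remQuot {R} r s)

  tokens : Vec Bool L → Fin L → Fin L
  tokens b s = token s (lookup b s)

  repeated : Vec Bool r → Vec Bool L
  repeated e = tabulate (λ s → lookup e (proj₂ (remQuot {R} r s)))

  firstRound : Vec Bool L → Vec Bool r
  firstRound b = tabulate (λ j → lookup b (combine {R} zero j))

  lookup-repeated : ∀ e ρ j → lookup (repeated e) (combine ρ j) ≡ lookup e j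
  lookup-repeated e ρ j = ≡.trans (lookup∘tabulate (λ s → lookup e (proj₂ (remQuot {R} r s))) (combine ρ j)) (cong (lookup e ∘ proj₂) (remQuot-combine {R} {r} ρ j))

  lookup-ext : ∀ {n} {X : Set} {u v : Vec X n} → (∀ i → lookup u i ≡ lookup v i) → u ≡ v
  lookup-ext {u = u} {v} h = ≡.trans (≡.sym (tabulate∘lookup u)) (≡.trans (tabulate-cong h) (tabulate∘lookup v))

  firstRound-repeated : ∀ e → firstRound (repeated e) ≡ e
  firstRound-repeated e = lookup-ext λ j → ≡.trans (lookup∘tabulate (λ j → lookup (repeated e) (combine {R} zero j)) j) (lookup-repeated e zero j)

  tokens-repeated : ∀ e ρ j → tokens (repeated e) (combine ρ j) ≡ combine (if lookup e j then next ρ else ρ) j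
  tokens-repeated e ρ j = ≡.trans (cong (token (combine ρ j)) (lookup-repeated e ρ j)) (by-bit (lookup e j))
    where
    by-bit : ∀ b → token (combine ρ j) b ≡ combine (if b then next ρ else ρ) j
    by-bit true  = token-combine ρ j
    by-bit false = refl

  -- A token stays in the column of its bit, and within column j the slots are permuted either by
  -- the identity or by `next`, the same one for all rounds.
  repeated-injective : ∀ e → isInjective F (tokens (repeated e)) ≡ true
  repeated-injective e = isInjective-complete _ inj
    where
    cancel : ∀ b ρ ρ′ → (if b then next ρ else ρ) ≡ (if b then next {suc R′} ρ′ else ρ′) → ρ ≡ ρ′
    cancel true  = next-injective
    cancel false = λ _ _ → id
    inj-combine : ∀ ρ j ρ′ j′ → tokens (repeated e) (combine ρ j) ≡ tokens (repeated e) (combine ρ′ j′) → (ρ , j) ≡ (ρ′ , j′)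
    inj-combine ρ j ρ′ j′ q with ≡.trans (≡.sym (remQuot-combine {R} {r} (if lookup e j then next ρ else ρ) j)) (≡.trans (cong (remQuot {R} r)
      (≡.trans (≡.sym (tokens-repeated e ρ j)) (≡.trans q (tokens-repeated e ρ′ j′)))) (remQuot-combine {R} {r} (if lookup e j′ then next ρ′ else ρ′) j′))
    ... | p with cong proj₂ p
    ... | refl = cong (_, j) (cancel (lookup e j) ρ ρ′ (cong proj₁ p))
    inj : ∀ s s′ → tokens (repeated e) s ≡ tokens (repeated e) s′ → s ≡ s′
    inj s s′ q = ≡.trans (≡.sym (combine-remQuot {R} r s)) (≡.trans (cong (uncurry combine) (inj-combine (proj₁ q₁) (proj₂ q₁) (proj₁ q₂) (proj₂ q₂)
      (≡.trans (cong (tokens (repeated e)) (combine-remQuot {R} r s)) (≡.trans q (cong (tokens (repeated e)) (≡.sym (combine-remQuot {R} r s′))))))) (combine-remQuot {R} r s′))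
      where
      q₁ = remQuot {R} r s
      q₂ = remQuot {R} r s′

  -- If round ρ takes the token of the following round, that round cannot take its own token as
  -- well, so its bit is true too. Around the cycle all bits of a column agree.
  injective-repeated : ∀ b → isInjective F (tokens b) ≡ true → repeated (firstRound b) ≡ b
  injective-repeated b inj = lookup-ext λ s → ≡.trans (cong (lookup (repeated (firstRound b))) (≡.sym (combine-remQuot {R} r s)))
    (≡.trans (at-combine (proj₁ (remQuot {R} r s)) (proj₂ (remQuot {R} r s))) (cong (lookup b) (combine-remQuot {R} r s)))
    where
    carry : ∀ j ρ → lookup b (combine ρ j) ≡ true → lookup b (combine (next ρ) j) ≡ true
    carry j ρ bit = by-cases (lookup b (combine (next ρ) j)) refl
      where
      by-cases : ∀ c → lookup b (combine (next ρ) j) ≡ c → c ≡ true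
      by-cases true  _    = refl
      by-cases false bit′ = ⊥-elim (next≢ ρ (≡.sym (cong proj₁ (≡.trans (≡.sym (remQuot-combine {R} {r} ρ j)) (≡.trans (cong (remQuot {R} r)
        (isInjective-sound (tokens b) inj (combine ρ j) (combine (next ρ) j)
          (≡.trans (cong (token (combine ρ j)) bit) (≡.trans (token-combine ρ j) (≡.sym (cong (token (combine (next ρ) j)) bit′)))))) (remQuot-combine {R} {r} (next ρ) j))))))
    at-combine : ∀ ρ j → lookup (repeated (firstRound b)) (combine ρ j) ≡ lookup b (combine ρ j)
    at-combine ρ j = ≡.trans (lookup-repeated (firstRound b) ρ j) (≡.trans (lookup∘tabulate (λ j → lookup b (combine {R} zero j)) j)
      (Bool-⇔ (next-orbit (λ ρ → lookup b (combine ρ j) ≡ true) (carry j) zero ρ) (next-orbit (λ ρ → lookup b (combine ρ j) ≡ true) (carry j) ρ zero)))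

  module _ {W : Set} (wv : W → Poly) (z o : W) (wv-z : wv z ≋ cst K.0#) (wv-o : wv o ≋ cst K.1#)
           (ω : Fin R → W) (φ : Fin R → Fin r → Bool → Bool) (sc : Fin R → Fin R → Bool) where

    accepts : Vec Bool r → Fin R → Bool
    accepts e x = allᵇ (λ j → φ x j (lookup e j))

    run : Vec Bool r → Fin R → ℕ → Fin R → Poly
    run e y zero    x = does (x ≟F y) ▸ cst K.1#
    run e y (suc n) x = accepts e x ▸ (wv (ω x) ⊗ ∑ (allFin R) (λ x′ → sc x x′ ▸ run e y n x′))

    -- All slots of a round but the last only test and leave the state in place; the last one also
    -- applies the weight and moves. The values are wires, not polynomials, because an oracle gate
    -- can only refer to gates.
    slotW : Fin L → Bool → Fin R → Fin R → W
    slotW s b x y = let j = proj₂ (remQuot {R} r s) in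
      if φ x j b then (if isLast j then (if sc x y then ω x else z) else (if does (x ≟F y) then o else z)) else z

    tokenW : Fin L → ℕ → Fin R → Fin R → W
    tokenW i t x y with t <? L
    ... | yes t< = if does (i ≟F fromℕ< t<) then slotW (fromℕ< t<) false x y
                   else if does (i ≟F token (fromℕ< t<) true) then slotW (fromℕ< t<) true x y else z
    ... | no _   = z

    entryW : Fin L → Y → Y → W
    entryW i (t , x , _) (t′ , x′ , s′) = if does (suc (toℕ t) ≟ℕ toℕ t′) then (if does (s′ ≟F zero) then tokenW i (toℕ t) x x′ else z) else z

    blockW : Fin L → Fin L → Fin m → Fin m → W
    blockW i j a b = if does (j ≟F i) then entryW i (unpack a) (unpack b) else z

    wv-if : ∀ b w → wv (if b then w else z) ≋ b ▸ wv w
    wv-if true  w = P.refl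
    wv-if false w = wv-z

    slot : Fin L → Bool → Matrix (Fin R)
    slot s b x y = wv (slotW s b x y)

    -- The two tokens accepted by a slot differ, so at most one summand is nonzero and the nested
    -- conditionals of `tokenW` equal the sum.
    token-expand : ∀ i s x y → wv (tokenW i (toℕ s) x y) ≋ ∑ bools (λ b → does (i ≟F token s b) ▸ slot s b x y)
    token-expand i s x y with toℕ s <? L
    ... | no ¬s< = ⊥-elim (¬s< (toℕ<n s))
    ... | yes s< rewrite fromℕ<-toℕ s s< with i ≟F s
    ... | yes refl = P.sym (P.trans (P.+-cong (▸-congᵇ _ (dec-false (s ≟F token s true) λ e → token-true≢ s (≡.sym e)))
                                              (P.+-identityʳ (slot s false x y))) (P.+-identityˡ _))
    ... | no _     = P.sym (P.trans (P.+-congˡ (P.+-identityˡ _)) (P.trans (P.+-identityʳ _) (P.sym (wv-if (does (i ≟F token s true)) _))))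

    -- Every factor but the last is diagonal, so all tests of a round are applied to the same state
    -- `x`.
    round-product : ∀ {n} (ψ : Fin (suc n) → Fin R → Bool) (G : Matrix (Fin R)) x y →
      mprod (FinF R) (List.tabulate (λ j x y → ψ j x ▸ (if isLast j then G x y else does (x ≟F y) ▸ cst K.1#))) x y ≋ allᵇ (λ j → ψ j x) ▸ G x y
    round-product {zero} ψ G x y = begin
      ∑ (allFin R) (λ z → (ψ zero x ▸ G x z) ⊗ (does (z ≟F y) ▸ cst K.1#))
        ≈⟨ ∑-cong (allFin R) (λ z → P.trans (▸-*ʳ (does (z ≟F y)) _ _) (▸-cong (does (z ≟F y)) (P.*-identityʳ _))) ⟩
      ∑ (allFin R) (λ z → does (z ≟F y) ▸ ψ zero x ▸ G x z)   ≈⟨ Delta-Fin R y (λ z → ψ zero x ▸ G x z) ⟩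
      ψ zero x ▸ G x y                                        ≈⟨ ▸-∧ (ψ zero x) true _ ⟨
      (ψ zero x ∧ true) ▸ G x y                               ∎
    round-product {suc n} ψ G x y = begin
      ∑ (allFin R) (λ z → (ψ zero x ▸ does (x ≟F z) ▸ cst K.1#) ⊗ mprod (FinF R) (List.tabulate (λ j x y → ψ (suc j) x ▸ (if isLast j then G x y else does (x ≟F y) ▸ cst K.1#))) z y)
        ≈⟨ ∑-cong (allFin R) (λ z → begin
            (ψ zero x ▸ does (x ≟F z) ▸ cst K.1#) ⊗ _
              ≈⟨ P.*-cong (P.trans (▸-comm (ψ zero x) (does (x ≟F z)) _) (▸-congᵇ _ (does-⇔ (x ≟F z) (z ≟F x) ≡.sym ≡.sym))) (round-product (ψ ∘ suc) G z y) ⟩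
            (does (z ≟F x) ▸ ψ zero x ▸ cst K.1#) ⊗ (allᵇ (λ j → ψ (suc j) z) ▸ G z y)
              ≈⟨ ▸-*ˡ (does (z ≟F x)) _ _ ⟩
            does (z ≟F x) ▸ ((ψ zero x ▸ cst K.1#) ⊗ (allᵇ (λ j → ψ (suc j) z) ▸ G z y)) ∎) ⟩
      ∑ (allFin R) (λ z → does (z ≟F x) ▸ ((ψ zero x ▸ cst K.1#) ⊗ (allᵇ (λ j → ψ (suc j) z) ▸ G z y)))
        ≈⟨ Delta-Fin R x (λ z → (ψ zero x ▸ cst K.1#) ⊗ (allᵇ (λ j → ψ (suc j) z) ▸ G z y)) ⟩
      (ψ zero x ▸ cst K.1#) ⊗ (allᵇ (λ j → ψ (suc j) x) ▸ G x y)
        ≈⟨ P.trans (▸-* (ψ zero x) (allᵇ (λ j → ψ (suc j) x)) _ _) (▸-cong (ψ zero x ∧ allᵇ (λ j → ψ (suc j) x)) (P.*-identityˡ _)) ⟩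
      allᵇ (λ j → ψ j x) ▸ G x y ∎

    slot-combine : ∀ e ρ j x y → slot (combine ρ j) (lookup (repeated e) (combine ρ j)) x y ≋
                   φ x j (lookup e j) ▸ (if isLast j then sc x y ▸ wv (ω x) else does (x ≟F y) ▸ cst K.1#)
    slot-combine e ρ j x y rewrite lookup-repeated e ρ j | cong proj₂ (remQuot-combine {R} {r} ρ j) =
      P.trans (wv-if (φ x j (lookup e j)) _) (▸-cong (φ x j (lookup e j)) (by-position (isLast j)))
      where
      by-position : ∀ b → wv (if b then (if sc x y then ω x else z) else (if does (x ≟F y) then o else z)) ≋ (if b then sc x y ▸ wv (ω x) else does (x ≟F y) ▸ cst K.1#)
      by-position true  = wv-if (sc x y) (ω x)
      by-position false = P.trans (wv-if (does (x ≟F y)) o) (▸-cong (does (x ≟F y)) wv-o)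

    run-rounds : ∀ e y n (Ms : Fin n → List (Matrix (Fin R))) →
                 (∀ ρ x x′ → mprod (FinF R) (Ms ρ) x x′ ≋ accepts e x ▸ sc x x′ ▸ wv (ω x)) →
                 ∀ x → mprod (FinF R) (List.concat (List.tabulate Ms)) x y ≋ run e y n x
    run-rounds e y zero    Ms h x = P.refl
    run-rounds e y (suc n) Ms h x = begin
      mprod (FinF R) (Ms zero ++ List.concat (List.tabulate (Ms ∘ suc))) x y
        ≈⟨ mprod-++ (FinF R) (Delta-Fin R) (Ms zero) _ x y ⟩
      ∑ (allFin R) (λ x′ → mprod (FinF R) (Ms zero) x x′ ⊗ mprod (FinF R) (List.concat (List.tabulate (Ms ∘ suc))) x′ y)
        ≈⟨ ∑-cong (allFin R) (λ x′ → P.trans (P.*-cong (h zero x x′) (run-rounds e y n (Ms ∘ suc) (h ∘ suc) x′)) (P.trans (▸-*ˡ (accepts e x) _ _)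
             (▸-cong (accepts e x) (P.trans (▸-*ˡ (sc x x′) _ _) (P.sym (▸-*ʳ (sc x x′) _ _)))))) ⟩
      ∑ (allFin R) (λ x′ → accepts e x ▸ (wv (ω x) ⊗ (sc x x′ ▸ run e y n x′)))
        ≈⟨ P.trans (P.sym (▸-∑ (accepts e x) (allFin R) _)) (▸-cong (accepts e x) (P.sym (∑-*ˡ (allFin R) _ _))) ⟩
      run e y (suc n) x ∎

    slots-run : ∀ e y x → mprod (FinF R) (List.tabulate (λ s → slot s (lookup (repeated e) s))) x y ≋ run e y R x
    slots-run e y x = P.trans
      (P.reflexive (cong (λ Ms → mprod (FinF R) Ms x y) (tabulate-combine R r (λ s → slot s (lookup (repeated e) s)))))
      (run-rounds e y R (λ ρ → List.tabulate {n = r} (λ j → slot (combine ρ j) (lookup (repeated e) (combine ρ j))))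
        (λ ρ x x′ → P.trans (mprod-cong (FinF R) (slot-combine e ρ) x x′)
          (round-product (λ j x → φ x j (lookup e j)) (λ x x′ → sc x x′ ▸ wv (ω x)) x x′)) x)

    -- The double sum over permutations and bits is regrouped by the bits: `b` leaves the single
    -- choice `tokens b`, and this is injective just when `b` repeats one bit vector in every round.
    -- The chosen entry leads from time 0 in state `x` to time `L` in state `y`.
    automaton-oracle : ∀ x y → Σ[ k ∈ Fin m ] Σ[ l ∈ Fin m ] Σ[ ρ ∈ (ℕ → W) ]
      subst F (wv ∘ ρ) (sdetM F L m k l) ≋ cst (invFactorial L) ⊗ ∑ (vecs r bools) (λ e → run e y R x)
    automaton-oracle x y = pack source , pack target , proj₁ decoded , (begin
      subst F (wv ∘ proj₁ decoded) (sdetM F L m (pack source) (pack target))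
        ≈⟨ subst-sdet-diagonal (wv ∘ proj₁ decoded) L m (pack source) (pack target) (λ i a b → clocked (tokenAt i) (unpack a) (unpack b)) diagonal ⟩
      cst (invFactorial L) ⊗ ∑ (vecs L (allFin L)) (λ u → isInjective F (lookup u) ▸
        mprod (FinF m) (List.tabulate (λ t a b → clocked (tokenAt (lookup u t)) (unpack a) (unpack b))) (pack source) (pack target))
        ≈⟨ P.*-congˡ (∑-cong (vecs L (allFin L)) λ u → ▸-cong (isInjective F (lookup u)) (expand u)) ⟩
      cst (invFactorial L) ⊗ ∑ (vecs L (allFin L)) (λ u → isInjective F (lookup u) ▸
        ∑ (vecs L bools) (λ b → allᵇ (λ s → does (lookup u s ≟F tokens b s)) ▸ Q b))
        ≈⟨ P.*-congˡ regroup ⟩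
      cst (invFactorial L) ⊗ ∑ (vecs L bools) (λ b → isInjective F (tokens b) ▸ Q b)
        ≈⟨ P.*-congˡ (∑-image (BoolF ^F L) (BoolF ^F r) (Delta-Bits L) (Delta-Bits r) (λ b → isInjective F (tokens b)) firstRound repeated
             repeated-injective firstRound-repeated injective-repeated Q) ⟩
      cst (invFactorial L) ⊗ ∑ (vecs r bools) (Q ∘ repeated)
        ≈⟨ P.*-congˡ (∑-cong (vecs r bools) λ e → slots-run e y x) ⟩
      cst (invFactorial L) ⊗ ∑ (vecs r bools) (λ e → run e y R x) ∎)
      where
      source target : Y
      source = zero , x , zero
      target = fromℕ L , y , zero
      decoded : Σ[ ρ ∈ (ℕ → W) ] (∀ i j a b → ρ (yIdx F L m i j a b) ≡ blockW i j a b)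
      decoded = decode-yIdx L m z blockW
      tokenAt : Fin L → ℕ → Matrix (Fin R)
      tokenAt i t x y = wv (tokenW i t x y)
      Q : Vec Bool L → Poly
      Q b = mprod (FinF R) (List.tabulate (λ s → slot s (lookup b s))) x y
      diagonal : ∀ i j a b → wv (proj₁ decoded (yIdx F L m i j a b)) ≋ does (j ≟F i) ▸ clocked (tokenAt i) (unpack a) (unpack b)
      diagonal i j a b rewrite proj₂ decoded i j a b = P.trans (wv-if (does (j ≟F i)) _) (▸-cong (does (j ≟F i))
        (P.trans (wv-if (does (suc (toℕ t) ≟ℕ toℕ t′)) _) (▸-cong (does (suc (toℕ t) ≟ℕ toℕ t′)) (wv-if (does (s′ ≟F zero)) _))))
        where
        t  = proj₁ (unpack a)
        t′ = proj₁ (unpack b)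
        s′ = proj₂ (proj₂ (unpack b))
      expand : ∀ u → mprod (FinF m) (List.tabulate (λ t a b → clocked (tokenAt (lookup u t)) (unpack a) (unpack b))) (pack source) (pack target) ≋
               ∑ (vecs L bools) (λ b → allᵇ (λ s → does (lookup u s ≟F tokens b s)) ▸ Q b)
      expand u = begin
        mprod (FinF m) (List.tabulate (λ t a b → clocked (tokenAt (lookup u t)) (unpack a) (unpack b))) (pack source) (pack target)
          ≈⟨ mprod-unpack (λ t → clocked (tokenAt (lookup u t))) (pack source) (pack target) ⟩
        mprod finY (List.tabulate (λ t → clocked (tokenAt (lookup u t)))) (unpack (pack source)) (unpack (pack target))
          ≡⟨ cong₂ (mprod finY (List.tabulate (λ t → clocked (tokenAt (lookup u t))))) (unpack-pack source) (unpack-pack target) ⟩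
        mprod finY (List.tabulate (λ t → clocked (tokenAt (lookup u t)))) source target
          ≈⟨ mprod-clocked (λ t → tokenAt (lookup u t)) zero (fromℕ L) x y (≡.sym (toℕ-fromℕ L)) ⟩
        mprod (FinF R) (List.tabulate (λ s → tokenAt (lookup u s) (toℕ s))) x y
          ≈⟨ mprod-expand (FinF R) bools (λ s b → does (lookup u s ≟F token s b)) slot (λ s → tokenAt (lookup u s) (toℕ s)) (λ s → token-expand (lookup u s) s) x y ⟩
        ∑ (vecs L bools) (λ b → allᵇ (λ s → does (lookup u s ≟F tokens b s)) ▸ Q b) ∎
      regroup : ∑ (vecs L (allFin L)) (λ u → isInjective F (lookup u) ▸ ∑ (vecs L bools) (λ b → allᵇ (λ s → does (lookup u s ≟F tokens b s)) ▸ Q b))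
                ≋ ∑ (vecs L bools) (λ b → isInjective F (tokens b) ▸ Q b)
      regroup = begin
        ∑ (vecs L (allFin L)) (λ u → isInjective F (lookup u) ▸ ∑ (vecs L bools) (λ b → allᵇ (λ s → does (lookup u s ≟F tokens b s)) ▸ Q b))
          ≈⟨ ∑-cong (vecs L (allFin L)) (λ u → ▸-∑ (isInjective F (lookup u)) (vecs L bools) _) ⟩
        ∑ (vecs L (allFin L)) (λ u → ∑ (vecs L bools) (λ b → isInjective F (lookup u) ▸ allᵇ (λ s → does (lookup u s ≟F tokens b s)) ▸ Q b))
          ≈⟨ ∑-swap (vecs L (allFin L)) (vecs L bools) _ ⟩
        ∑ (vecs L bools) (λ b → ∑ (vecs L (allFin L)) (λ u → isInjective F (lookup u) ▸ allᵇ (λ s → does (lookup u s ≟F tokens b s)) ▸ Q b))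
          ≈⟨ ∑-cong (vecs L bools) (λ b → P.trans
               (∑-cong (vecs L (allFin L)) λ u → P.trans (▸-comm (isInjective F (lookup u)) (allᵇ (λ s → does (lookup u s ≟F tokens b s))) _)
                 (▸-congᵇ _ (≡.sym (does-Vec _≟F_ u (tokens b)))))
               (P.trans (Delta-Vec (FinF L) (Delta-Fin L) L (tabulate (tokens b)) (λ u → isInjective F (lookup u) ▸ Q b))
                 (▸-congᵇ _ (isInjective-cong (lookup∘tabulate (tokens b)))))) ⟩
        ∑ (vecs L bools) (λ b → isInjective F (tokens b) ▸ Q b) ∎

-- Gates addressed within the whole circuit

module Gates {c ℓ} (F : CharZeroField c ℓ) where
  weaken : ∀ {O k} → Gate F O k → Gate F O (suc k)
  weaken (inp x)   = inp x
  weaken (con a)   = con a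
  weaken (add a b) = add (suc a) (suc b)
  weaken (mul a b) = mul (suc a) (suc b)
  weaken (orc o ρ) = orc o (suc ∘ ρ)

  -- References are shifted to positions in the whole circuit, so that a gate can be part of an
  -- automaton state.
  gateAt : ∀ {O k} → Circuit F O k → Fin k → Gate F O k
  gateAt (C ▷ g) zero    = weaken g
  gateAt (C ▷ g) (suc i) = weaken (gateAt C i)

  -- Position zero is the newest gate, so descending from a gate to its inputs increases the
  -- position.
  Above : ∀ {O k} → Fin k → Gate F O k → Set
  Above i (add a b) = toℕ i < toℕ a × toℕ i < toℕ b
  Above i (mul a b) = toℕ i < toℕ a × toℕ i < toℕ b
  Above i _         = ⊤

  gateAt-above : ∀ {O k} (C : Circuit F O k) i → Above i (gateAt C i)
  gateAt-above (C ▷ inp x)   zero = tt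
  gateAt-above (C ▷ con a)   zero = tt
  gateAt-above (C ▷ add a b) zero = s≤s z≤n , s≤s z≤n
  gateAt-above (C ▷ mul a b) zero = s≤s z≤n , s≤s z≤n
  gateAt-above (C ▷ orc o ρ) zero = tt
  gateAt-above (C ▷ g) (suc i) with gateAt C i | gateAt-above C i
  ... | inp x   | _       = tt
  ... | con a   | _       = tt
  ... | add a b | p , q   = s≤s p , s≤s q
  ... | mul a b | p , q   = s≤s p , s≤s q
  ... | orc o ρ | _       = tt

  lookup-values : ∀ {k} (C : Circuit F ⊥ k) i →
                  lookup (values F (noOracle F) C) i ≡ gateVal F (noOracle F) (gateAt C i) (values F (noOracle F) C)
  lookup-values C i = go C i
    where
    gateVal-weaken : ∀ {k} (g : Gate F ⊥ k) p vs → gateVal F (noOracle F) (weaken g) (p ∷ᵥ vs) ≡ gateVal F (noOracle F) g vs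
    gateVal-weaken (inp x)   p vs = refl
    gateVal-weaken (con a)   p vs = refl
    gateVal-weaken (add a b) p vs = refl
    gateVal-weaken (mul a b) p vs = refl
    go : ∀ {k} (C : Circuit F ⊥ k) i → lookup (values F (noOracle F) C) i ≡ gateVal F (noOracle F) (gateAt C i) (values F (noOracle F) C)
    go (C ▷ g) zero    = ≡.sym (gateVal-weaken g _ _)
    go (C ▷ g) (suc i) = ≡.trans (go C i) (≡.sym (gateVal-weaken (gateAt C i) _ _))

  -- A bit contributes 1: that it is true is left to a separate test.
  inputValue : ∀ {x r₀} → Dec (x < r₀) → NCPoly F
  inputValue {x} {r₀} (yes _) = cst (CommutativeRing.1# (CharZeroField.commutativeRing F))
  inputValue {x} {r₀} (no _)  = var (x ∸ r₀)

  leafValue : ∀ {O k} → ℕ → Gate F O k → NCPoly F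
  leafValue r₀ (inp x) = inputValue (x <? r₀)
  leafValue r₀ _       = cst (CommutativeRing.0# (CharZeroField.commutativeRing F))

-- Traversal of parse trees

-- The homogeneous component of degree D of a circuit is a sum over parse trees. A tree is traversed depth first, visiting pairs
-- (gate, degree). Every leaf has degree 1, so the right factors of the multiplications visited start at distinct positions 1, …, D - 1
-- of the monomial; instead of a stack, cell q of a list holds the pair at which the traversal resumes after q leaves.
module ParseTrees {c ℓ} (F : CharZeroField c ℓ) (s′ D′ : ℕ) (C : Circuit F ⊥ (suc s′)) where
  open Polynomials F
  open Gates F
  open PR

  s D b : ℕ
  s = suc s′
  D = suc D′
  b = s *ℕ suc D

  Node : Set
  Node = Fin s × Fin (suc D)

  nodeF : Finite Node
  nodeF = FinF s ×F FinF (suc D)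

  δ-node : Delta nodeF
  δ-node = Delta-× (FinF s) (FinF (suc D)) (Delta-Fin s) (Delta-Fin (suc D))

  Cell : Set
  Cell = Vec Bool b

  cellF : Finite Cell
  cellF = BoolF ^F b

  _≟N_ : DecidableEquality Node
  _≟N_ = Finite._≟_ nodeF

  _≟C_ : DecidableEquality Cell
  _≟C_ = Finite._≟_ cellF

  cells : ∀ n → List (Vec Cell n)
  cells n = vecs n (elements cellF)

  nodes : List Node
  nodes = elements nodeF

  -- Unit vectors. Cells range over all bit vectors of length `b`; one that encodes no node
  -- contributes nothing, since the leaf that loads it compares it with codes only.
  code : Node → Cell
  code v = tabulate (λ l → does (l ≟F uncurry combine v))

  code-injective : ∀ v w → code v ≡ code w → v ≡ w
  code-injective v w e = ≡.trans (≡.sym (uncurry remQuot-combine v)) (≡.trans (cong (remQuot {s} (suc D)) (does⇒ (uncurry combine v ≟F uncurry combine w)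
    (≡.trans (≡.sym (lookup∘tabulate (λ l → does (l ≟F uncurry combine w)) (uncurry combine v)))
      (≡.trans (cong (λ u → lookup u (uncurry combine v)) (≡.sym e))
        (≡.trans (lookup∘tabulate (λ l → does (l ≟F uncurry combine v)) (uncurry combine v)) (dec-true (uncurry combine v ≟F uncurry combine v) refl))))))
    (uncurry remQuot-combine w))

  value : Fin s → Poly
  value i = lookup (values F (noOracle F) C) i

  constantTerm : Fin s → K.Carrier
  constantTerm i = coeff F (value i) []

  -- The required content of the last cell, the one at which no right factor can start. This fixes
  -- that cell as well, so that no tree is counted more than once; no subtree that gets scheduled
  -- has degree 0.
  final : Node
  final = zero , zero

  holds : List Cell → ℕ → Node → Bool
  holds []      n       v = false
  holds (c ∷ h) zero    v = does (c ≟C code v)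
  holds (c ∷ h) (suc n) v = holds h n v

  _⊖_ : Fin (suc D) → Fin (suc D) → Fin (suc D)
  k ⊖ j = fromℕ< (ℕₚ.≤-<-trans (ℕₚ.m∸n≤m (toℕ k) (toℕ j)) (toℕ<n k))

  toℕ-⊖ : ∀ k j → toℕ (k ⊖ j) ≡ toℕ k ∸ toℕ j
  toℕ-⊖ k j = toℕ-fromℕ< _

  -- Bounds the remaining steps when `n` cells are left: a leaf uses up a cell, any other step
  -- increases the gate position, so at most `s` steps pass for each leaf.
  rankAt : ℕ → Fin s → ℕ
  rankAt zero    i = 0
  rankAt (suc n) i = n *ℕ s +ℕ (s ∸ toℕ i)

  rank≤ : ∀ n i → rankAt n i ≤ n *ℕ s
  rank≤ zero    i = z≤n
  rank≤ (suc n) i = ℕₚ.≤-trans (ℕₚ.+-monoʳ-≤ (n *ℕ s) (ℕₚ.m∸n≤m s (toℕ i))) (ℕₚ.≤-reflexive (ℕₚ.+-comm (n *ℕ s) s))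

  rank-child : ∀ {n N i a} → toℕ i < toℕ a → rankAt (suc n) i ≤ suc N → rankAt (suc n) a ≤ N
  rank-child {n} {N} {i} {a} i<a p = ℕₚ.≤-pred (ℕₚ.≤-trans (ℕₚ.+-monoʳ-< (n *ℕ s) (ℕₚ.∸-monoʳ-< i<a (ℕₚ.<⇒≤ (toℕ<n a)))) p)

  rank-load : ∀ {n N} i → rankAt (suc n) i ≤ suc N → n *ℕ s ≤ N
  rank-load {n} i p = ℕₚ.≤-pred (ℕₚ.≤-trans (ℕₚ.≤-trans (ℕₚ.≤-reflexive (ℕₚ.+-comm 1 (n *ℕ s))) (ℕₚ.+-monoʳ-≤ (n *ℕ s) (ℕₚ.m<n⇒0<n∸m (toℕ<n i)))) p)

  rank-positive : ∀ {n} i → ¬ rankAt (suc n) i ≤ 0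
  rank-positive {n} i p = ℕₚ.<⇒≱ (ℕₚ.≤-trans (ℕₚ.m<n⇒0<n∸m (toℕ<n i)) (ℕₚ.m≤n+m _ (n *ℕ s))) p

  module _ (σ : ℕ → Poly) where

    load : List Cell → (List Cell → Node → Poly) → Poly
    load []      φ = cst K.0#
    load (c ∷ h) φ = ∑ nodes (λ v → does (c ≟C code v) ▸ φ h v)

    -- A factor of degree 0 is not visited but replaced by its constant term, so all visited
    -- subtrees keep positive degree. Otherwise the right factor must be stored in the cell behind
    -- the left one; as `h` begins with the cell after one leaf, its index is `j′`, one less than
    -- the degree `j`.
    product : Fin s → Fin s → Fin (suc D) → List Cell → (List Cell → Node → Poly) → Fin (suc D) → Poly
    product a b k h φ zero      = cst (constantTerm a) ⊗ φ h (b , k)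
    product a b k h φ j@(suc j′) =
      if does (j ≟F k) then cst (constantTerm b) ⊗ φ h (a , k) else
      (does (toℕ j <? toℕ k) ▸ holds h (toℕ j′) (b , k ⊖ j) ▸ φ h (a , j))

    visit : Gate F ⊥ s → Fin (suc D) → List Cell → (List Cell → Node → Poly) → Poly
    visit (inp x)   k h φ = does (1 ≟ℕ toℕ k) ▸ (σ x ⊗ load h φ)
    visit (con a)   k h φ = cst K.0#
    visit (add a b) k h φ = φ h (a , k) ⊕ φ h (b , k)
    visit (mul a b) k h φ = ∑ (allFin (suc D)) (product a b k h φ)

    -- The first argument is fuel, and h lists the cells after the current position.
    traverse : ℕ → List Cell → Node → Poly
    traverse N       []        v       = does (v ≟N final) ▸ cst K.1#
    traverse zero    (_ ∷ _)   v       = cst K.0#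
    traverse (suc N) h@(_ ∷ _) (i , k) = visit (gateAt C i) k h (traverse N)

    -- Every step lowers the rank, so fuel beyond the rank is irrelevant. Thus `resume` can fix one
    -- amount of fuel, whatever was left by the subtree before it.
    traverse-stable : ∀ N N′ h i k → rankAt (length h) i ≤ N → rankAt (length h) i ≤ N′ → traverse N h (i , k) ≋ traverse N′ h (i , k)
    traverse-stable N       N′       []        i k p p′ = P.refl
    traverse-stable zero    N′       (c ∷ h)   i k p p′ = ⊥-elim (rank-positive {length h} i p)
    traverse-stable (suc N) zero     (c ∷ h)   i k p p′ = ⊥-elim (rank-positive {length h} i p′)
    traverse-stable (suc N) (suc N′) h⁺@(c ∷ h) i k p p′ with gateAt C i | gateAt-above C i
    ... | inp x   | _         = ▸-cong (does (1 ≟ℕ toℕ k)) (P.*-congˡ (∑-cong nodes λ (i′ , k′) → ▸-cong (does (c ≟C code (i′ , k′)))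
        (traverse-stable N N′ h i′ k′ (ℕₚ.≤-trans (rank≤ (length h) i′) (rank-load {length h} i p)) (ℕₚ.≤-trans (rank≤ (length h) i′) (rank-load {length h} i p′)))))
    ... | con a   | _         = P.refl
    ... | add a b | i<a , i<b = P.+-cong (traverse-stable N N′ h⁺ a k (rank-child {length h} i<a p) (rank-child {length h} i<a p′))
                                         (traverse-stable N N′ h⁺ b k (rank-child {length h} i<b p) (rank-child {length h} i<b p′))
    ... | mul a b | i<a , i<b = ∑-cong (allFin (suc D)) factor
      where
      stable-a : ∀ k → traverse N h⁺ (a , k) ≋ traverse N′ h⁺ (a , k)
      stable-a k = traverse-stable N N′ h⁺ a k (rank-child {length h} i<a p) (rank-child {length h} i<a p′)
      factor : ∀ j → product a b k h⁺ (traverse N) j ≋ product a b k h⁺ (traverse N′) j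
      factor zero = P.*-congˡ (traverse-stable N N′ h⁺ b k (rank-child {length h} i<b p) (rank-child {length h} i<b p′))
      factor j@(suc j′) with does (j ≟F k)
      ... | true  = P.*-congˡ (stable-a k)
      ... | false = ▸-cong (does (toℕ j <? toℕ k)) (▸-cong (holds h⁺ (toℕ j′) (b , k ⊖ j)) (stable-a j))

    -- The continuation after a subtree: the cell behind it says where the traversal goes on.
    resume : Cell → List Cell → Poly
    resume c h = ∑ nodes (λ v → does (c ≟C code v) ▸ traverse (length h *ℕ s) h v)

    resume-code : ∀ v h → resume (code v) h ≋ traverse (length h *ℕ s) h v
    resume-code v h = P.trans
      (∑-cong nodes λ w → ▸-congᵇ _ (does-⇔ (code v ≟C code w) (w ≟N v) (λ e → ≡.sym (code-injective v w e)) (λ e → cong code (≡.sym e))))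
      (δ-node v (traverse (length h *ℕ s) h))

    component : Fin s → ℕ → Poly
    component i k = homogeneous σ k (value i)

    component-0 : ∀ i → component i 0 ≋ cst (constantTerm i)
    component-0 i = P.trans (go (monomials (value i))) (cst-cong (K.sym (coeff-monomials (value i) [])))
      where
      go : ∀ ms → ∑ ms (λ m → does (length (proj₂ m) ≟ℕ 0) ▸ term σ m) ≋ cst (coefficient ms [])
      go []                   = P.refl
      go ((a , [])    ∷ ms) = P.trans (P.+-cong (P.*-identityʳ (cst a)) (go ms)) (P.sym (cst-+ a _))
      go ((a , _ ∷ _) ∷ ms) = P.trans (P.+-identityˡ _) (P.trans (go ms) (cst-cong (K.sym (K.+-identityˡ _))))

    componentOf : Gate F ⊥ s → ℕ → Poly
    componentOf (inp x)   k = does (1 ≟ℕ k) ▸ σ x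
    componentOf (con a)   k = does (0 ≟ℕ k) ▸ cst a
    componentOf (add a b) k = component a k ⊕ component b k
    componentOf (mul a b) k = ∑ (allFin (suc D)) (λ j → does (toℕ j ≤? k) ▸ (component a (toℕ j) ⊗ component b (k ∸ toℕ j)))

    component-gate : ∀ i k → k ≤ D → component i k ≋ componentOf (gateAt C i) k
    component-gate i k k≤D = P.trans (P.reflexive (cong (homogeneous σ k) (lookup-values C i))) (go (gateAt C i))
      where
      go : ∀ g → homogeneous σ k (gateVal F (noOracle F) g (values F (noOracle F) C)) ≋ componentOf g k
      go (inp x)   = homogeneous-var σ k x
      go (con a)   = homogeneous-cst σ k a
      go (add a b) = homogeneous-⊕ σ k (value a) (value b)
      go (mul a b) = homogeneous-⊗ σ k (value a) (value b) k≤D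

    ∑-cells-split : ∀ {n} m m′ → n ≡ m +ℕ suc m′ → (f : List Cell → Poly) →
      ∑ (cells n) (f ∘ toList) ≋
      ∑ (cells m) (λ u → ∑ (elements cellF) (λ x → ∑ (cells m′) (λ w → f (toList u ++ x ∷ toList w))))
    ∑-cells-split zero    m′ refl f = P.trans (∑-vecs m′ (elements cellF) (f ∘ toList)) (P.sym (P.+-identityʳ _))
    ∑-cells-split (suc m) m′ refl f = begin
      ∑ (cells (suc m +ℕ suc m′)) (f ∘ toList)
        ≈⟨ ∑-vecs (m +ℕ suc m′) (elements cellF) (f ∘ toList) ⟩
      ∑ (elements cellF) (λ y → ∑ (cells (m +ℕ suc m′)) (λ v → f (y ∷ toList v)))
        ≈⟨ ∑-cong (elements cellF) (λ y → ∑-cells-split m m′ refl (λ h → f (y ∷ h))) ⟩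
      ∑ (elements cellF) (λ y → ∑ (cells m) (λ u → ∑ (elements cellF) (λ x → ∑ (cells m′) (λ w → f (y ∷ toList u ++ x ∷ toList w)))))
        ≈⟨ ∑-vecs m (elements cellF) (λ u → ∑ (elements cellF) (λ x → ∑ (cells m′) (λ w → f (toList u ++ x ∷ toList w)))) ⟨
      ∑ (cells (suc m)) (λ u → ∑ (elements cellF) (λ x → ∑ (cells m′) (λ w → f (toList u ++ x ∷ toList w)))) ∎

    holds-at : ∀ {n} (u : Vec Cell n) x h v → holds (toList u ++ x ∷ h) n v ≡ does (x ≟C code v)
    holds-at []ᵥ      x h v = refl
    holds-at (_ ∷ᵥ u) x h v = holds-at u x h v

    traverse-unfold : ∀ {n} N (u : Vec Cell n) c h i k →
                      traverse (suc N) (toList u ++ c ∷ h) (i , k) ≡ visit (gateAt C i) k (toList u ++ c ∷ h) (traverse N)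
    traverse-unfold N []ᵥ      c h i k = refl
    traverse-unfold N (_ ∷ᵥ _) c h i k = refl

    -- Summing over the cells strictly inside the subtree evaluates the subtree; the traversal then resumes at the cell behind it.
    traverse-sum : ∀ N i k k′ → toℕ k ≡ suc k′ → ∀ c h → rankAt (suc (k′ +ℕ length h)) i ≤ N →
                   ∑ (cells k′) (λ u → traverse N (toList u ++ c ∷ h) (i , k)) ≋ component i (suc k′) ⊗ resume c h
    traverse-sum zero    i k k′ k≡ c h p = ⊥-elim (rank-positive {k′ +ℕ length h} i p)
    traverse-sum (suc N) i k k′ k≡ c h p = begin
      ∑ (cells k′) (λ u → traverse (suc N) (toList u ++ c ∷ h) (i , k))
        ≈⟨ ∑-cong (cells k′) (λ u → P.reflexive (traverse-unfold N u c h i k)) ⟩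
      ∑ (cells k′) (λ u → visit (gateAt C i) k (toList u ++ c ∷ h) (traverse N))
        ≈⟨ by-gate (gateAt C i) (gateAt-above C i) ⟩
      componentOf (gateAt C i) (suc k′) ⊗ resume c h
        ≈⟨ P.*-congʳ (component-gate i (suc k′) (≡.subst (_≤ D) k≡ (ℕₚ.≤-pred (toℕ<n k)))) ⟨
      component i (suc k′) ⊗ resume c h ∎
      where
      child : ∀ a → toℕ i < toℕ a → ∑ (cells k′) (λ u → traverse N (toList u ++ c ∷ h) (a , k)) ≋ component a (suc k′) ⊗ resume c h
      child a i<a = traverse-sum N a k k′ k≡ c h (rank-child {k′ +ℕ length h} i<a p)

      -- Of the `k′` cells inside the product, the first `j′` lie inside the left factor, the next
      -- one must contain the code of the right factor, and the remaining `w′` lie inside the right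
      -- factor.
      split : ∀ a b j′ (j : Fin (suc D)) w′ → toℕ i < toℕ a → toℕ j ≡ suc j′ → k′ ≡ j′ +ℕ suc w′ →
              ∑ (cells k′) (λ u → holds (toList u ++ c ∷ h) j′ (b , k ⊖ j) ▸ traverse N (toList u ++ c ∷ h) (a , j)) ≋
              (component a (suc j′) ⊗ component b (suc w′)) ⊗ resume c h
      split a b j′ j w′ i<a j≡ k′≡ = begin
        ∑ (cells k′) (λ u → holds (toList u ++ c ∷ h) j′ v ▸ traverse N (toList u ++ c ∷ h) (a , j))
          ≈⟨ ∑-cells-split j′ w′ k′≡ (λ l → holds (l ++ c ∷ h) j′ v ▸ traverse N (l ++ c ∷ h) (a , j)) ⟩
        ∑ (cells j′) (λ u → ∑ (elements cellF) (λ x → ∑ (cells w′) (λ w →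
          holds ((toList u ++ x ∷ toList w) ++ c ∷ h) j′ v ▸ traverse N ((toList u ++ x ∷ toList w) ++ c ∷ h) (a , j))))
          ≈⟨ ∑-cong (cells j′) (λ u → ∑-cong (elements cellF) λ x → ∑-cong (cells w′) λ w → P.trans
               (P.reflexive (cong (λ l → holds l j′ v ▸ traverse N l (a , j)) (++-assoc (toList u) (x ∷ toList w) (c ∷ h))))
               (▸-congᵇ _ (holds-at u x (toList w ++ c ∷ h) v))) ⟩
        ∑ (cells j′) (λ u → ∑ (elements cellF) (λ x → ∑ (cells w′) (λ w →
          does (x ≟C code v) ▸ traverse N (toList u ++ x ∷ (toList w ++ c ∷ h)) (a , j))))
          ≈⟨ ∑-swap (cells j′) (elements cellF) _ ⟩
        ∑ (elements cellF) (λ x → ∑ (cells j′) (λ u → ∑ (cells w′) (λ w →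
          does (x ≟C code v) ▸ traverse N (toList u ++ x ∷ (toList w ++ c ∷ h)) (a , j))))
          ≈⟨ ∑-cong (elements cellF) (λ x → P.trans (∑-cong (cells j′) λ u → P.sym (▸-∑ (does (x ≟C code v)) (cells w′) _)) (P.sym (▸-∑ (does (x ≟C code v)) (cells j′) _))) ⟩
        ∑ (elements cellF) (λ x → does (x ≟C code v) ▸ ∑ (cells j′) (λ u → ∑ (cells w′) (λ w →
          traverse N (toList u ++ x ∷ (toList w ++ c ∷ h)) (a , j))))
          ≈⟨ Delta-Bits (s *ℕ suc D) (code v) (λ x → ∑ (cells j′) (λ u → ∑ (cells w′) (λ w → traverse N (toList u ++ x ∷ (toList w ++ c ∷ h)) (a , j)))) ⟩
        ∑ (cells j′) (λ u → ∑ (cells w′) (λ w → traverse N (toList u ++ code v ∷ (toList w ++ c ∷ h)) (a , j)))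
          ≈⟨ ∑-swap (cells j′) (cells w′) _ ⟩
        ∑ (cells w′) (λ w → ∑ (cells j′) (λ u → traverse N (toList u ++ code v ∷ (toList w ++ c ∷ h)) (a , j)))
          -- The induction hypothesis for the left factor leaves the continuation at `code v`, and
          -- that is the visit of the right factor.
          ≈⟨ ∑-cong (cells w′) (λ w → P.trans
               (traverse-sum N a j j′ j≡ (code v) (toList w ++ c ∷ h) (≡.subst (λ n → rankAt (suc n) a ≤ N) (total w) (rank-child {k′ +ℕ length h} i<a p)))
               (P.*-congˡ (P.trans (resume-code v (toList w ++ c ∷ h))
                 (traverse-stable _ N (toList w ++ c ∷ h) b (k ⊖ j) (rank≤ (length (toList w ++ c ∷ h)) b) (ℕₚ.≤-trans (rank≤ (length (toList w ++ c ∷ h)) b) (fuel w)))))) ⟩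
        ∑ (cells w′) (λ w → component a (suc j′) ⊗ traverse N (toList w ++ c ∷ h) v)
          ≈⟨ ∑-*ˡ (cells w′) _ _ ⟨
        component a (suc j′) ⊗ ∑ (cells w′) (λ w → traverse N (toList w ++ c ∷ h) v)
          ≈⟨ P.*-congˡ (traverse-sum N b (k ⊖ j) w′ k⊖j≡ c h (ℕₚ.≤-trans (rank≤ (suc (w′ +ℕ length h)) b) fuel′)) ⟩
        component a (suc j′) ⊗ (component b (suc w′) ⊗ resume c h)
          ≈⟨ P.*-assoc _ _ _ ⟨
        (component a (suc j′) ⊗ component b (suc w′)) ⊗ resume c h ∎
        where
        v : Node
        v = b , k ⊖ j
        k⊖j≡ : toℕ (k ⊖ j) ≡ suc w′
        k⊖j≡ = ≡.trans (toℕ-⊖ k j) (≡.trans (cong₂ _∸_ (≡.trans k≡ (cong suc k′≡)) j≡) (ℕₚ.m+n∸m≡n j′ (suc w′)))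
        length-tail : ∀ (w : Vec Cell w′) → length (toList w ++ c ∷ h) ≡ suc (w′ +ℕ length h)
        length-tail w = ≡.trans (length-++ (toList w)) (≡.trans (cong (_+ℕ suc (length h)) (length-toList w)) (ℕₚ.+-suc w′ (length h)))
        sizes : k′ +ℕ length h ≡ j′ +ℕ suc (w′ +ℕ length h)
        sizes = ≡.trans (cong (_+ℕ length h) k′≡) (ℕₚ.+-assoc j′ (suc w′) (length h))
        total : ∀ w → k′ +ℕ length h ≡ j′ +ℕ length (toList w ++ c ∷ h)
        total w = ≡.trans sizes (cong (j′ +ℕ_) (≡.sym (length-tail w)))
        fuel′ : suc (w′ +ℕ length h) *ℕ s ≤ N
        fuel′ = ℕₚ.≤-trans (ℕₚ.*-monoˡ-≤ s (ℕₚ.≤-trans (ℕₚ.m≤n+m (suc (w′ +ℕ length h)) j′) (ℕₚ.≤-reflexive (≡.sym sizes)))) (rank-load {k′ +ℕ length h} i p)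
        fuel : ∀ w → length (toList w ++ c ∷ h) *ℕ s ≤ N
        fuel w = ≡.subst (λ n → n *ℕ s ≤ N) (≡.sym (length-tail w)) fuel′

      factor : ∀ a b → toℕ i < toℕ a → toℕ i < toℕ b → ∀ j →
               ∑ (cells k′) (λ u → product a b k (toList u ++ c ∷ h) (traverse N) j) ≋
               (does (toℕ j ≤? suc k′) ▸ (component a (toℕ j) ⊗ component b (suc k′ ∸ toℕ j))) ⊗ resume c h
      factor a b i<a i<b zero = begin
        ∑ (cells k′) (λ u → cst (constantTerm a) ⊗ traverse N (toList u ++ c ∷ h) (b , k))
          ≈⟨ ∑-*ˡ (cells k′) _ _ ⟨
        cst (constantTerm a) ⊗ ∑ (cells k′) (λ u → traverse N (toList u ++ c ∷ h) (b , k))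
          ≈⟨ P.*-cong (P.sym (component-0 a)) (child b i<b) ⟩
        component a 0 ⊗ (component b (suc k′) ⊗ resume c h)
          ≈⟨ P.*-assoc _ _ _ ⟨
        (component a 0 ⊗ component b (suc k′)) ⊗ resume c h ∎
      factor a b i<a i<b j@(suc j′) with j ≟F k
      ... | yes refl = begin
        ∑ (cells k′) (λ u → cst (constantTerm b) ⊗ traverse N (toList u ++ c ∷ h) (a , j))
          ≈⟨ ∑-*ˡ (cells k′) _ _ ⟨
        cst (constantTerm b) ⊗ ∑ (cells k′) (λ u → traverse N (toList u ++ c ∷ h) (a , j))
          ≈⟨ P.*-congˡ (child a i<a) ⟩
        cst (constantTerm b) ⊗ (component a (suc k′) ⊗ resume c h)
          ≈⟨ P.trans (P.sym (P.*-assoc _ _ _)) (P.*-congʳ (cst-central _ _)) ⟩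
        (component a (suc k′) ⊗ cst (constantTerm b)) ⊗ resume c h
          ≈⟨ P.*-congʳ (P.*-congˡ (component-0 b)) ⟨
        (component a (suc k′) ⊗ component b 0) ⊗ resume c h
          ≡⟨ cong₂ (λ x y → (component a x ⊗ component b y) ⊗ resume c h) (≡.sym k≡) (≡.sym (≡.trans (cong (suc k′ ∸_) k≡) (ℕₚ.n∸n≡0 (suc k′)))) ⟩
        (component a (toℕ j) ⊗ component b (suc k′ ∸ toℕ j)) ⊗ resume c h
          ≈⟨ P.*-congʳ (▸-congᵇ _ (≡.sym (dec-true (toℕ j ≤? suc k′) (ℕₚ.≤-reflexive k≡)))) ⟩
        (does (toℕ j ≤? suc k′) ▸ (component a (toℕ j) ⊗ component b (suc k′ ∸ toℕ j))) ⊗ resume c h ∎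
      ... | no j≢k = proper (toℕ j <? toℕ k)
        where
        proper : (j<?k : Dec (toℕ j < toℕ k)) →
                 ∑ (cells k′) (λ u → does j<?k ▸ holds (toList u ++ c ∷ h) (toℕ j′) (b , k ⊖ j) ▸ traverse N (toList u ++ c ∷ h) (a , j)) ≋
                 (does (toℕ j ≤? suc k′) ▸ (component a (toℕ j) ⊗ component b (suc k′ ∸ toℕ j))) ⊗ resume c h
        proper (yes j<k) = begin
          ∑ (cells k′) (λ u → holds (toList u ++ c ∷ h) (toℕ j′) (b , k ⊖ j) ▸ traverse N (toList u ++ c ∷ h) (a , j))
            ≈⟨ split a b (toℕ j′) j (k′ ∸ suc (toℕ j′)) i<a refl (≡.sym (≡.trans (ℕₚ.+-suc (toℕ j′) _) (ℕₚ.m+[n∸m]≡n j′<k′))) ⟩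
          (component a (toℕ j) ⊗ component b (suc (k′ ∸ suc (toℕ j′)))) ⊗ resume c h
            ≡⟨ cong (λ y → (component a (toℕ j) ⊗ component b y) ⊗ resume c h) (≡.sym (ℕₚ.+-∸-assoc 1 j′<k′)) ⟩
          (component a (toℕ j) ⊗ component b (suc k′ ∸ toℕ j)) ⊗ resume c h
            ≈⟨ P.*-congʳ (▸-congᵇ _ (≡.sym (dec-true (toℕ j ≤? suc k′) (ℕₚ.m≤n⇒m≤1+n j′<k′)))) ⟩
          (does (toℕ j ≤? suc k′) ▸ (component a (toℕ j) ⊗ component b (suc k′ ∸ toℕ j))) ⊗ resume c h ∎
          where
          j′<k′ : suc (toℕ j′) ≤ k′
          j′<k′ = ℕₚ.≤-pred (≡.subst (toℕ j <_) k≡ j<k)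
        proper (no j≮k) = P.trans (∑-zero (cells k′) λ u → P.refl) (P.sym (P.trans (P.*-congʳ (▸-congᵇ _ (dec-false (toℕ j ≤? suc k′)
          λ j≤k → [ j≮k , j≢k ∘ toℕ-injective ]′ (ℕₚ.m≤n⇒m<n∨m≡n (≡.subst (toℕ j ≤_) (≡.sym k≡) j≤k))))) (P.zeroˡ _)))

      leaf : ∀ n → n ≡ k′ → (x : Bool) → x ≡ does (1 ≟ℕ suc n) → ∀ y →
             ∑ (cells n) (λ u → x ▸ (σ y ⊗ load (toList u ++ c ∷ h) (traverse N))) ≋ (does (1 ≟ℕ suc n) ▸ σ y) ⊗ resume c h
      leaf zero    refl _ refl y = P.trans (P.+-identityʳ _) (P.*-congˡ (∑-cong nodes λ (i′ , k″) → ▸-cong (does (c ≟C code (i′ , k″)))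
        (traverse-stable N (length h *ℕ s) h i′ k″ (ℕₚ.≤-trans (rank≤ (length h) i′) (rank-load {length h} i p)) (rank≤ (length h) i′))))
      leaf (suc n) refl _ refl y = P.trans (∑-zero (cells (suc n)) λ u → P.refl) (P.sym (P.zeroˡ _))

      by-gate : ∀ g → Above i g → ∑ (cells k′) (λ u → visit g k (toList u ++ c ∷ h) (traverse N)) ≋ componentOf g (suc k′) ⊗ resume c h
      by-gate (inp x)   _           = leaf k′ refl _ (cong (λ n → does (1 ≟ℕ n)) k≡) x
      by-gate (con a)   _           = P.trans (∑-zero (cells k′) λ u → P.refl) (P.sym (P.zeroˡ _))
      by-gate (add a b) (i<a , i<b) = P.trans (∑-+ (cells k′) _ _) (P.trans (P.+-cong (child a i<a) (child b i<b)) (P.sym (P.distribʳ _ _ _)))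
      by-gate (mul a b) (i<a , i<b) = P.trans (∑-swap (cells k′) (allFin (suc D)) _) (P.trans (∑-cong (allFin (suc D)) (factor a b i<a i<b)) (P.sym (∑-*ʳ (allFin (suc D)) _ _)))

    -- The last cell is the `c` of `traverse-sum`. Behind it nothing remains, so only the code of
    -- `final` survives and the continuations sum to 1.
    component-traverse : ∀ N i → D *ℕ s ≤ N → component i D ≋ ∑ (cells D) (λ u → traverse N (toList u) (i , fromℕ D))
    component-traverse N i D*s≤N = P.sym (begin
      ∑ (cells D) (λ u → traverse N (toList u) (i , fromℕ D))
        ≈⟨ ∑-cells-split D′ 0 (≡.sym (ℕₚ.+-comm D′ 1)) (λ l → traverse N l (i , fromℕ D)) ⟩
      ∑ (cells D′) (λ u → ∑ (elements cellF) (λ c → ∑ (cells 0) (λ w → traverse N (toList u ++ c ∷ toList w) (i , fromℕ D))))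
        ≈⟨ ∑-cong (cells D′) (λ u → ∑-cong (elements cellF) λ c → P.+-identityʳ _) ⟩
      ∑ (cells D′) (λ u → ∑ (elements cellF) (λ c → traverse N (toList u ++ c ∷ []) (i , fromℕ D)))
        ≈⟨ ∑-swap (cells D′) (elements cellF) _ ⟩
      ∑ (elements cellF) (λ c → ∑ (cells D′) (λ u → traverse N (toList u ++ c ∷ []) (i , fromℕ D)))
        ≈⟨ ∑-cong (elements cellF) (λ c → traverse-sum N i (fromℕ D) D′ (toℕ-fromℕ D) c [] (ℕₚ.≤-trans (rank≤ (suc (D′ +ℕ 0)) i)
             (≡.subst (λ n → suc n *ℕ s ≤ N) (≡.sym (ℕₚ.+-identityʳ D′)) D*s≤N))) ⟩
      ∑ (elements cellF) (λ c → component i D ⊗ resume c [])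
        ≈⟨ ∑-*ˡ (elements cellF) _ _ ⟨
      component i D ⊗ ∑ (elements cellF) (λ c → resume c [])
        ≈⟨ P.*-congˡ (P.trans (∑-swap (elements cellF) nodes _) (P.trans (∑-cong nodes λ v → Delta-Bits b (code v) _) (δ-node final λ _ → cst K.1#))) ⟩
      component i D ⊗ cst K.1#   ≈⟨ P.*-identityʳ _ ⟩
      component i D              ∎)

-- The automaton that performs the traversal

module ParseAutomaton {c ℓ} (F : CharZeroField c ℓ) (s′ D′ r₀ : ℕ) (C : Circuit F ⊥ (suc s′)) where
  open Polynomials F
  open Gates F
  open ParseTrees F s′ D′ C
  open PR

  private
    -- Here `b` unfolds to `suc d₀`. With the arguments below, `R` unfolds to `suc D * (b * b)`, the
    -- number of states made of a position and two nodes, and `r` to `D * b + r₀`, the bits of the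
    -- cells and those of the sum.
    d₁ d₀ : ℕ
    d₁ = D′ +ℕ s′ *ℕ suc D
    d₀ = suc d₁

  open TestedAutomaton F (d₁ +ℕ d₀ *ℕ suc d₀ +ℕ D *ℕ (b *ℕ b)) (d₀ +ℕ D′ *ℕ b +ℕ r₀)
    using (R; r; L; bools; lookup-ext; run; automaton-oracle) public

  Config : Set
  Config = Fin (suc D) × Node

  -- Tests, weight and target of a round are functions of the state, so a nondeterministic choice
  -- has to be guessed on entering the state and be part of it.
  State : Set
  State = Config × Node

  configF : Finite Config
  configF = FinF (suc D) ×F nodeF

  _≟U_ : DecidableEquality Config
  _≟U_ = Finite._≟_ configF

  stateF : Finite State
  stateF = configF ×F nodeF

  δ-config : Delta configF
  δ-config = Delta-× (FinF (suc D)) nodeF (Delta-Fin (suc D)) δ-node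

  encode : State → Fin R
  encode ((p , v) , w) = combine p (combine (uncurry combine v) (uncurry combine w))

  decode : Fin R → State
  decode x = let (p , vw) = remQuot {suc D} (b *ℕ b) x ; (v , w) = remQuot {b} b vw in (p , remQuot {s} (suc D) v) , remQuot {s} (suc D) w

  decode-encode : ∀ y → decode (encode y) ≡ y
  decode-encode ((p , v) , w) = ≡.trans (cong decode₁ (remQuot-combine {suc D} p (combine (uncurry combine v) (uncurry combine w))))
    (≡.trans (cong (decode₂ p) (remQuot-combine {b} (uncurry combine v) (uncurry combine w)))
      (cong₂ (λ v w → (p , v) , w) (uncurry remQuot-combine v) (uncurry remQuot-combine w)))
    where
    decode₂ : Fin (suc D) → Fin b × Fin b → State
    decode₂ p (v , w) = (p , remQuot {s} (suc D) v) , remQuot {s} (suc D) w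
    decode₁ : Fin (suc D) × Fin (b *ℕ b) → State
    decode₁ (p , vw) = decode₂ p (remQuot {b} b vw)

  encode-decode : ∀ x → encode (decode x) ≡ x
  encode-decode x = ≡.trans (cong₂ (λ v w → combine p (combine v w)) (combine-remQuot {s} (suc D) v) (combine-remQuot {s} (suc D) w))
    (≡.trans (cong (combine p) (combine-remQuot {b} b vw)) (combine-remQuot {suc D} (b *ℕ b) x))
    where
    p  = proj₁ (remQuot {suc D} (b *ℕ b) x)
    vw = proj₂ (remQuot {suc D} (b *ℕ b) x)
    v  = proj₁ (remQuot {b} b vw)
    w  = proj₂ (remQuot {b} b vw)

  -- Names for all weights that can occur. There are `2 * s + 2` of them, and each becomes one gate
  -- of the reducing circuit.
  data Wire : Set where
    zeroW oneW  : Wire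
    leaf scalar : Fin s → Wire

  wireValue : Wire → Poly
  wireValue zeroW      = cst K.0#
  wireValue oneW       = cst K.1#
  wireValue (leaf i)   = leafValue r₀ (gateAt C i)
  wireValue (scalar i) = cst (constantTerm i)

  record Step : Set where
    constructor step
    field
      weight    : Wire
      readsBit  : Maybe (Fin r₀)
      readsCell : Maybe (Fin D × Node)
      target    : Config

  open Step

  dead : Step
  dead = step zeroW nothing nothing (zero , final)

  bitOf : ∀ {x} → Dec (x < r₀) → Maybe (Fin r₀)
  bitOf (yes x<) = just (fromℕ< x<)
  bitOf (no _)   = nothing

  checkCell : ∀ {q} → Dec (q < D) → Node → Config → Step
  checkCell (yes q<) v u = step oneW nothing (just (fromℕ< q< , v)) u
  checkCell (no _)   v u = dead

  -- The second component of a state is a nondeterministic choice: the pair loaded after a leaf, or, in its degree part,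
  -- the summand taken at an addition and the degree of the left factor at a multiplication.
  gateStep : Gate F ⊥ s → Fin s → ∀ p → toℕ p < D → Fin (suc D) → Node → Step
  gateStep (inp x)   i p p< k w = if does (1 ≟ℕ toℕ k) then step (leaf i) (bitOf (x <? r₀)) (just (fromℕ< p< , w)) (fromℕ< (s≤s p<) , w) else dead
  gateStep (add a b) i p p< k (zero , zero)          = step oneW nothing nothing (p , a , k)
  gateStep (add a b) i p p< k (zero , suc zero)      = step oneW nothing nothing (p , b , k)
  gateStep (mul a b) i p p< k (zero , zero)          = step (scalar a) nothing nothing (p , b , k)
  gateStep (mul a b) i p p< k (zero , j@(suc j′))    =
    if does (j ≟F k) then step (scalar b) nothing nothing (p , a , k) else
    (if does (toℕ j <? toℕ k) then checkCell (toℕ p +ℕ toℕ j′ <? D) (b , k ⊖ j) (p , a , j) else dead)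
  -- Besides constant gates this rejects all guesses that stand for no summand; otherwise a sum or
  -- product would be counted once for each of them.
  gateStep _         i p p< k _ = dead

  stepFrom : ∀ p → Dec (toℕ p < D) → Node → Node → Step
  stepFrom p (yes p<) (i , k) w = gateStep (gateAt C i) i p p< k w
  -- After `D` leaves the automaton idles until all rounds are over; fixing the guess to `final`
  -- leaves just one way to idle.
  stepFrom p (no _)   v       w = if does (v ≟N final) ∧ does (w ≟N final) then step oneW nothing nothing (p , v) else dead

  stepOf : State → Step
  stepOf ((p , v) , w) = stepFrom p (toℕ p <? D) v w

  bitHolds : Vec Bool r₀ → Maybe (Fin r₀) → Bool
  bitHolds e nothing  = true
  bitHolds e (just a) = lookup e a

  cellHolds : Vec Cell D → Maybe (Fin D × Node) → Bool
  cellHolds cs nothing        = true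
  cellHolds cs (just (q , v)) = does (lookup cs q ≟C code v)

  testCell : Maybe (Fin D × Node) → Fin D × Fin b → Bool → Bool
  testCell nothing        _        bit = true
  testCell (just (q , v)) (q′ , l) bit = if does (q′ ≟F q) then does (bit ≟B lookup (code v) l) else true

  testBit : Maybe (Fin r₀) → Fin r₀ → Bool → Bool
  testBit nothing   a′ bit = true
  testBit (just a)  a′ bit = if does (a′ ≟F a) then bit else true

  test : Step → Fin (D *ℕ b) ⊎ Fin r₀ → Bool → Bool
  test S (inj₁ ql) = testCell (readsCell S) (remQuot b ql)
  test S (inj₂ a)  = testBit (readsBit S) a

  cellsOf : Vec Bool r → Vec Cell D
  cellsOf e = tabulate (λ q → tabulate (λ l → lookup e (combine q l ↑ˡ r₀)))

  bitsOf : Vec Bool r → Vec Bool r₀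
  bitsOf e = tabulate (λ a → lookup e ((D *ℕ b) ↑ʳ a))

  lookup-cellsOf : ∀ e q l → lookup (lookup (cellsOf e) q) l ≡ lookup e (combine q l ↑ˡ r₀)
  lookup-cellsOf e q l = ≡.trans (cong (λ x → lookup x l) (lookup∘tabulate (λ q → tabulate (λ l → lookup e (combine q l ↑ˡ r₀))) q))
    (lookup∘tabulate (λ l → lookup e (combine q l ↑ˡ r₀)) l)

  lookup-bitsOf : ∀ e a → lookup (bitsOf e) a ≡ lookup e ((D *ℕ b) ↑ʳ a)
  lookup-bitsOf e a = lookup∘tabulate (λ a → lookup e ((D *ℕ b) ↑ʳ a)) a

  joinedBit : Vec Cell D → Vec Bool r₀ → Fin (D *ℕ b) ⊎ Fin r₀ → Bool
  joinedBit cs e (inj₁ ql) = uncurry (λ q l → lookup (lookup cs q) l) (remQuot {D} b ql)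
  joinedBit cs e (inj₂ a)  = lookup e a

  joinBits : Vec Cell D × Vec Bool r₀ → Vec Bool r
  joinBits (cs , e) = tabulate (λ J → joinedBit cs e (splitAt (D *ℕ b) J))

  lookup-joinBits : ∀ cs e J → lookup (joinBits (cs , e)) J ≡ joinedBit cs e (splitAt (D *ℕ b) J)
  lookup-joinBits cs e J = lookup∘tabulate (λ J → joinedBit cs e (splitAt (D *ℕ b) J)) J

  split-joinBits : ∀ ce → (cellsOf (joinBits ce) , bitsOf (joinBits ce)) ≡ ce
  split-joinBits (cs , e) = cong₂ _,_
    (lookup-ext λ q → lookup-ext λ l → ≡.trans (lookup-cellsOf (joinBits (cs , e)) q l) (≡.trans (lookup-joinBits cs e (combine q l ↑ˡ r₀))
      (≡.trans (cong (joinedBit cs e) (splitAt-↑ˡ (D *ℕ b) (combine q l) r₀)) (cong (uncurry (λ q l → lookup (lookup cs q) l)) (remQuot-combine q l)))))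
    (lookup-ext λ a → ≡.trans (lookup-bitsOf (joinBits (cs , e)) a) (≡.trans (lookup-joinBits cs e ((D *ℕ b) ↑ʳ a))
      (cong (joinedBit cs e) (splitAt-↑ʳ (D *ℕ b) r₀ a))))

  join-splitBits : ∀ e → joinBits (cellsOf e , bitsOf e) ≡ e
  join-splitBits e = lookup-ext λ J → ≡.trans (lookup-joinBits (cellsOf e) (bitsOf e) J) (by-part J (splitAt (D *ℕ b) J) refl)
    where
    by-part : ∀ J P → splitAt (D *ℕ b) J ≡ P → joinedBit (cellsOf e) (bitsOf e) P ≡ lookup e J
    by-part J (inj₁ ql) eq = ≡.trans (lookup-cellsOf e (proj₁ (remQuot {D} b ql)) (proj₂ (remQuot {D} b ql)))
      (cong (lookup e) (≡.trans (cong (_↑ˡ r₀) (combine-remQuot {D} b ql)) (splitAt⁻¹-↑ˡ eq)))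
    by-part J (inj₂ a)  eq = ≡.trans (lookup-bitsOf e a) (cong (lookup e) (splitAt⁻¹-↑ʳ eq))

  -- A slot sees a single bit, so comparing a cell with a code is spread over the `b` slots of that
  -- cell; all other slots accept both values.
  all-tests : ∀ S e → allᵇ (λ J → test S (splitAt (D *ℕ b) J) (lookup e J)) ≡ bitHolds (bitsOf e) (readsBit S) ∧ cellHolds (cellsOf e) (readsCell S)
  all-tests S@(step _ B Q _) e = Bool-⇔
    (λ h → cong₂ _∧_ (bit B λ a → ≡.trans (≡.sym (cong (λ P → test S P (lookup e ((D *ℕ b) ↑ʳ a))) (splitAt-↑ʳ (D *ℕ b) r₀ a))) (allᵇ⇒ {t = tested} h ((D *ℕ b) ↑ʳ a)))
                     (cell Q λ q l → ≡.trans (≡.sym (≡.trans (cong (λ P → test S P (lookup e (combine q l ↑ˡ r₀))) (splitAt-↑ˡ (D *ℕ b) (combine q l) r₀))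
                       (cong (λ ql → testCell Q ql (lookup e (combine q l ↑ˡ r₀))) (remQuot-combine q l)))) (allᵇ⇒ {t = tested} h (combine q l ↑ˡ r₀))))
    (λ h → ⇒allᵇ {t = tested} λ J → by-part J (splitAt (D *ℕ b) J) refl (∧-⇒ˡ h) (∧-⇒ʳ {bitHolds (bitsOf e) B} h))
    where
    tested : Fin r → Bool
    tested J = test S (splitAt (D *ℕ b) J) (lookup e J)
    bit : ∀ B → (∀ a → testBit B a (lookup e ((D *ℕ b) ↑ʳ a)) ≡ true) → bitHolds (bitsOf e) B ≡ true
    bit nothing  h = refl
    bit (just a) h with a ≟F a | h a
    ... | yes _ | q = ≡.trans (lookup-bitsOf e a) q
    ... | no ¬p | _ = ⊥-elim (¬p refl)
    cell : ∀ Q → (∀ q l → testCell Q (q , l) (lookup e (combine q l ↑ˡ r₀)) ≡ true) → cellHolds (cellsOf e) Q ≡ true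
    cell nothing        h = refl
    cell (just (q , v)) h = dec-true (lookup (cellsOf e) q ≟C code v) (lookup-ext λ l → ≡.trans (lookup-cellsOf e q l) (agrees l (h q l)))
      where
      agrees : ∀ l → testCell (just (q , v)) (q , l) (lookup e (combine q l ↑ˡ r₀)) ≡ true → lookup e (combine q l ↑ˡ r₀) ≡ lookup (code v) l
      agrees l t with q ≟F q
      ... | yes _ = does⇒ (_ ≟B _) t
      ... | no ¬p = ⊥-elim (¬p refl)
    bit⁻ : ∀ B a {x} → x ≡ lookup (bitsOf e) a → bitHolds (bitsOf e) B ≡ true → testBit B a x ≡ true
    bit⁻ nothing   a _ _ = refl
    bit⁻ (just a′) a x≡ h with a ≟F a′
    ... | yes refl = ≡.trans x≡ h
    ... | no _     = refl
    cell⁻ : ∀ Q q′ l {x} → x ≡ lookup (lookup (cellsOf e) q′) l → cellHolds (cellsOf e) Q ≡ true → testCell Q (q′ , l) x ≡ true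
    cell⁻ nothing        q′ l _ _ = refl
    cell⁻ (just (q , v)) q′ l x≡ h with q′ ≟F q
    ... | yes refl = dec-true (_ ≟B _) (≡.trans x≡ (cong (λ c → lookup c l) (does⇒ (lookup (cellsOf e) q ≟C code v) h)))
    ... | no _     = refl
    by-part : ∀ J P → splitAt (D *ℕ b) J ≡ P → bitHolds (bitsOf e) B ≡ true → cellHolds (cellsOf e) Q ≡ true → test S P (lookup e J) ≡ true
    by-part J (inj₂ a)  eq hb hc = bit⁻ B a (≡.trans (cong (lookup e) (≡.sym (splitAt⁻¹-↑ʳ eq))) (≡.sym (lookup-bitsOf e a))) hb
    by-part J (inj₁ ql) eq hb hc = cell⁻ Q (proj₁ (remQuot {D} b ql)) (proj₂ (remQuot {D} b ql))
      (≡.trans (cong (lookup e) (≡.sym (≡.trans (cong (_↑ˡ r₀) (combine-remQuot {D} b ql)) (splitAt⁻¹-↑ˡ eq))))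
        (≡.sym (lookup-cellsOf e (proj₁ (remQuot {D} b ql)) (proj₂ (remQuot {D} b ql))))) hc

  weightAt : Fin R → Wire
  weightAt x = weight (stepOf (decode x))

  testAt : Fin R → Fin r → Bool → Bool
  testAt x J = test (stepOf (decode x)) (splitAt (D *ℕ b) J)

  moves : Fin R → Fin R → Bool
  moves x y = does ((proj₁ (decode y)) ≟U (target (stepOf (decode x))))

  finalState : Fin R
  finalState = encode ((fromℕ D , final) , final)

  runFrom : Vec Bool r → ℕ → Fin R → Poly
  runFrom e = run wireValue zeroW oneW P.refl P.refl weightAt testAt moves e finalState

  visitSum : Vec Bool r → ℕ → Config → Poly
  visitSum e N u = ∑ nodes (λ w → runFrom e N (encode (u , w)))

  outcome : Vec Bool r → Step → (Config → Poly) → Poly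
  outcome e S φ = (bitHolds (bitsOf e) (readsBit S) ∧ cellHolds (cellsOf e) (readsCell S)) ▸ (wireValue (weight S) ⊗ φ (target S))

  outcome-dead : ∀ e φ → outcome e dead φ ≋ cst K.0#
  outcome-dead e φ = P.zeroˡ _

  -- A move prescribes the next configuration and leaves the next guess open, which is the sum in
  -- `visitSum`.
  run-suc : ∀ e N y → runFrom e (suc N) (encode y) ≋ outcome e (stepOf y) (visitSum e N)
  run-suc e N y = begin
    accepted (decode (encode y)) ▸ (wireValue (weight (stepOf (decode (encode y)))) ⊗
      ∑ (allFin R) (λ x → does (Finite._≟_ configF (proj₁ (decode x)) (target (stepOf (decode (encode y))))) ▸ runFrom e N x))
      ≡⟨ cong (λ y → accepted y ▸ (wireValue (weight (stepOf y)) ⊗ ∑ (allFin R) (λ x → does ((proj₁ (decode x)) ≟U (target (stepOf y))) ▸ runFrom e N x))) (decode-encode y) ⟩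
    accepted y ▸ (wireValue (weight S) ⊗ ∑ (allFin R) (λ x → does ((proj₁ (decode x)) ≟U (target S)) ▸ runFrom e N x))
      ≈⟨ P.trans (▸-congᵇ _ (all-tests S e)) (▸-cong (bitHolds (bitsOf e) (readsBit S) ∧ cellHolds (cellsOf e) (readsCell S)) (P.*-congˡ successors)) ⟩
    outcome e S (visitSum e N) ∎
    where
    S = stepOf y
    accepted : State → Bool
    accepted y = allᵇ (λ J → test (stepOf y) (splitAt (D *ℕ b) J) (lookup e J))
    successors : ∑ (allFin R) (λ x → does ((proj₁ (decode x)) ≟U (target S)) ▸ runFrom e N x) ≋ visitSum e N (target S)
    successors = begin
      ∑ (allFin R) (λ x → does ((proj₁ (decode x)) ≟U (target S)) ▸ runFrom e N x)
        ≈⟨ ∑-bijection (FinF R) stateF (Delta-Fin R) (Delta-× configF nodeF δ-config δ-node) decode encode decode-encode encode-decode _ ⟩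
      ∑ (elements stateF) (λ y → does ((proj₁ (decode (encode y))) ≟U (target S)) ▸ runFrom e N (encode y))
        ≈⟨ ∑-cartesian _,_ (elements configF) nodes _ ⟩
      ∑ (elements configF) (λ u → ∑ nodes (λ w → does (Finite._≟_ configF (proj₁ (decode (encode (u , w)))) (target S)) ▸ runFrom e N (encode (u , w))))
        ≈⟨ ∑-cong (elements configF) (λ u → P.trans (∑-cong nodes λ w → ▸-congᵇ _ (cong (λ y → does ((proj₁ y) ≟U (target S))) (decode-encode (u , w))))
             (P.sym (▸-∑ (does (u ≟U (target S))) nodes _))) ⟩
      ∑ (elements configF) (λ u → does (u ≟U (target S)) ▸ visitSum e N u)
        ≈⟨ δ-config (target S) (visitSum e N) ⟩
      visitSum e N (target S) ∎

  drop-toList : ∀ {n} (cs : Vec Cell n) p (p< : p < n) → List.drop p (toList cs) ≡ lookup cs (fromℕ< p<) ∷ List.drop (suc p) (toList cs)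
  drop-toList (c ∷ᵥ cs) zero    p<       = refl
  drop-toList (c ∷ᵥ cs) (suc p) (s≤s p<) = drop-toList cs p p<

  drop-all : ∀ {n} (cs : Vec Cell n) p → n ≤ p → List.drop p (toList cs) ≡ []
  drop-all []ᵥ       zero    n≤p       = refl
  drop-all []ᵥ       (suc p) n≤p       = refl
  drop-all (c ∷ᵥ cs) (suc p) (s≤s n≤p) = drop-all cs p n≤p

  holds-drop : ∀ p h n v → holds (List.drop p h) n v ≡ holds h (p +ℕ n) v
  holds-drop zero    h       n v = refl
  holds-drop (suc p) []      n v = refl
  holds-drop (suc p) (c ∷ h) n v = holds-drop p h n v

  holds-toList : ∀ {m} (cs : Vec Cell m) n v → (n< : n < m) → holds (toList cs) n v ≡ does (lookup cs (fromℕ< n<) ≟C code v)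
  holds-toList (c ∷ᵥ cs) zero    v n<       = refl
  holds-toList (c ∷ᵥ cs) (suc n) v (s≤s n<) = holds-toList cs n v n<

  holds-beyond : ∀ {m} (cs : Vec Cell m) n v → ¬ n < m → holds (toList cs) n v ≡ false
  holds-beyond []ᵥ       n       v n≮ = refl
  holds-beyond (c ∷ᵥ cs) zero    v n≮ = ⊥-elim (n≮ (s≤s z≤n))
  holds-beyond (c ∷ᵥ cs) (suc n) v n≮ = holds-beyond cs n v (n≮ ∘ s≤s)

  leaf-plug : ∀ e x → bitHolds (bitsOf e) (bitOf (x <? r₀)) ▸ inputValue (x <? r₀) ≋ plugBits F r₀ (bitsOf e) x
  leaf-plug e x with x <? r₀
  ... | yes x< = by-bit (lookup (bitsOf e) (fromℕ< x<))
    where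
    by-bit : ∀ b → b ▸ cst K.1# ≋ cst (if b then K.1# else K.0#)
    by-bit true  = P.refl
    by-bit false = P.refl
  ... | no _   = P.refl

  module _ (e : Vec Bool r) where
    private
      σ : ℕ → Poly
      σ = plugBits F r₀ (bitsOf e)
      cellsAfter : Fin (suc D) → List Cell
      cellsAfter p = List.drop (toℕ p) (toList (cellsOf e))

    ∑-nodes : (f : Node → Poly) → ∑ nodes f ≋ ∑ (allFin s) (λ i → ∑ (allFin (suc D)) (λ k → f (i , k)))
    ∑-nodes f = ∑-cartesian _,_ (allFin s) (allFin (suc D)) f

    ∑-nodes-zero : (f : Node → Poly) → (∀ i k → f (suc i , k) ≋ cst K.0#) → ∑ nodes f ≋ ∑ (allFin (suc D)) (λ k → f (zero , k))
    ∑-nodes-zero f h = P.trans (∑-nodes f) (P.trans (P.reflexive (∑-suc s′ (λ i → ∑ (allFin (suc D)) (λ k → f (i , k)))))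
      (P.trans (P.+-congˡ (∑-zero (allFin s′) λ i → ∑-zero (allFin (suc D)) λ k → h i k)) (P.+-identityʳ _)))

    -- Remaining rounds play the role of fuel. When none are left, only the configuration with all
    -- leaves read and node `final` counts, just as for a traversal without fuel.
    visitSum-traverse : ∀ N p v → visitSum e N (p , v) ≋ traverse σ N (cellsAfter p) v
    visitSum-traverse zero p v = begin
      ∑ nodes (λ w → does (encode ((p , v) , w) ≟F finalState) ▸ cst K.1#)
        ≈⟨ ∑-cong nodes (λ w → P.trans (▸-congᵇ _ (is-final w)) (▸-∧ (does (w ≟N final)) (does ((p , v) ≟U (fromℕ D , final))) _)) ⟩
      ∑ nodes (λ w → does (w ≟N final) ▸ does ((p , v) ≟U (fromℕ D , final)) ▸ cst K.1#)
        ≈⟨ δ-node final (λ _ → does ((p , v) ≟U (fromℕ D , final)) ▸ cst K.1#) ⟩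
      does ((p , v) ≟U (fromℕ D , final)) ▸ cst K.1#
        ≈⟨ at-end (toℕ p <? D) ⟩
      traverse σ zero (cellsAfter p) v ∎
      where
      is-final : ∀ w → does (encode ((p , v) , w) ≟F finalState) ≡ does (w ≟N final) ∧ does ((p , v) ≟U (fromℕ D , final))
      is-final w = Bool-⇔
        (λ h → let q = ≡.trans (≡.sym (decode-encode ((p , v) , w))) (≡.trans (cong decode (does⇒ (encode ((p , v) , w) ≟F finalState) h)) (decode-encode ((fromℕ D , final) , final)))
               in cong₂ _∧_ (dec-true (w ≟N final) (cong proj₂ q)) (dec-true ((p , v) ≟U (fromℕ D , final)) (cong proj₁ q)))
        (λ h → dec-true (encode ((p , v) , w) ≟F finalState) (cong encode (cong₂ _,_
               (does⇒ ((p , v) ≟U (fromℕ D , final)) (∧-⇒ʳ {does (w ≟N final)} h)) (does⇒ (w ≟N final) (∧-⇒ˡ h)))))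
      at-end : Dec (toℕ p < D) → does ((p , v) ≟U (fromℕ D , final)) ▸ cst K.1# ≋ traverse σ zero (cellsAfter p) v
      at-end (yes p<) rewrite drop-toList (cellsOf e) (toℕ p) p< = ▸-congᵇ _ (dec-false ((p , v) ≟U (fromℕ D , final))
        λ q → ℕₚ.<-irrefl (≡.trans (cong (toℕ ∘ proj₁) q) (toℕ-fromℕ D)) p<)
      at-end (no p≮) rewrite drop-all (cellsOf e) (toℕ p) (ℕₚ.≮⇒≥ p≮) = ▸-congᵇ _ (does-⇔ ((p , v) ≟U (fromℕ D , final)) (v ≟N final)
        (cong proj₂) (cong₂ _,_ (toℕ-injective (≡.trans (ℕₚ.≤-antisym (ℕₚ.≤-pred (toℕ<n p)) (ℕₚ.≮⇒≥ p≮)) (≡.sym (toℕ-fromℕ D))))))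
    visitSum-traverse (suc N) p v = P.trans (∑-cong nodes λ w → run-suc e N ((p , v) , w)) (by-position (toℕ p <? D) v)
      where
      IH : ∀ p v → visitSum e N (p , v) ≋ traverse σ N (cellsAfter p) v
      IH = visitSum-traverse N

      module _ (p< : toℕ p < D) where
        q : Fin D
        q = fromℕ< p<

        checked : ∀ a j v → (d : Dec (toℕ p +ℕ toℕ j < D)) →
                  outcome e (checkCell d v (p , a , suc j)) (visitSum e N) ≋ holds (cellsAfter p) (toℕ j) v ▸ traverse σ N (cellsAfter p) (a , suc j)
        checked a j v (yes q<) = P.trans (▸-cong (does (lookup (cellsOf e) (fromℕ< q<) ≟C code v)) (P.trans (P.*-identityˡ _) (IH p (a , suc j))))
          (▸-congᵇ _ (≡.sym (≡.trans (holds-drop (toℕ p) (toList (cellsOf e)) (toℕ j) v) (holds-toList (cellsOf e) _ v q<))))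
        checked a j v (no q≮)  = P.trans (outcome-dead e (visitSum e N))
          (▸-congᵇ {false} _ (≡.sym (≡.trans (holds-drop (toℕ p) (toList (cellsOf e)) (toℕ j) v) (holds-beyond (cellsOf e) _ v q≮))))

        by-gate : ∀ g i k → gateAt C i ≡ g → ∑ nodes (λ w → outcome e (gateStep g i p p< k w) (visitSum e N)) ≋ visit σ g k (cellsAfter p) (traverse σ N)
        by-gate (inp x) i k g≡ with does (1 ≟ℕ toℕ k)
        ... | false = ∑-zero nodes λ w → outcome-dead e (visitSum e N)
        ... | true  = begin
          ∑ nodes (λ w → (B ∧ does (lookup (cellsOf e) q ≟C code w)) ▸ (leafValue r₀ (gateAt C i) ⊗ visitSum e N (fromℕ< (s≤s p<) , w)))
            ≈⟨ ∑-cong nodes (λ w → begin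
                (B ∧ does (lookup (cellsOf e) q ≟C code w)) ▸ (leafValue r₀ (gateAt C i) ⊗ visitSum e N (fromℕ< (s≤s p<) , w))
                  ≈⟨ ▸-* B (does (lookup (cellsOf e) q ≟C code w)) _ _ ⟨
                (B ▸ leafValue r₀ (gateAt C i)) ⊗ (does (lookup (cellsOf e) q ≟C code w) ▸ visitSum e N (fromℕ< (s≤s p<) , w))
                  ≈⟨ P.*-cong (P.trans (P.reflexive (cong (λ g → B ▸ leafValue r₀ g) g≡)) (leaf-plug e x))
                       (▸-cong (does (lookup (cellsOf e) q ≟C code w)) (P.trans (IH (fromℕ< (s≤s p<)) w) (P.reflexive (cong (λ n → traverse σ N (List.drop n (toList (cellsOf e))) w) (toℕ-fromℕ< (s≤s p<)))))) ⟩
                σ x ⊗ (does (lookup (cellsOf e) q ≟C code w) ▸ traverse σ N (List.drop (suc (toℕ p)) (toList (cellsOf e))) w) ∎) ⟩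
          ∑ nodes (λ w → σ x ⊗ (does (lookup (cellsOf e) q ≟C code w) ▸ traverse σ N (List.drop (suc (toℕ p)) (toList (cellsOf e))) w))
            ≈⟨ ∑-*ˡ nodes _ _ ⟨
          σ x ⊗ load σ (lookup (cellsOf e) q ∷ List.drop (suc (toℕ p)) (toList (cellsOf e))) (traverse σ N)
            ≡⟨ cong (λ h → σ x ⊗ load σ h (traverse σ N)) (drop-toList (cellsOf e) (toℕ p) p<) ⟨
          σ x ⊗ load σ (cellsAfter p) (traverse σ N) ∎
          where
          B : Bool
          B = bitHolds (bitsOf e) (bitOf (x <? r₀))
        by-gate (con a) i k g≡ = ∑-zero nodes λ w → outcome-dead e (visitSum e N)
        by-gate (add a b) i k g≡ = begin
          ∑ nodes f
            ≈⟨ ∑-nodes-zero f (λ _ _ → outcome-dead e (visitSum e N)) ⟩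
          ∑ (allFin (suc D)) (λ j → f (zero , j))
            ≡⟨ ≡.trans (∑-suc D _) (cong (f (zero , zero) ⊕_) (∑-suc D′ _)) ⟩
          f (zero , zero) ⊕ (f (zero , suc zero) ⊕ ∑ (allFin D′) (λ j → f (zero , suc (suc j))))
            ≈⟨ P.+-congˡ (P.trans (P.+-congˡ (∑-zero (allFin D′) λ j → outcome-dead e (visitSum e N))) (P.+-identityʳ _)) ⟩
          f (zero , zero) ⊕ f (zero , suc zero)
            ≈⟨ P.+-cong (P.trans (P.*-identityˡ _) (IH p (a , k))) (P.trans (P.*-identityˡ _) (IH p (b , k))) ⟩
          traverse σ N (cellsAfter p) (a , k) ⊕ traverse σ N (cellsAfter p) (b , k) ∎
          where
          f : Node → Poly
          f w = outcome e (gateStep (add a b) i p p< k w) (visitSum e N)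
        by-gate (mul a b) i k g≡ = P.trans (∑-nodes-zero f (λ _ _ → outcome-dead e (visitSum e N))) (∑-cong (allFin (suc D)) factor)
          where
          f : Node → Poly
          f w = outcome e (gateStep (mul a b) i p p< k w) (visitSum e N)
          factor : ∀ j → f (zero , j) ≋ product σ a b k (cellsAfter p) (traverse σ N) j
          factor zero = P.*-congˡ (IH p (b , k))
          factor j@(suc j′) with does (j ≟F k)
          ... | true  = P.*-congˡ (IH p (a , k))
          ... | false with does (toℕ j <? toℕ k)
          ... | true  = checked a j′ (b , k ⊖ j) (toℕ p +ℕ toℕ j′ <? D)
          ... | false = outcome-dead e (visitSum e N)

      by-position : (d : Dec (toℕ p < D)) → ∀ v → ∑ nodes (λ w → outcome e (stepFrom p d v w) (visitSum e N)) ≋ traverse σ (suc N) (cellsAfter p) v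
      by-position (yes p<) (i , k) = P.trans (by-gate p< (gateAt C i) i k refl)
        (P.reflexive (unfold (cellsAfter p) (drop-toList (cellsOf e) (toℕ p) p<)))
        where
        unfold : ∀ h {x h′} → h ≡ x ∷ h′ → visit σ (gateAt C i) k h (traverse σ N) ≡ traverse σ (suc N) h (i , k)
        unfold _ refl = refl
      by-position (no p≮) v = begin
        ∑ nodes (λ w → outcome e (if does (v ≟N final) ∧ does (w ≟N final) then step oneW nothing nothing (p , v) else dead) (visitSum e N))
          ≈⟨ ∑-cong nodes (λ w → by-test (does (v ≟N final)) (does (w ≟N final))) ⟩
        ∑ nodes (λ w → does (w ≟N final) ▸ does (v ≟N final) ▸ visitSum e N (p , v))
          ≈⟨ δ-node final (λ _ → does (v ≟N final) ▸ visitSum e N (p , v)) ⟩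
        does (v ≟N final) ▸ visitSum e N (p , v)
          ≈⟨ ▸-cong (does (v ≟N final)) (IH p v) ⟩
        does (v ≟N final) ▸ traverse σ N (cellsAfter p) v
          ≡⟨ cong (λ h → does (v ≟N final) ▸ traverse σ N h v) (drop-all (cellsOf e) (toℕ p) (ℕₚ.≮⇒≥ p≮)) ⟩
        does (v ≟N final) ▸ does (v ≟N final) ▸ cst K.1#
          ≈⟨ idempotent (does (v ≟N final)) ⟩
        does (v ≟N final) ▸ cst K.1#
          ≡⟨ cong (λ h → traverse σ (suc N) h v) (drop-all (cellsOf e) (toℕ p) (ℕₚ.≮⇒≥ p≮)) ⟨
        traverse σ (suc N) (cellsAfter p) v ∎
        where
        idempotent : ∀ b → b ▸ b ▸ cst K.1# ≋ b ▸ cst K.1#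
        idempotent true  = P.refl
        idempotent false = P.refl
        by-test : ∀ s t → outcome e (if s ∧ t then step oneW nothing nothing (p , v) else dead) (visitSum e N) ≋ t ▸ s ▸ visitSum e N (p , v)
        by-test true  true  = P.*-identityˡ _
        by-test true  false = outcome-dead e (visitSum e N)
        by-test false t     = P.trans (outcome-dead e (visitSum e N)) (P.sym (▸-zero t))

  -- The bits of the automaton split into the cells and the vector `e₀`, so one sum over bit vectors
  -- covers both the parse trees and the outer sum. The `R` rounds exceed the `D * s` steps of any
  -- traversal.
  component-runs : ∀ i → ∑ (vecs r₀ bools) (λ e₀ → component (plugBits F r₀ e₀) i D) ≋
                         ∑ nodes (λ w → ∑ (vecs r bools) (λ e → runFrom e R (encode ((zero , i , fromℕ D) , w))))
  component-runs i = P.sym (begin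
    ∑ nodes (λ w → ∑ (vecs r bools) (λ e → runFrom e R (encode ((zero , i , fromℕ D) , w))))
      ≈⟨ ∑-swap nodes (vecs r bools) _ ⟩
    ∑ (vecs r bools) (λ e → visitSum e R (zero , i , fromℕ D))
      ≈⟨ ∑-cong (vecs r bools) (λ e → visitSum-traverse e R zero (i , fromℕ D)) ⟩
    ∑ (vecs r bools) (λ e → traverse (plugBits F r₀ (bitsOf e)) R (toList (cellsOf e)) (i , fromℕ D))
      ≈⟨ ∑-bijection (BoolF ^F r) (cellF ^F D ×F BoolF ^F r₀) (Delta-Bits r) (Delta-× (cellF ^F D) (BoolF ^F r₀) (Delta-Vec cellF (Delta-Bits b) D) (Delta-Bits r₀))
           (λ e → cellsOf e , bitsOf e) joinBits split-joinBits join-splitBits _ ⟩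
    ∑ (elements (cellF ^F D ×F BoolF ^F r₀)) (λ ce → traverse (plugBits F r₀ (bitsOf (joinBits ce))) R (toList (cellsOf (joinBits ce))) (i , fromℕ D))
      ≈⟨ ∑-cong (elements (cellF ^F D ×F BoolF ^F r₀)) (λ ce → P.reflexive (cong (λ ce → traverse (plugBits F r₀ (proj₂ ce)) R (toList (proj₁ ce)) (i , fromℕ D)) (split-joinBits ce))) ⟩
    ∑ (elements (cellF ^F D ×F BoolF ^F r₀)) (λ ce → traverse (plugBits F r₀ (proj₂ ce)) R (toList (proj₁ ce)) (i , fromℕ D))
      ≈⟨ P.trans (∑-cartesian _,_ (cells D) (vecs r₀ bools) _) (∑-swap (cells D) (vecs r₀ bools) _) ⟩
    ∑ (vecs r₀ bools) (λ e₀ → ∑ (cells D) (λ cs → traverse (plugBits F r₀ e₀) R (toList cs) (i , fromℕ D)))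
      ≈⟨ ∑-cong (vecs r₀ bools) (λ e₀ → component-traverse (plugBits F r₀ e₀) R i fuel) ⟨
    ∑ (vecs r₀ bools) (λ e₀ → component (plugBits F r₀ e₀) i D) ∎)
    where
    fuel : D *ℕ s ≤ R
    fuel = ℕₚ.*-mono-≤ (ℕₚ.n≤1+n D) (ℕₚ.≤-trans (ℕₚ.m≤m*n s (suc D)) (ℕₚ.m≤m*n b b))

-- Assembling circuits with shared gates

module Building {c ℓ} (F : CharZeroField c ℓ) {O : Set} (⟦_⟧ : O → NCPoly F) where
  open Polynomials F

  Has : ∀ {k} → Circuit F O k → Poly → Set c
  Has C p = Σ[ i ∈ Fin _ ] lookup (values F ⟦_⟧ C) i ≡ p

  has-▷ : ∀ {k} {C : Circuit F O k} g {p} → Has C p → Has (C ▷ g) p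
  has-▷ g (i , e) = suc i , e

  -- Gate values are compared by ≡: a polynomial is built exactly as written, sharing the gates of repeated subterms.
  Build : (Poly → Set c) → ℕ → (Poly → Set c) → Set c
  Build Γ n Δ = ∀ {k} (C : Circuit F O k) → (∀ {p} → Γ p → Has C p) →
    Σ[ k′ ∈ ℕ ] Σ[ C′ ∈ Circuit F O k′ ] (k′ ≤ n +ℕ k × (∀ {p} → Has C p → Has C′ p) × (∀ {p} → Δ p → Has C′ p))

  private variable
    Γ Δ Θ : Poly → Set c
    a b n n′ : ℕ
    p q : Poly

  build-gate : ∀ {p} → (∀ {k} (C : Circuit F O k) → (∀ {p} → Γ p → Has C p) → Σ[ g ∈ Gate F O k ] gateVal F ⟦_⟧ g (values F ⟦_⟧ C) ≡ p) →
               Build Γ 1 (_≡ p)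
  build-gate gate C has = let (g , e) = gate C has in _ , C ▷ g , ℕₚ.≤-refl , has-▷ g , λ { refl → zero , e }

  build-var : ∀ i → Build Γ 1 (_≡ var i)
  build-var i = build-gate λ C _ → inp i , refl

  build-cst : ∀ x → Build Γ 1 (_≡ cst x)
  build-cst x = build-gate λ C _ → con x , refl

  build-have : Γ p → Build Γ 0 (_≡ p)
  build-have γ C has = _ , C , ℕₚ.≤-refl , id , λ { refl → has γ }

  build-≤ : n ≤ n′ → Build Γ n Δ → Build Γ n′ Δ
  build-≤ n≤ B {k} C has = let (k′ , C′ , k′≤ , old , new) = B C has in k′ , C′ , ℕₚ.≤-trans k′≤ (ℕₚ.+-monoˡ-≤ k n≤) , old , new

  build-let : Build Γ a Δ → Build (λ p → Γ p ⊎ Δ p) b Θ → Build Γ (b +ℕ a) Θ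
  build-let {a = a} {b = b} B B′ {k} C has =
    let (k₁ , C₁ , k₁≤ , old₁ , new₁) = B C has
        (k₂ , C₂ , k₂≤ , old₂ , new₂) = B′ C₁ [ (λ γ → old₁ (has γ)) , new₁ ]′
    in k₂ , C₂ , ℕₚ.≤-trans k₂≤ (ℕₚ.≤-trans (ℕₚ.+-monoʳ-≤ b k₁≤) (ℕₚ.≤-reflexive (≡.sym (ℕₚ.+-assoc b a k)))) , old₂ ∘ old₁ , new₂

  build-⊎ : Build Γ a Δ → Build Γ b Θ → Build Γ (b +ℕ a) (λ p → Δ p ⊎ Θ p)
  build-⊎ {a = a} {b = b} B B′ {k} C has =
    let (k₁ , C₁ , k₁≤ , old₁ , new₁) = B C has
        (k₂ , C₂ , k₂≤ , old₂ , new₂) = B′ C₁ (λ γ → old₁ (has γ))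
    in k₂ , C₂ , ℕₚ.≤-trans k₂≤ (ℕₚ.≤-trans (ℕₚ.+-monoʳ-≤ b k₁≤) (ℕₚ.≤-reflexive (≡.sym (ℕₚ.+-assoc b a k)))) , old₂ ∘ old₁ , [ old₂ ∘ new₁ , new₂ ]′

  build-weaken : (∀ {p} → Δ p → Γ p) → Build Δ n Θ → Build Γ n Θ
  build-weaken Δ⊆Γ B C has = B C (λ δ → has (Δ⊆Γ δ))

  build-binary : (_∙_ : Poly → Poly → Poly) (gate : ∀ {k} → Fin k → Fin k → Gate F O k) →
                 (∀ {k} (i j : Fin k) vs → gateVal F ⟦_⟧ (gate i j) vs ≡ lookup vs i ∙ lookup vs j) →
                 Build Γ a (_≡ p) → Build Γ b (_≡ q) → Build Γ (suc (b +ℕ a)) (_≡ (p ∙ q))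
  build-binary {a = a} {b = b} _∙_ gate correct B B′ {k} C has =
    let (k₁ , C₁ , k₁≤ , old₁ , new₁) = B C has
        (k₂ , C₂ , k₂≤ , old₂ , new₂) = B′ C₁ (λ γ → old₁ (has γ))
        (i , i≡) = old₂ (new₁ refl)
        (j , j≡) = new₂ refl
    in suc k₂ , C₂ ▷ gate i j
     , s≤s (ℕₚ.≤-trans k₂≤ (ℕₚ.≤-trans (ℕₚ.+-monoʳ-≤ b k₁≤) (ℕₚ.≤-reflexive (≡.sym (ℕₚ.+-assoc b a k)))))
     , (λ h → has-▷ (gate i j) (old₂ (old₁ h)))
     , λ { refl → zero , ≡.trans (correct i j _) (cong₂ _∙_ i≡ j≡) }

  build-⊕ : Build Γ a (_≡ p) → Build Γ b (_≡ q) → Build Γ (suc (b +ℕ a)) (_≡ (p ⊕ q))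
  build-⊕ = build-binary _⊕_ add λ _ _ _ → refl

  build-⊗ : Build Γ a (_≡ p) → Build Γ b (_≡ q) → Build Γ (suc (b +ℕ a)) (_≡ (p ⊗ q))
  build-⊗ = build-binary _⊗_ mul λ _ _ _ → refl

  ∏ : ∀ {X : Set} → List X → (X → Poly) → Poly
  ∏ []       f = cst K.1#
  ∏ (x ∷ xs) f = f x ⊗ ∏ xs f

  private
    one-more : ∀ n l → suc ((l *ℕ suc n +ℕ 1) +ℕ n) ≡ suc l *ℕ suc n +ℕ 1
    one-more n l = ≡.trans (≡.sym (ℕₚ.+-suc _ n)) (≡.trans (ℕₚ.+-comm (l *ℕ suc n +ℕ 1) (suc n)) (≡.sym (ℕₚ.+-assoc (suc n) (l *ℕ suc n) 1)))

  build-∑ : ∀ {X : Set} (xs : List X) {f : X → Poly} → (∀ x → Build Γ n (_≡ f x)) → Build Γ (length xs *ℕ suc n +ℕ 1) (_≡ ∑ xs f)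
  build-∑         []       B = build-cst K.0#
  build-∑ {n = n} (x ∷ xs) B = build-≤ (ℕₚ.≤-reflexive (one-more n (length xs))) (build-⊕ (B x) (build-∑ xs B))

  build-∏ : ∀ {X : Set} (xs : List X) {f : X → Poly} → (∀ x → Build Γ n (_≡ f x)) → Build Γ (length xs *ℕ suc n +ℕ 1) (_≡ ∏ xs f)
  build-∏         []       B = build-cst K.1#
  build-∏ {n = n} (x ∷ xs) B = build-≤ (ℕₚ.≤-reflexive (one-more n (length xs))) (build-⊗ (B x) (build-∏ xs B))

  build-family : ∀ {X : Set} (xs : List X) {f : X → Poly} → (∀ x → Build Γ n (_≡ f x)) →
                 Build Γ (length xs *ℕ n) (λ p → Σ[ x ∈ X ] (x ∈ xs × p ≡ f x))
  build-family []       B C has = _ , C , ℕₚ.≤-refl , id , λ { (_ , () , _) }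
  build-family {n = n} (x ∷ xs) B {k} C has =
    let (k₁ , C₁ , k₁≤ , old₁ , new₁) = B x C has
        (k₂ , C₂ , k₂≤ , old₂ , new₂) = build-family xs B C₁ (λ γ → old₁ (has γ))
    in k₂ , C₂
     , ℕₚ.≤-trans k₂≤ (ℕₚ.≤-trans (ℕₚ.+-monoʳ-≤ (length xs *ℕ n) k₁≤) (ℕₚ.≤-reflexive (≡.trans (≡.sym (ℕₚ.+-assoc (length xs *ℕ n) n k)) (cong (_+ℕ k) (ℕₚ.+-comm (length xs *ℕ n) n)))))
     , old₂ ∘ old₁
     , λ { (_ , here refl , refl) → old₂ (new₁ refl) ; (y , there y∈ , e) → new₂ (y , y∈ , e) }

  subst-ext : ∀ {σ τ : ℕ → Poly} → σ ≗ τ → ∀ p → subst F σ p ≡ subst F τ p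
  subst-ext h (var i) = h i
  subst-ext h (cst x) = refl
  subst-ext h (p ⊕ q) = cong₂ _⊕_ (subst-ext h p) (subst-ext h q)
  subst-ext h (p ⊗ q) = cong₂ _⊗_ (subst-ext h p) (subst-ext h q)

  -- Every wire already has a gate, so a wiring by wires becomes a wiring by gates and costs a
  -- single gate, whatever the number of variables.
  build-oracle : ∀ {W : Set} (wv : W → Poly) → (∀ w → Γ (wv w)) → ∀ o (ρ : ℕ → W) → Build Γ 1 (_≡ subst F (wv ∘ ρ) ⟦ o ⟧)
  build-oracle wv γ o ρ = build-gate λ C has →
    orc o (λ i → proj₁ (has (γ (ρ i)))) , subst-ext (λ i → proj₂ (has (γ (ρ i)))) ⟦ o ⟧

  -- The output is the last gate, so the wanted gate is copied there by adding 0.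
  build-circuit : Build (λ _ → Lift c ⊥) n (_≡ p) → Σ[ k ∈ ℕ ] (suc k ≤ suc (suc n) × Σ[ C ∈ Circuit F O (suc k) ] output F ⟦_⟧ C ≋ p)
  build-circuit {n = n} B =
    let (k , C , k≤ , _ , new) = B ∅ (λ ())
        (i , i≡) = new refl
    in suc k , s≤s (s≤s (ℕₚ.≤-trans k≤ (ℕₚ.≤-reflexive (ℕₚ.+-identityʳ n)))) , C ▷ con K.0# ▷ add (suc i) zero
     , P.trans (P.+-identityʳ _) (P.reflexive i≡)

-- The reduction

module Hardness {c ℓ} (F : CharZeroField c ℓ) where
  open Polynomials F
  open SymmetrizedDeterminant F using (invFactorial)
  open Gates F
  open PR

  blockSize : ℕ → ℕ
  blockSize n = suc n *ℕ n

  length-pairs : ∀ {X Y : Set} (xs : List X) (ys : List Y) → length (concatMap (λ x → map (x ,_) ys) xs) ≡ length xs *ℕ length ys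
  length-pairs []       ys = refl
  length-pairs (x ∷ xs) ys = ≡.trans (length-++ (map (x ,_) ys)) (cong₂ _+ℕ_ (length-map (x ,_) ys) (length-pairs xs ys))

  bits≡vecs : ∀ r → allBits F r ≡ vecs r (true ∷ false ∷ [])
  bits≡vecs zero    = refl
  bits≡vecs (suc r) = cong (λ bs → concatMap (λ x → map (x ∷ᵥ_) bs) (true ∷ false ∷ [])) (bits≡vecs r)

  factorial : ℕ → K.Carrier
  factorial n = ℕ→R commutativeRing (n !)

  factorial-cancel : ∀ n p q → q ≋ cst (invFactorial n) ⊗ p → p ≋ cst (factorial n) ⊗ q
  factorial-cancel n p q e = P.sym (begin
    cst (factorial n) ⊗ q                                ≈⟨ P.*-congˡ e ⟩
    cst (factorial n) ⊗ (cst (invFactorial n) ⊗ p)       ≈⟨ P.*-assoc _ _ _ ⟨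
    (cst (factorial n) ⊗ cst (invFactorial n)) ⊗ p       ≈⟨ P.*-congʳ (P.trans (P.sym (cst-* _ _)) (cst-cong (inv-correct _ _))) ⟩
    cst K.1# ⊗ p                                         ≈⟨ P.*-identityˡ p ⟩
    p                                                    ∎)

  -- The number `L` of slots of the parse automaton for `s` gates, degree `d` and `r` bits, so it
  -- bounds the index of the determinant that is queried.
  oracleBound : ℕ → ℕ → ℕ → ℕ
  oracleBound s d r = suc d *ℕ (s *ℕ suc d *ℕ (s *ℕ suc d)) *ℕ (d *ℕ (s *ℕ suc d) +ℕ r)

  oracleBound-mono : ∀ {s s′ d d′} r → s ≤ s′ → d ≤ d′ → oracleBound s d r ≤ oracleBound s′ d′ r
  oracleBound-mono r s≤ d≤ = ℕₚ.*-mono-≤ (ℕₚ.*-mono-≤ (s≤s d≤) (ℕₚ.*-mono-≤ b≤ b≤)) (ℕₚ.+-monoˡ-≤ r (ℕₚ.*-mono-≤ d≤ b≤))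
    where b≤ = ℕₚ.*-mono-≤ s≤ (s≤s d≤)

  -- The gate count of `total-build` together with the output gates: the wires, then for each degree
  -- `s * suc d` queries at 4 gates each, namely the factorial, the oracle, their product and an
  -- addition.
  sizeBound : ℕ → ℕ → ℕ
  sizeBound s d = suc (suc (suc (d *ℕ suc (s *ℕ suc d *ℕ 4 +ℕ 1) +ℕ 1 +ℕ 1) +ℕ (1 +ℕ 1 +ℕ s *ℕ 1 +ℕ s *ℕ 1)))

  sizeBound-mono : ∀ {s s′} d → s ≤ s′ → sizeBound s d ≤ sizeBound s′ d
  sizeBound-mono d s≤ = s≤s (s≤s (ℕₚ.+-mono-≤
    (s≤s (ℕₚ.+-monoˡ-≤ 1 (ℕₚ.+-monoˡ-≤ 1 (ℕₚ.*-monoʳ-≤ d (s≤s (ℕₚ.+-monoˡ-≤ 1 (ℕₚ.*-monoˡ-≤ 4 (ℕₚ.*-monoˡ-≤ (suc d) s≤))))))))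
    (ℕₚ.+-mono-≤ (ℕₚ.+-monoʳ-≤ 2 (ℕₚ.*-monoˡ-≤ 1 s≤)) (ℕₚ.*-monoˡ-≤ 1 s≤))))

  module _ (s′ r₀ : ℕ) (C : Circuit F ⊥ (suc s′)) where
    s : ℕ
    s = suc s′

    constantAt : Fin s → Poly
    constantAt i = cst (coeff F (lookup (values F (noOracle F) C) i) [])

    Wires : Poly → Set c
    Wires p = (Σ[ i ∈ Fin s ] (i ∈ allFin s × p ≡ leafValue r₀ (gateAt C i))) ⊎
              (Σ[ i ∈ Fin s ] (i ∈ allFin s × p ≡ constantAt i)) ⊎ (p ≡ cst K.0# ⊎ p ≡ cst K.1#)

    module _ {Q : ℕ} where
      Oracle : Set
      Oracle = Σ[ i ∈ TIdx F blockSize ] TSize F blockSize i ≤ Q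

      open Building F {Oracle} (λ o → TFam F blockSize (proj₁ o)) public

      build-leaf : ∀ {Γ} (g : Gate F ⊥ s) → Build Γ 1 (_≡ leafValue r₀ g)
      build-leaf (inp x) with x <? r₀
      ... | yes _ = build-cst K.1#
      ... | no _  = build-var (x ∸ r₀)
      build-leaf (con _)   = build-cst K.0#
      build-leaf (add _ _) = build-cst K.0#
      build-leaf (mul _ _) = build-cst K.0#

      build-wires : Build (λ _ → Lift c ⊥) (1 +ℕ 1 +ℕ s *ℕ 1 +ℕ s *ℕ 1) Wires
      build-wires = build-≤ (ℕₚ.≤-reflexive (cong (λ l → 1 +ℕ 1 +ℕ l *ℕ 1 +ℕ l *ℕ 1) (length-tabulate {n = s} id)))
        (build-⊎ (build-family (allFin s) (λ i → build-leaf (gateAt C i))) (build-⊎ (build-family (allFin s) (λ i → build-cst _)) (build-⊎ (build-cst K.0#) (build-cst K.1#))))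

      module _ (D′ : ℕ) (Q≥ : oracleBound s (suc D′) r₀ ≤ Q) where
        open ParseTrees F s′ D′ C using (Node; nodes; D; component)
        open ParseAutomaton F s′ D′ r₀ C

        wire : ∀ w → Wires (wireValue w)
        wire zeroW      = inj₂ (inj₂ (inj₁ refl))
        wire oneW       = inj₂ (inj₂ (inj₂ refl))
        wire (leaf i)   = inj₁ (i , ∈-allFin i , refl)
        wire (scalar i) = inj₂ (inj₁ (i , ∈-allFin i , refl))

        runs : Node → Poly
        runs w = ∑ (vecs r bools) (λ e → runFrom e R (encode ((zero , zero , fromℕ D) , w)))

        -- A run begins in a single state, which already contains a guess, so each initial guess `w`
        -- needs its own oracle gate.
        query : ∀ w → Σ[ p ∈ Poly ] (Build Wires 3 (_≡ p) × runs w ≋ p)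
        query w =
          let (k , l , ρ , e) = automaton-oracle wireValue zeroW oneW P.refl P.refl weightAt testAt moves (encode ((zero , zero , fromℕ D) , w)) finalState
          in cst (factorial L) ⊗ subst F (wireValue ∘ ρ) (sdetM F L (blockSize L) k l)
           , build-⊗ (build-cst (factorial L)) (build-oracle wireValue wire ((L , k , l) , Q≥) ρ)
           , factorial-cancel L (runs w) _ e

        componentSum : Poly
        componentSum = ∑ nodes (λ w → proj₁ (query w))

        build-componentSum : Build Wires (s *ℕ suc D *ℕ 4 +ℕ 1) (_≡ componentSum)
        build-componentSum = build-≤ (ℕₚ.≤-reflexive (cong (λ l → l *ℕ 4 +ℕ 1)
            (≡.trans (length-pairs (allFin s) (allFin (suc D))) (cong₂ _*ℕ_ (length-tabulate {n = s} id) (length-tabulate {n = suc D} id)))))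
          (build-∑ nodes (λ w → proj₁ (proj₂ (query w))))

        componentSum-correct : ∑ (vecs r₀ bools) (λ e → component (plugBits F r₀ e) zero D) ≋ componentSum
        componentSum-correct = P.trans (component-runs zero) (∑-cong nodes λ w → proj₂ (proj₂ (query w)))

  hard : ∀ f → InVNP F ℕ (λ n → n) f → CReduces F f (TIdx F blockSize) (TSize F blockSize) (TFam F blockSize)
  hard f (g , (s , v , d , ps , pv , pd , circuits) , r , pr , f≃) =
    (λ n → sizeBound (s n) (d n)) , (λ n → oracleBound (s n) (d n) (r n)) , psize , poracle , reduction
    where
    pb : PolyBounded (λ n → s n *ℕ suc (d n))
    pb = PolyBounded-* ps (PolyBounded-+ (PolyBounded-const 1) pd)
    poracle : PolyBounded (λ n → oracleBound (s n) (d n) (r n))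
    poracle = PolyBounded-* (PolyBounded-* (PolyBounded-+ (PolyBounded-const 1) pd) (PolyBounded-* pb pb)) (PolyBounded-+ (PolyBounded-* pd pb) pr)
    psize : PolyBounded (λ n → sizeBound (s n) (d n))
    psize = PolyBounded-+ (PolyBounded-const 3) (PolyBounded-+
      (PolyBounded-+ (PolyBounded-+ (PolyBounded-* pd (PolyBounded-+ (PolyBounded-const 1) (PolyBounded-+ (PolyBounded-* pb (PolyBounded-const 4)) (PolyBounded-const 1)))) (PolyBounded-const 1)) (PolyBounded-const 1))
      (PolyBounded-+ (PolyBounded-+ (PolyBounded-const 2) (PolyBounded-* ps (PolyBounded-const 1))) (PolyBounded-* ps (PolyBounded-const 1))))
    reduction : ∀ n → Σ[ k ∈ ℕ ] (suc k ≤ sizeBound (s n) (d n) × Σ[ C ∈ Circuit F (Σ[ i ∈ TIdx F blockSize ] TSize F blockSize i ≤ oracleBound (s n) (d n) (r n)) (suc k) ]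
                  _≃_ F (output F (λ o → TFam F blockSize (proj₁ o)) C) (f n))
    reduction n with circuits n
    ... | g-vars , g-deg , k , k< , C , C≃g =
      let (k′ , k′< , C′ , C′≋) = build-circuit s′ r₀ C total-build
      in k′ , ℕₚ.≤-trans k′< (sizeBound-mono (d n) k<) , C′ , at (P.trans C′≋ (P.sym f≋))
      where
      s′ r₀ : ℕ
      s′ = k
      r₀ = r n
      bits = vecs r₀ (true ∷ false ∷ [])
      Q≥ : ∀ (j : Fin (d n)) → oracleBound (suc s′) (suc (toℕ j)) r₀ ≤ oracleBound (s n) (d n) r₀
      Q≥ j = oracleBound-mono r₀ k< (toℕ<n j)
      -- The sum has exponentially many terms, but its value is one field element and so costs one
      -- constant gate.
      constant : K.Carrier
      constant = SK.∑ bits (λ _ → coeff F (output F (noOracle F) C) [])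
      parts : Fin (d n) → Poly
      parts j = componentSum s′ r₀ C (toℕ j) (Q≥ j)
      total-build : Building.Build F (λ o → TFam F blockSize (proj₁ o)) (λ _ → Lift c ⊥) _ (_≡ (cst constant ⊕ ∑ (allFin (d n)) parts))
      total-build = build-let s′ r₀ C (build-wires s′ r₀ C) (build-weaken s′ r₀ C inj₂ (build-⊕ s′ r₀ C (build-cst s′ r₀ C constant)
        (build-≤ s′ r₀ C (ℕₚ.≤-reflexive (cong (λ l → l *ℕ suc (suc s′ *ℕ suc (d n) *ℕ 4 +ℕ 1) +ℕ 1) (length-tabulate {n = d n} id)))
          (build-∑ s′ r₀ C (allFin (d n)) (λ j → build-≤ s′ r₀ C (ℕₚ.+-monoˡ-≤ 1 (ℕₚ.*-monoˡ-≤ 4 (ℕₚ.*-monoʳ-≤ (suc s′) (s≤s (toℕ<n j))))) (build-componentSum s′ r₀ C (toℕ j) (Q≥ j)))))))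
      p : Poly
      p = output F (noOracle F) C
      f≋ : f n ≋ cst constant ⊕ ∑ (allFin (d n)) parts
      f≋ = begin
        f n
          ≈⟨ coeffs (f≃ n) ⟩
        sumP F (map (λ e → subst F (plugBits F r₀ e) (g n)) (allBits F r₀))
          ≡⟨ ≡.trans (sumP-map (allBits F r₀) _) (cong (λ bs → ∑ bs (λ e → subst F (plugBits F r₀ e) (g n))) (bits≡vecs r₀)) ⟩
        ∑ bits (λ e → subst F (plugBits F r₀ e) (g n))
          -- Degree 0 is split off because a parse tree needs at least one leaf.
          ≈⟨ ∑-cong bits (λ e → P.trans (subst-homogeneous (plugBits F r₀ e) (d n) p (g n) C≃g g-deg) (P.reflexive (∑-suc (d n) (λ j → homogeneous (plugBits F r₀ e) (toℕ j) p)))) ⟩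
        ∑ bits (λ e → homogeneous (plugBits F r₀ e) 0 p ⊕ ∑ (allFin (d n)) (λ j → homogeneous (plugBits F r₀ e) (suc (toℕ j)) p))
          ≈⟨ P.trans (∑-+ bits _ _) (P.+-congˡ (∑-swap bits (allFin (d n)) _)) ⟩
        ∑ bits (λ e → homogeneous (plugBits F r₀ e) 0 p) ⊕ ∑ (allFin (d n)) (λ j → ∑ bits (λ e → homogeneous (plugBits F r₀ e) (suc (toℕ j)) p))
          ≈⟨ P.+-cong (P.trans (∑-cong bits λ e → ParseTrees.component-0 F s′ 0 C (plugBits F r₀ e) zero) (P.sym (cst-∑ bits _)))
                      (∑-cong (allFin (d n)) λ j → componentSum-correct s′ r₀ C (toℕ j) (Q≥ j)) ⟩
        cst constant ⊕ ∑ (allFin (d n)) parts ∎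

-- Membership of the determinant family

module Membership {c ℓ} (F : CharZeroField c ℓ) where
  open Polynomials F
  open SymmetrizedDeterminant F
  open Building F (noOracle F)
  open Hardness F using (blockSize; bits≡vecs)
  open PR

  conv-vanishes : ∀ (f g : Series) w → (∀ u v → u ++ v ≡ w → f u K.≈ K.0# ⊎ g v K.≈ K.0#) → conv f g w K.≈ K.0#
  conv-vanishes f g w h = go f w λ u v e → h u v e
    where
    product-zero : ∀ {x y} → x K.≈ K.0# ⊎ y K.≈ K.0# → x K.* y K.≈ K.0#
    product-zero (inj₁ x≈0) = K.trans (K.*-congʳ x≈0) (K.zeroˡ _)
    product-zero (inj₂ y≈0) = K.trans (K.*-congˡ y≈0) (K.zeroʳ _)
    go : ∀ f w → (∀ u v → u ++ v ≡ w → f u K.≈ K.0# ⊎ g v K.≈ K.0#) → conv f g w K.≈ K.0#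
    go f []      h = product-zero (h [] [] refl)
    go f (x ∷ w) h = K.trans (K.+-cong (product-zero (h [] (x ∷ w) refl)) (go (f ∘ (x ∷_)) w λ u v e → h (x ∷ u) v (cong (x ∷_) e))) (K.+-identityˡ _)

  -- Bounds on variables and degree

  record Bounded (v d : ℕ) (p : Poly) : Set ℓ where
    constructor bounded
    field
      varsBelow : VarsBelow F v p
      degLe     : DegLe F d p

  open Bounded

  bounded-var : ∀ {v i} → i < v → Bounded v 1 (var i)
  bounded-var {v} {i} i<v = bounded vars deg
    where
    vars : VarsBelow F v (var i)
    vars []          ()
    vars (j ∷ [])    e with i ≡ᵇ j in eq
    ... | false = K.refl
    ... | true  with () ← ≡.trans (≡.sym e) (cong (_∧ true) (≡.trans (cong (_<ᵇ v) (≡.sym (ℕₚ.≡ᵇ⇒≡ i j (≡.subst T (≡.sym eq) tt)))) (dec-true (i <? v) i<v)))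
    vars (_ ∷ _ ∷ _) e = K.refl
    deg : DegLe F 1 (var i)
    deg (_ ∷ _ ∷ _) _ = K.refl
    deg (_ ∷ [])    (s≤s ())

  bounded-cst : ∀ {v} a → Bounded v 0 (cst a)
  bounded-cst a = bounded (λ { (_ ∷ _) _ → K.refl }) (λ { (_ ∷ _) _ → K.refl })

  bounded-≤ : ∀ {v d d′ p} → d ≤ d′ → Bounded v d p → Bounded v d′ p
  bounded-≤ d≤ (bounded vars deg) = bounded vars λ w d′< → deg w (ℕₚ.≤-<-trans d≤ d′<)

  bounded-⊕ : ∀ {v d p q} → Bounded v d p → Bounded v d q → Bounded v d (p ⊕ q)
  bounded-⊕ (bounded vars deg) (bounded vars′ deg′) = bounded
    (λ w e → K.trans (K.+-cong (vars w e) (vars′ w e)) (K.+-identityˡ _)) (λ w e → K.trans (K.+-cong (deg w e) (deg′ w e)) (K.+-identityˡ _))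

  bounded-⊗ : ∀ {v d d′ p q} → Bounded v d p → Bounded v d′ q → Bounded v (d +ℕ d′) (p ⊗ q)
  bounded-⊗ {v} {d} {d′} {p} {q} (bounded vars deg) (bounded vars′ deg′) = bounded
    (λ w e → K.trans (coeff-⊗ p q w) (conv-vanishes _ _ w λ { u u′ refl → [ inj₁ ∘ vars u , inj₂ ∘ vars′ u′ ]′ (all-++ u u′ e) }))
    (λ w e → K.trans (coeff-⊗ p q w) (conv-vanishes _ _ w λ { u u′ refl → [ inj₁ ∘ deg u , inj₂ ∘ deg′ u′ ]′ (long u u′ e) }))
    where
    all-++ : ∀ u u′ → all (λ i → i <ᵇ v) (u ++ u′) ≡ false → all (λ i → i <ᵇ v) u ≡ false ⊎ all (λ i → i <ᵇ v) u′ ≡ false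
    all-++ []      u′ e = inj₂ e
    all-++ (i ∷ u) u′ e with i <ᵇ v
    ... | false = inj₁ refl
    ... | true  = all-++ u u′ e
    long : ∀ u u′ → d +ℕ d′ < length (u ++ u′) → d < length u ⊎ d′ < length u′
    long u u′ e with d <? length u
    ... | yes d< = inj₁ d<
    ... | no d≮  = inj₂ (ℕₚ.+-cancelˡ-< d d′ (length u′) (ℕₚ.≤-trans e (ℕₚ.≤-trans (ℕₚ.≤-reflexive (length-++ u)) (ℕₚ.+-monoˡ-≤ (length u′) (ℕₚ.≮⇒≥ d≮)))))

  bounded-∑ : ∀ {v d} {X : Set} (xs : List X) {f : X → Poly} → (∀ x → Bounded v d (f x)) → Bounded v d (∑ xs f)
  bounded-∑ []       h = bounded-≤ z≤n (bounded-cst K.0#)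
  bounded-∑ (x ∷ xs) h = bounded-⊕ (h x) (bounded-∑ xs h)

  bounded-∏ : ∀ {v d} {X : Set} (xs : List X) {f : X → Poly} → (∀ x → Bounded v d (f x)) → Bounded v (length xs *ℕ d) (∏ xs f)
  bounded-∏ []       h = bounded-cst K.1#
  bounded-∏ (x ∷ xs) h = bounded-⊗ (h x) (bounded-∏ xs h)

  bounded-mprod : ∀ {v d m n} (M : Fin n → Matrix (Fin m)) → (∀ t a b → Bounded v d (M t a b)) → ∀ a b → Bounded v (n *ℕ d) (mprod (FinF m) (List.tabulate M) a b)
  bounded-mprod {n = zero}  M h a b with does (a ≟F b)
  ... | true  = bounded-cst K.1#
  ... | false = bounded-cst K.0#
  bounded-mprod {m = m} {n = suc n} M h a b = bounded-∑ (allFin m) λ z → bounded-⊗ (h zero a z) (bounded-mprod (M ∘ suc) (h ∘ suc) z b)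

  module _ {Γ : Poly → Set c} where
    build-∑Fin : ∀ {a} n {f : Fin n → Poly} → (∀ i → Build Γ a (_≡ f i)) → Build Γ (n *ℕ suc a +ℕ 1) (_≡ ∑ (allFin n) f)
    build-∑Fin {a} n B = build-≤ (ℕₚ.≤-reflexive (cong (λ l → l *ℕ suc a +ℕ 1) (length-tabulate {n = n} id))) (build-∑ (allFin n) B)

    -- Each entry of the remaining product is used by all `m` entries of the new column. Keeping the
    -- whole column as gates lets them share it, whereas the written-out expression grows
    -- exponentially with `n`.
    build-column : ∀ {m n a} (M : Fin n → Matrix (Fin m)) → (∀ t x y → Build Γ a (_≡ M t x y)) → ∀ y →
                   Build Γ (n *ℕ (m *ℕ (m *ℕ suc (suc a) +ℕ 1)) +ℕ m *ℕ 1) (λ p → Σ[ x ∈ Fin m ] (x ∈ allFin m × p ≡ mprod (FinF m) (List.tabulate M) x y))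
    build-column {m} {zero} M B y = build-≤ (ℕₚ.≤-reflexive (cong (_*ℕ 1) (length-tabulate {n = m} id)))
      (build-family (allFin m) λ x → build-≤ ℕₚ.≤-refl (build-▸ (does (x ≟F y))))
      where
      build-▸ : ∀ b → Build Γ 1 (_≡ b ▸ cst K.1#)
      build-▸ true  = build-cst K.1#
      build-▸ false = build-cst K.0#
    build-column {m} {suc n} {a} M B y = build-≤
      (ℕₚ.≤-reflexive (≡.trans (cong (λ l → l *ℕ (m *ℕ suc (suc a) +ℕ 1) +ℕ (n *ℕ (m *ℕ (m *ℕ suc (suc a) +ℕ 1)) +ℕ m *ℕ 1)) (length-tabulate {n = m} id))
        (≡.sym (ℕₚ.+-assoc (m *ℕ (m *ℕ suc (suc a) +ℕ 1)) _ _))))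
      (build-let (build-column (M ∘ suc) (B ∘ suc) y)
        (build-family (allFin m) λ x → build-≤ (ℕₚ.≤-reflexive (cong (λ l → l *ℕ suc (suc a) +ℕ 1) (length-tabulate {n = m} id)))
          (build-∑ (allFin m) λ z → build-⊗ (build-weaken inj₁ (B zero x z)) (build-have (inj₂ (z , ∈-allFin z , refl))))))

  subst-∏ : ∀ σ {X : Set} (xs : List X) (f : X → Poly) → subst F σ (∏ xs f) ≡ ∏ xs (subst F σ ∘ f)
  subst-∏ σ []       f = refl
  subst-∏ σ (x ∷ xs) f = cong (subst F σ (f x) ⊗_) (subst-∏ σ xs f)

  ∏-cong : ∀ {X : Set} (xs : List X) {f g : X → Poly} → (∀ x → f x ≋ g x) → ∏ xs f ≋ ∏ xs g
  ∏-cong []       h = P.refl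
  ∏-cong (x ∷ xs) h = P.*-cong (h x) (∏-cong xs h)

  ∏-tests : ∀ {n} {X : Set} (g : Fin n → X) (t : X → Bool) → ∏ (List.tabulate g) (λ x → t x ▸ cst K.1#) ≋ allᵇ (t ∘ g) ▸ cst K.1#
  ∏-tests {zero}  g t = P.refl
  ∏-tests {suc n} g t = P.trans (P.*-congˡ (∏-tests (g ∘ suc) t))
    (P.trans (▸-* (t (g zero)) (allᵇ (t ∘ g ∘ suc)) _ _) (▸-cong (t (g zero) ∧ allᵇ (t ∘ g ∘ suc)) (P.*-identityˡ _)))

  subst-mprod : ∀ σ {m n} (M : Fin n → Matrix (Fin m)) a b →
                subst F σ (mprod (FinF m) (List.tabulate M) a b) ≋ mprod (FinF m) (List.tabulate (λ t a b → subst F σ (M t a b))) a b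
  subst-mprod σ {n = zero}  M a b with does (a ≟F b)
  ... | true  = P.refl
  ... | false = P.refl
  subst-mprod σ {m} {suc n} M a b = P.trans (P.reflexive (subst-∑ σ (allFin m) _)) (∑-cong (allFin m) λ z → P.*-congˡ (subst-mprod σ (M ∘ suc) z b))

  -- The value 0 for equal arguments makes the product over all pairs test injectivity along with
  -- computing the sign.
  orientation : ∀ {n} → Fin n → Fin n → K.Carrier
  orientation i j = if ⌊ i ≟F j ⌋ then K.0# else if does (toℕ j <? toℕ i) then K.- K.1# else K.1#

  ∏-orientation : ∀ {n} (σ : Fin n → Fin n) →
                  ∏ (pairs F n) (λ tt′ → cst (orientation (σ (proj₁ tt′)) (σ (proj₂ tt′)))) ≋ isInjective F σ ▸ cst (sgn F σ)
  ∏-orientation {n} σ = go (pairs F n)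
    where
    sign : ℕ → K.Carrier
    sign k = if isEven F k then K.1# else K.- K.1#
    inversionsIn : List (Fin n × Fin n) → ℕ
    inversionsIn ps = length (filter (λ ij → toℕ (σ (proj₂ ij)) <? toℕ (σ (proj₁ ij))) ps)
    sign-suc : ∀ k → sign (suc k) K.≈ K.- K.1# K.* sign k
    sign-suc zero          = K.sym (K.*-identityʳ _)
    sign-suc (suc zero)    = K.sym (K.trans (-1*x≈-x (K.- K.1#)) (-‿involutive K.1#))
    sign-suc (suc (suc k)) = sign-suc k
    go : ∀ ps → ∏ ps (λ tt′ → cst (orientation (σ (proj₁ tt′)) (σ (proj₂ tt′)))) ≋
                and (map (λ ij → if ⌊ σ (proj₁ ij) ≟F σ (proj₂ ij) ⌋ then false else true) ps) ▸
                cst (sign (inversionsIn ps))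
    go [] = P.refl
    go ((i , j) ∷ ps) with ⌊ σ i ≟F σ j ⌋
    ... | true  = P.zeroˡ _
    ... | false with does (toℕ (σ j) <? toℕ (σ i))
    ... | true  = P.trans (P.*-congˡ (go ps)) (P.trans (▸-*ʳ A _ _) (▸-cong A (P.trans (P.sym (cst-* _ _)) (cst-cong (K.sym (sign-suc (inversionsIn ps)))))))
      where A = and (map (λ ij → if ⌊ σ (proj₁ ij) ≟F σ (proj₂ ij) ⌋ then false else true) ps)
    ... | false = P.trans (P.*-congˡ (go ps)) (P.*-identityˡ _)

  plug-bit : ∀ r (e : Vec Bool r) (J : Fin r) → plugBits F r e (toℕ J) ≋ lookup e J ▸ cst K.1#
  plug-bit r e J with toℕ J <? r
  ... | no J≮  = ⊥-elim (J≮ (toℕ<n J))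
  ... | yes J< rewrite fromℕ<-toℕ J J< with lookup e J
  ... | true  = P.refl
  ... | false = P.refl

  plug-var : ∀ r (e : Vec Bool r) x → plugBits F r e (r +ℕ x) ≡ var x
  plug-var r e x with r +ℕ x <? r
  ... | yes p = ⊥-elim (ℕₚ.m+n≮m r x p)
  ... | no  _ = cong var (ℕₚ.m+n∸m≡n r x)

  -- The determinant as a sum over bits

  -- The permutations σ and τ are given by two n × n matrices of bits whose row t should be the unit vector at σ t, respectively τ t.
  module _ (n : ℕ) where
    private
      m r : ℕ
      m = blockSize n
      r = n *ℕ n +ℕ n *ℕ n

    rowBit : Bool → Fin n → Fin n → Fin r
    rowBit true  t i = combine t i ↑ˡ (n *ℕ n)
    rowBit false t i = (n *ℕ n) ↑ʳ combine t i

    literal : Bool → Poly → Poly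
    literal true  p = p
    literal false p = cst K.1# ⊕ cst (K.- K.1#) ⊗ p

    -- Tests the entire row: the bit at `i` must be 1 and all others 0. A row that is no unit vector
    -- is therefore rejected for every `i`.
    select : Bool → Fin n → Fin n → Poly
    select side t i = ∏ (allFin n) (λ l → literal (does (l ≟F i)) (var (toℕ (rowBit side t l))))

    -- A table lookup: if both rows are unit vectors, exactly one summand is nonzero, and it is the
    -- orientation of the two values.
    pairSign : Bool → Fin n × Fin n → Poly
    pairSign side (t , t′) = ∑ (allFin n) (λ i → ∑ (allFin n) (λ i′ → cst (orientation i i′) ⊗ (select side t i ⊗ select side t′ i′)))

    signOf : Bool → Poly
    signOf side = ∏ (pairs F n) (pairSign side)

    factorAt : Fin n → Matrix (Fin m)
    factorAt t a b = ∑ (allFin n) (λ i → ∑ (allFin n) (λ j → (select true t i ⊗ select false t j) ⊗ var (r +ℕ yIdx F n m i j a b)))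

    summand : Fin m → Fin m → Poly
    summand k l = cst (invFactorial n) ⊗ ((signOf true ⊗ signOf false) ⊗ mprod (FinF m) (List.tabulate factorAt) k l)

    hits : (Fin n → Bool) → Fin n → Bool
    hits row i = allᵇ (λ l → does (row l ≟B does (l ≟F i)))

    -- Two unit vectors equal to the same row are equal to each other, so the sums over `i` in
    -- `pairSign` reduce to one term.
    hits-unique : ∀ row i j → hits row i ≡ true → hits row j ≡ does (j ≟F i)
    hits-unique row i j hi = Bool-⇔
      (λ hj → dec-true (j ≟F i) (does⇒ (j ≟F i) (≡.trans (≡.sym (agree hi j)) (≡.trans (agree hj j) (dec-true (j ≟F j) refl)))))
      (λ e → ≡.trans (cong (hits row) (does⇒ (j ≟F i) e)) hi)
      where
      agree : ∀ {i} → hits row i ≡ true → ∀ l → row l ≡ does (l ≟F i)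
      agree {i} h l = does⇒ (row l ≟B does (l ≟F i)) (allᵇ⇒ {t = λ l → does (row l ≟B does (l ≟F i))} h l)

    module _ (e : Vec Bool r) where
      private
        σ : ℕ → Poly
        σ = plugBits F r e

      row : Bool → Fin n → Fin n → Bool
      row side t i = lookup e (rowBit side t i)

      hit : Bool → Fin n → Fin n → Bool
      hit side t = hits (row side t)

      subst-literal : ∀ b J → subst F σ (literal b (var (toℕ J))) ≋ does (lookup e J ≟B b) ▸ cst K.1#
      subst-literal true  J = P.trans (plug-bit r e J) (by-bit (lookup e J))
        where
        by-bit : ∀ x → x ▸ cst K.1# ≋ does (x ≟B true) ▸ cst K.1#
        by-bit true  = P.refl
        by-bit false = P.refl
      subst-literal false J = P.trans (P.+-congˡ (P.*-congˡ (plug-bit r e J))) (by-bit (lookup e J))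
        where
        by-bit : ∀ x → cst K.1# ⊕ cst (K.- K.1#) ⊗ (x ▸ cst K.1#) ≋ does (x ≟B false) ▸ cst K.1#
        by-bit true  = P.trans (P.+-congˡ (P.*-identityʳ _)) (P.trans (P.sym (cst-+ _ _)) (cst-cong (K.-‿inverseʳ K.1#)))
        by-bit false = P.trans (P.+-congˡ (P.zeroʳ _)) (P.+-identityʳ _)

      subst-select : ∀ side t i → subst F σ (select side t i) ≋ hit side t i ▸ cst K.1#
      subst-select side t i = P.trans (P.reflexive (subst-∏ σ (allFin n) _)) (P.trans
        (∏-cong (allFin n) λ l → subst-literal (does (l ≟F i)) (rowBit side t l))
        (∏-tests id (λ l → does (row side t l ≟B does (l ≟F i)))))

      subst-pairSign : ∀ side t t′ i i′ → hit side t i ≡ true → hit side t′ i′ ≡ true → subst F σ (pairSign side (t , t′)) ≋ cst (orientation i i′)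
      subst-pairSign side t t′ i i′ h h′ = begin
        subst F σ (pairSign side (t , t′))
          ≈⟨ P.trans (P.reflexive (subst-∑ σ (allFin n) _)) (∑-cong (allFin n) λ j → P.reflexive (subst-∑ σ (allFin n) _)) ⟩
        ∑ (allFin n) (λ j → ∑ (allFin n) (λ j′ → cst (orientation j j′) ⊗ (subst F σ (select side t j) ⊗ subst F σ (select side t′ j′))))
          ≈⟨ ∑-cong (allFin n) (λ j → ∑-cong (allFin n) λ j′ → P.trans
               (P.*-congˡ (P.trans (P.*-cong (subst-select side t j) (subst-select side t′ j′)) (P.trans (▸-* (hit side t j) (hit side t′ j′) _ _)
                 (P.trans (▸-congᵇ _ (cong₂ _∧_ (hits-unique (row side t) i j h) (hits-unique (row side t′) i′ j′ h′))) (▸-cong (does (j ≟F i) ∧ does (j′ ≟F i′)) (P.*-identityˡ _))))))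
               (P.trans (▸-*ʳ (does (j ≟F i) ∧ does (j′ ≟F i′)) _ _) (P.trans (▸-cong (does (j ≟F i) ∧ does (j′ ≟F i′)) (P.*-identityʳ _)) (▸-∧ (does (j ≟F i)) (does (j′ ≟F i′)) _)))) ⟩
        ∑ (allFin n) (λ j → ∑ (allFin n) (λ j′ → does (j ≟F i) ▸ does (j′ ≟F i′) ▸ cst (orientation j j′)))
          ≈⟨ ∑-cong (allFin n) (λ j → P.trans (P.sym (▸-∑ (does (j ≟F i)) (allFin n) _)) (▸-cong (does (j ≟F i)) (Delta-Fin n i′ λ j′ → cst (orientation j j′)))) ⟩
        ∑ (allFin n) (λ j → does (j ≟F i) ▸ cst (orientation j i′))
          ≈⟨ Delta-Fin n i (λ j → cst (orientation j i′)) ⟩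
        cst (orientation i i′) ∎

      subst-signOf : ∀ side (s : Fin n → Fin n) → (∀ t → hit side t (s t) ≡ true) → subst F σ (signOf side) ≋ isInjective F s ▸ cst (sgn F s)
      subst-signOf side s h = P.trans (P.reflexive (subst-∏ σ (pairs F n) _)) (P.trans
        (∏-cong (pairs F n) λ (t , t′) → subst-pairSign side t t′ (s t) (s t′) (h t) (h t′)) (∏-orientation s))

    Choice : Finite (Fin n × Fin n)
    Choice = FinF n ×F FinF n

    choices : List (Vec (Fin n × Fin n) n)
    choices = vecs n (elements Choice)

    left right : Vec (Fin n × Fin n) n → Fin n → Fin n
    left  v t = proj₁ (lookup v t)
    right v t = proj₂ (lookup v t)

    matches : Vec Bool r → Vec (Fin n × Fin n) n → Bool
    matches e v = allᵇ (λ t → hit e true t (left v t) ∧ hit e false t (right v t))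

    monomialOf : Fin m → Fin m → Vec (Fin n × Fin n) n → Poly
    monomialOf k l v = mprod (FinF m) (List.tabulate (λ t a b → var (yIdx F n m (left v t) (right v t) a b))) k l

    subst-product : ∀ e k l → subst F (plugBits F r e) (mprod (FinF m) (List.tabulate factorAt) k l) ≋ ∑ choices (λ v → matches e v ▸ monomialOf k l v)
    subst-product e k l = P.trans (subst-mprod (plugBits F r e) factorAt k l)
      (mprod-expand (FinF m) (elements Choice) (λ t ij → hit e true t (proj₁ ij) ∧ hit e false t (proj₂ ij)) (λ t ij a b → var (yIdx F n m (proj₁ ij) (proj₂ ij) a b)) _ expand k l)
      where
      expand : ∀ t a b → subst F (plugBits F r e) (factorAt t a b) ≋
               ∑ (elements Choice) (λ ij → (hit e true t (proj₁ ij) ∧ hit e false t (proj₂ ij)) ▸ var (yIdx F n m (proj₁ ij) (proj₂ ij) a b))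
      expand t a b = begin
        subst F (plugBits F r e) (factorAt t a b)
          ≈⟨ P.trans (P.reflexive (subst-∑ (plugBits F r e) (allFin n) _)) (∑-cong (allFin n) λ i → P.reflexive (subst-∑ (plugBits F r e) (allFin n) _)) ⟩
        _ ≈⟨ ∑-cong (allFin n) (λ i → ∑-cong (allFin n) λ j → P.trans
               (P.*-cong (P.trans (P.*-cong (subst-select e true t i) (subst-select e false t j)) (▸-* (hit e true t i) (hit e false t j) _ _)) (P.reflexive (plug-var r e _)))
               (P.trans (▸-*ˡ (hit e true t i ∧ hit e false t j) _ _) (▸-cong (hit e true t i ∧ hit e false t j) (P.trans (P.*-congʳ (P.*-identityˡ _)) (P.*-identityˡ _))))) ⟩
        ∑ (allFin n) (λ i → ∑ (allFin n) (λ j → (hit e true t i ∧ hit e false t j) ▸ var (yIdx F n m i j a b)))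
          ≈⟨ ∑-cartesian _,_ (allFin n) (allFin n) _ ⟨
        ∑ (elements Choice) (λ ij → (hit e true t (proj₁ ij) ∧ hit e false t (proj₂ ij)) ▸ var (yIdx F n m (proj₁ ij) (proj₂ ij) a b)) ∎

    contribution : Fin m → Fin m → Vec (Fin n × Fin n) n → Poly
    contribution k l v = isInjective F (left v) ▸ isInjective F (right v) ▸ (cst (sgn F (left v) K.* sgn F (right v)) ⊗ monomialOf k l v)

    -- The signs have a known value only if all rows are unit vectors. That is enough: every term of
    -- the expanded matrix product carries the guard `matches e v`, under which `▸-cong′` evaluates
    -- them.
    subst-summand : ∀ e k l → subst F (plugBits F r e) (summand k l) ≋ cst (invFactorial n) ⊗ ∑ choices (λ v → matches e v ▸ contribution k l v)
    subst-summand e k l = P.*-congˡ (begin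
      signs ⊗ subst F σ (mprod (FinF m) (List.tabulate factorAt) k l)
        ≈⟨ P.trans (P.*-congˡ (subst-product e k l)) (∑-*ˡ choices _ _) ⟩
      ∑ choices (λ v → signs ⊗ (matches e v ▸ monomialOf k l v))
        ≈⟨ ∑-cong choices (λ v → P.trans (▸-*ʳ (matches e v) _ _) (▸-cong′ (matches e v) (signed v))) ⟩
      ∑ choices (λ v → matches e v ▸ contribution k l v) ∎)
      where
      σ = plugBits F r e
      signs : Poly
      signs = subst F σ (signOf true) ⊗ subst F σ (signOf false)
      signed : ∀ v → matches e v ≡ true → signs ⊗ monomialOf k l v ≋ contribution k l v
      signed v h = begin
        signs ⊗ monomialOf k l v
          ≈⟨ P.*-congʳ (P.trans (P.*-cong (subst-signOf e true (left v) (∧-⇒ˡ ∘ both)) (subst-signOf e false (right v) (λ t → ∧-⇒ʳ {hit e true t (left v t)} (both t))))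
               (▸-* (isInjective F (left v)) (isInjective F (right v)) _ _)) ⟩
        ((isInjective F (left v) ∧ isInjective F (right v)) ▸ (cst (sgn F (left v)) ⊗ cst (sgn F (right v)))) ⊗ monomialOf k l v
          ≈⟨ ▸-*ˡ (isInjective F (left v) ∧ isInjective F (right v)) _ _ ⟩
        (isInjective F (left v) ∧ isInjective F (right v)) ▸ ((cst (sgn F (left v)) ⊗ cst (sgn F (right v))) ⊗ monomialOf k l v)
          ≈⟨ P.trans (▸-cong (isInjective F (left v) ∧ isInjective F (right v)) (P.*-congʳ (P.sym (cst-* _ _)))) (▸-∧ (isInjective F (left v)) (isInjective F (right v)) _) ⟩
        contribution k l v ∎
        where
        both : ∀ t → hit e true t (left v t) ∧ hit e false t (right v t) ≡ true
        both = allᵇ⇒ {t = λ t → hit e true t (left v t) ∧ hit e false t (right v t)} h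

    unitBit : Vec (Fin n × Fin n) n → Fin (n *ℕ n) ⊎ Fin (n *ℕ n) → Bool
    unitBit v (inj₁ q) = uncurry (λ t i → does (i ≟F left v t)) (remQuot {n} n q)
    unitBit v (inj₂ q) = uncurry (λ t i → does (i ≟F right v t)) (remQuot {n} n q)

    unitBits : Vec (Fin n × Fin n) n → Fin r → Bool
    unitBits v J = unitBit v (splitAt (n *ℕ n) J)

    unitBits-left : ∀ v t i → unitBits v (rowBit true t i) ≡ does (i ≟F left v t)
    unitBits-left v t i = ≡.trans (cong (unitBit v) (splitAt-↑ˡ (n *ℕ n) (combine t i) (n *ℕ n)))
      (cong (uncurry (λ t i → does (i ≟F left v t))) (remQuot-combine t i))

    unitBits-right : ∀ v t i → unitBits v (rowBit false t i) ≡ does (i ≟F right v t)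
    unitBits-right v t i = ≡.trans (cong (unitBit v) (splitAt-↑ʳ (n *ℕ n) (n *ℕ n) (combine t i)))
      (cong (uncurry (λ t i → does (i ≟F right v t))) (remQuot-combine t i))

    -- For each pair of maps a single bit vector matches, so summing over the bits counts every pair
    -- once.
    matches-unit : ∀ e v → matches e v ≡ does (Vec-≡-dec _≟B_ e (tabulate (unitBits v)))
    matches-unit e v = Bool-⇔ forward backward
      where
      forward : matches e v ≡ true → does (Vec-≡-dec _≟B_ e (tabulate (unitBits v))) ≡ true
      forward h = ≡.trans (does-Vec _≟B_ e (unitBits v)) (⇒allᵇ λ J → dec-true (lookup e J ≟B unitBits v J) (agree J (splitAt (n *ℕ n) J) refl))
        where
        both : ∀ t → hit e true t (left v t) ∧ hit e false t (right v t) ≡ true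
        both = allᵇ⇒ {t = λ t → hit e true t (left v t) ∧ hit e false t (right v t)} h
        at-row : ∀ side t i → hit e side t i ≡ true → ∀ l → lookup e (rowBit side t l) ≡ does (l ≟F i)
        at-row side t i hi l = does⇒ (row e side t l ≟B does (l ≟F i)) (allᵇ⇒ {t = λ l → does (row e side t l ≟B does (l ≟F i))} hi l)
        agree : ∀ J S → splitAt (n *ℕ n) J ≡ S → lookup e J ≡ unitBits v J
        agree J (inj₁ q) eq = ≡.subst (λ J → lookup e J ≡ unitBits v J) (≡.trans (cong (_↑ˡ (n *ℕ n)) (combine-remQuot {n} n q)) (splitAt⁻¹-↑ˡ eq))
          (≡.trans (at-row true t (left v t) (∧-⇒ˡ (both t)) i) (≡.sym (unitBits-left v t i)))
          where
          t = proj₁ (remQuot {n} n q)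
          i = proj₂ (remQuot {n} n q)
        agree J (inj₂ q) eq = ≡.subst (λ J → lookup e J ≡ unitBits v J) (≡.trans (cong ((n *ℕ n) ↑ʳ_) (combine-remQuot {n} n q)) (splitAt⁻¹-↑ʳ eq))
          (≡.trans (at-row false t (right v t) (∧-⇒ʳ {hit e true t (left v t)} (both t)) i) (≡.sym (unitBits-right v t i)))
          where
          t = proj₁ (remQuot {n} n q)
          i = proj₂ (remQuot {n} n q)
      backward : does (Vec-≡-dec _≟B_ e (tabulate (unitBits v))) ≡ true → matches e v ≡ true
      backward h = ⇒allᵇ λ t → cong₂ _∧_
        (⇒allᵇ λ l → dec-true (row e true t l ≟B does (l ≟F left v t)) (≡.trans (agree (rowBit true t l)) (unitBits-left v t l)))
        (⇒allᵇ λ l → dec-true (row e false t l ≟B does (l ≟F right v t)) (≡.trans (agree (rowBit false t l)) (unitBits-right v t l)))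
        where
        agree : ∀ J → lookup e J ≡ unitBits v J
        agree J = ≡.trans (cong (λ u → lookup u J) (does⇒ (Vec-≡-dec _≟B_ e (tabulate (unitBits v))) h)) (lookup∘tabulate (unitBits v) J)

    sdet-sum : ∀ k l → sdetM F n m k l ≋ ∑ (vecs r (true ∷ false ∷ [])) (λ e → subst F (plugBits F r e) (summand k l))
    sdet-sum k l = P.sym (begin
      ∑ bits (λ e → subst F (plugBits F r e) (summand k l))
        ≈⟨ P.trans (∑-cong bits λ e → subst-summand e k l) (P.sym (∑-*ˡ bits _ _)) ⟩
      cst (invFactorial n) ⊗ ∑ bits (λ e → ∑ choices (λ v → matches e v ▸ contribution k l v))
        -- Exchanging the sums puts the bits inside, where the guard is an equality with the
        -- encoding of `v` and `Delta-Bits` removes them.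
        ≈⟨ P.*-congˡ (P.trans (∑-swap bits choices _) (∑-cong choices λ v → P.trans (∑-cong bits λ e → ▸-congᵇ _ (matches-unit e v))
             (Delta-Bits r (tabulate (unitBits v)) λ _ → contribution k l v))) ⟩
      cst (invFactorial n) ⊗ ∑ choices (contribution k l)
        ≈⟨ P.*-congˡ unzipped ⟩
      cst (invFactorial n) ⊗ ∑ vs (λ u → isInjective F (lookup u) ▸ ∑ vs (λ v → isInjective F (lookup v) ▸ signedTerm block′ k l (lookup u) (lookup v)))
        ≈⟨ subst-sdet var n m k l ⟨
      subst F var (sdetM F n m k l)
        ≡⟨ subst-var (sdetM F n m k l) ⟩
      sdetM F n m k l ∎)
      where
      bits = vecs r (true ∷ false ∷ [])
      vs   = vecs n (allFin n)
      block′ : Fin n → Fin n → Fin m → Fin m → Poly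
      block′ i j a b = var (yIdx F n m i j a b)
      δ : Delta (FinF n ^F n)
      δ = Delta-Vec (FinF n) (Delta-Fin n) n
      zip : Vec (Fin n) n × Vec (Fin n) n → Vec (Fin n × Fin n) n
      zip (u , v) = tabulate (λ t → lookup u t , lookup v t)
      unzip : Vec (Fin n × Fin n) n → Vec (Fin n) n × Vec (Fin n) n
      unzip v = tabulate (left v) , tabulate (right v)
      left-zip : ∀ u v t → left (zip (u , v)) t ≡ lookup u t
      left-zip u v t = cong proj₁ (lookup∘tabulate (λ t → lookup u t , lookup v t) t)
      right-zip : ∀ u v t → right (zip (u , v)) t ≡ lookup v t
      right-zip u v t = cong proj₂ (lookup∘tabulate (λ t → lookup u t , lookup v t) t)
      unzip-zip : ∀ uv → unzip (zip uv) ≡ uv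
      unzip-zip (u , v) = cong₂ _,_ (≡.trans (tabulate-cong (left-zip u v)) (tabulate∘lookup u)) (≡.trans (tabulate-cong (right-zip u v)) (tabulate∘lookup v))
      zip-unzip : ∀ v → zip (unzip v) ≡ v
      zip-unzip v = ≡.trans (tabulate-cong λ t → cong₂ _,_ (lookup∘tabulate (left v) t) (lookup∘tabulate (right v) t)) (tabulate∘lookup v)
      contribution-zip : ∀ u v → contribution k l (zip (u , v)) ≋ isInjective F (lookup u) ▸ isInjective F (lookup v) ▸ signedTerm block′ k l (lookup u) (lookup v)
      contribution-zip u v = P.trans (▸-congᵇ _ (isInjective-cong (left-zip u v))) (▸-cong (isInjective F (lookup u))
        (P.trans (▸-congᵇ _ (isInjective-cong (right-zip u v))) (▸-cong (isInjective F (lookup v)) (signedTerm-cong block′ k l (left-zip u v) (right-zip u v)))))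
      unzipped : ∑ choices (contribution k l) ≋ ∑ vs (λ u → isInjective F (lookup u) ▸ ∑ vs (λ v → isInjective F (lookup v) ▸ signedTerm block′ k l (lookup u) (lookup v)))
      unzipped = begin
        ∑ choices (contribution k l)
          ≈⟨ ∑-bijection (Choice ^F n) (FinF n ^F n ×F FinF n ^F n) (Delta-Vec Choice (Delta-× (FinF n) (FinF n) (Delta-Fin n) (Delta-Fin n)) n)
               (Delta-× (FinF n ^F n) (FinF n ^F n) δ δ) unzip zip unzip-zip zip-unzip (contribution k l) ⟩
        ∑ (elements (FinF n ^F n ×F FinF n ^F n)) (λ uv → contribution k l (zip uv))
          ≈⟨ ∑-cartesian _,_ vs vs _ ⟩
        ∑ vs (λ u → ∑ vs (λ v → contribution k l (zip (u , v))))
          ≈⟨ ∑-cong vs (λ u → P.trans (∑-cong vs λ v → contribution-zip u v) (P.sym (▸-∑ (isInjective F (lookup u)) vs _))) ⟩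
        _ ∎

    -- Size and degree of the summand

    -- These follow the shape of the `build-` and `bounded-` proofs below. For instance, a literal
    -- takes at most 5 gates and one more to multiply it in, which gives the 6 in `selectSize`; a
    -- pair of selections has degree at most `n + n`.
    varsBound selectSize signSize factorSize summandSize signDegree summandDegree : ℕ
    varsBound     = r +ℕ n *ℕ n *ℕ m *ℕ m
    selectSize    = n *ℕ 6 +ℕ 1
    signSize      = n *ℕ n *ℕ suc (n *ℕ suc (n *ℕ suc (suc (suc (selectSize +ℕ selectSize) +ℕ 1)) +ℕ 1) +ℕ 1) +ℕ 1
    factorSize    = n *ℕ suc (n *ℕ suc (suc (1 +ℕ suc (selectSize +ℕ selectSize))) +ℕ 1) +ℕ 1
    summandSize   = suc (suc (0 +ℕ suc (signSize +ℕ signSize)) +ℕ 1) +ℕ (n *ℕ (m *ℕ (m *ℕ suc (suc factorSize) +ℕ 1)) +ℕ m *ℕ 1)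
    signDegree    = n *ℕ n *ℕ (n +ℕ n)
    summandDegree = signDegree +ℕ signDegree +ℕ n *ℕ (n +ℕ n +ℕ 1)

    length-pairs≤ : length (pairs F n) ≤ n *ℕ n
    length-pairs≤ = ℕₚ.≤-trans (length-filter (λ ij → toℕ (proj₁ ij) <? toℕ (proj₂ ij)) all-pairs)
      (ℕₚ.≤-reflexive (≡.trans (Hardness.length-pairs F (allFin n) (allFin n)) (cong₂ _*ℕ_ (length-tabulate {n = n} id) (length-tabulate {n = n} id))))
      where
      all-pairs : List (Fin n × Fin n)
      all-pairs = concatMap (λ i → map (i ,_) (allFin n)) (allFin n)

    module _ {Γ : Poly → Set c} where
      build-select : ∀ side t i → Build Γ selectSize (_≡ select side t i)
      build-select side t i = build-≤ (ℕₚ.≤-reflexive (cong (λ l → l *ℕ 6 +ℕ 1) (length-tabulate {n = n} id)))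
        (build-∏ (allFin n) λ l → build-literal (does (l ≟F i)) (toℕ (rowBit side t l)))
        where
        build-literal : ∀ b x → Build Γ 5 (_≡ literal b (var x))
        build-literal true  x = build-≤ (s≤s z≤n) (build-var x)
        build-literal false x = build-⊕ (build-cst K.1#) (build-⊗ (build-cst (K.- K.1#)) (build-var x))

      build-signOf : ∀ side → Build Γ signSize (_≡ signOf side)
      build-signOf side = build-≤ (ℕₚ.+-monoˡ-≤ 1 (ℕₚ.*-monoˡ-≤ _ length-pairs≤))
        (build-∏ (pairs F n) λ (t , t′) → build-∑Fin n λ i → build-∑Fin n λ i′ → build-⊗ (build-cst (orientation i i′)) (build-⊗ (build-select side t i) (build-select side t′ i′)))

      build-factorAt : ∀ t a b → Build Γ factorSize (_≡ factorAt t a b)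
      build-factorAt t a b = build-∑Fin n λ i → build-∑Fin n λ j → build-⊗ (build-⊗ (build-select true t i) (build-select false t j)) (build-var _)

      build-summand : ∀ k l → Build Γ summandSize (_≡ summand k l)
      build-summand k l = build-let (build-column factorAt build-factorAt l)
        (build-⊗ (build-cst (invFactorial n)) (build-⊗ (build-weaken inj₁ (build-⊗ (build-signOf true) (build-signOf false))) (build-have (inj₂ (k , ∈-allFin k , refl)))))

    bounded-select : ∀ side t i → Bounded varsBound n (select side t i)
    bounded-select side t i = bounded-≤ (ℕₚ.≤-reflexive (≡.trans (ℕₚ.*-identityʳ _) (length-tabulate {n = n} id)))
      (bounded-∏ (allFin n) λ l → bounded-literal (does (l ≟F i)) (rowBit side t l))
      where
      bounded-literal : ∀ b J → Bounded varsBound 1 (literal b (var (toℕ J)))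
      bounded-literal true  J = bounded-var (ℕₚ.≤-trans (toℕ<n J) (ℕₚ.m≤m+n r _))
      bounded-literal false J = bounded-⊕ (bounded-≤ z≤n (bounded-cst K.1#)) (bounded-⊗ (bounded-cst (K.- K.1#)) (bounded-literal true J))

    bounded-signOf : ∀ side → Bounded varsBound signDegree (signOf side)
    bounded-signOf side = bounded-≤ (ℕₚ.*-monoˡ-≤ (n +ℕ n) length-pairs≤)
      (bounded-∏ (pairs F n) λ (t , t′) → bounded-∑ (allFin n) λ i → bounded-∑ (allFin n) λ i′ →
        bounded-⊗ (bounded-cst (orientation i i′)) (bounded-⊗ (bounded-select side t i) (bounded-select side t′ i′)))

    bounded-summand : ∀ k l → Bounded varsBound summandDegree (summand k l)
    bounded-summand k l = bounded-⊗ (bounded-cst (invFactorial n)) (bounded-⊗ (bounded-⊗ (bounded-signOf true) (bounded-signOf false))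
      (bounded-mprod factorAt (λ t a b → bounded-∑ (allFin n) λ i → bounded-∑ (allFin n) λ j →
        bounded-⊗ (bounded-⊗ (bounded-select true t i) (bounded-select false t j)) (bounded-var (variable< i j a b))) k l))
      where
      variable< : ∀ i j a b → r +ℕ yIdx F n m i j a b < varsBound
      variable< i j a b = ℕₚ.+-monoʳ-< r (≡.subst (_< n *ℕ n *ℕ m *ℕ m) (toℕ-code n m i j a b) (toℕ<n (combine (combine (combine i j) a) b)))

  polyBounded-blockSize : PolyBounded blockSize
  polyBounded-blockSize = PolyBounded-* (PolyBounded-+ (PolyBounded-const 1) PolyBounded-id) PolyBounded-id

  member : InVNP F (TIdx F blockSize) (TSize F blockSize) (TFam F blockSize)
  member = (λ (n , k , l) → summand n k l)
    , ((λ n → suc (suc (summandSize n))) , varsBound , summandDegree , sizes , vars , degrees , λ (n , k , l) →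
        let (k′ , k′< , C , e) = build-circuit (build-summand n k l) in
        varsBelow (bounded-summand n k l) , degLe (bounded-summand n k l) , k′ , k′< , C , at e)
    , (λ n → n *ℕ n +ℕ n *ℕ n) , PolyBounded-+ n² n² , λ (n , k , l) → at (P.trans (sdet-sum n k l) (P.reflexive (≡.sym
        (≡.trans (sumP-map (allBits F (n *ℕ n +ℕ n *ℕ n)) _) (cong (λ bs → ∑ bs (λ e → subst F (plugBits F (n *ℕ n +ℕ n *ℕ n) e) (summand n k l))) (bits≡vecs (n *ℕ n +ℕ n *ℕ n)))))))
    where
    1# : ∀ {f} → PolyBounded f → PolyBounded (λ n → suc (f n))
    1# = PolyBounded-+ (PolyBounded-const 1)
    +1 : ∀ {f} → PolyBounded f → PolyBounded (λ n → f n +ℕ 1)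
    +1 p = PolyBounded-+ p (PolyBounded-const 1)
    n¹ : PolyBounded (λ n → n)
    n¹ = PolyBounded-id
    n² : PolyBounded (λ n → n *ℕ n)
    n² = PolyBounded-* n¹ n¹
    2n : PolyBounded (λ n → n +ℕ n)
    2n = PolyBounded-+ n¹ n¹
    vars : PolyBounded varsBound
    vars = PolyBounded-+ (PolyBounded-+ n² n²) (PolyBounded-* (PolyBounded-* n² polyBounded-blockSize) polyBounded-blockSize)
    signs : PolyBounded signDegree
    signs = PolyBounded-* n² 2n
    degrees : PolyBounded summandDegree
    degrees = PolyBounded-+ (PolyBounded-+ signs signs) (PolyBounded-* n¹ (+1 2n))
    selects : PolyBounded selectSize
    selects = +1 (PolyBounded-* n¹ (PolyBounded-const 6))
    two : PolyBounded (λ n → suc (selectSize n +ℕ selectSize n))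
    two = 1# (PolyBounded-+ selects selects)
    signSizes : PolyBounded signSize
    signSizes = +1 (PolyBounded-* n² (1# (+1 (PolyBounded-* n¹ (1# (+1 (PolyBounded-* n¹ (1# (1# (+1 two))))))))))
    factors : PolyBounded factorSize
    factors = +1 (PolyBounded-* n¹ (1# (+1 (PolyBounded-* n¹ (1# (1# (PolyBounded-+ (PolyBounded-const 1) two)))))))
    sizes : PolyBounded (λ n → suc (suc (summandSize n)))
    sizes = 1# (1# (1# (PolyBounded-+ (+1 (1# (1# (PolyBounded-+ signSizes signSizes))))
      (PolyBounded-+ (PolyBounded-* n¹ (PolyBounded-* polyBounded-blockSize (+1 (PolyBounded-* polyBounded-blockSize (1# (1# factors)))))) (PolyBounded-* polyBounded-blockSize (PolyBounded-const 1))))))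

theorem5p4 : ∀ {c ℓ} (F : CharZeroField c ℓ) →
    Σ[ m ∈ (ℕ → ℕ) ]
    (PolyBounded m ×
    InVNP F (TIdx F m) (TSize F m) (TFam F m) ×
    (∀ (f : ℕ → NCPoly F) → InVNP F ℕ (λ n → n) f →
    CReduces F f (TIdx F m) (TSize F m) (TFam F m)))
theorem5p4 F = Hardness.blockSize F , Membership.polyBounded-blockSize F , Membership.member F , Hardness.hard F
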